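{- Let $(\mathcal{S}^x,H)$ be a finite thick STGQ of order $(s,t)$, where $s$ is odd if $s=t$, and let $\mathbb{S}\le H$ be its group of $t$ symmetries with center $x$. Suppose $(\mathcal{S}^x,H)$ satisfies property (*). Then: (i) for every affine line $L$, every element of $H_L$ fixes every line through the point $\mathrm{proj}_L x$; (ii) for every affine line $L$ and every $\alpha\in H_L\setminus\{\mathrm{id}\}$, the set $[\alpha]$ has size $s/t$; in particular, if $s=t$ is odd, the affine lines fixed by $\alpha$ are exactly the $t$ lines through $\mathrm{proj}_Lx$ different from the line $x\,\mathrm{proj}_Lx$; (iii) $Z(H)=\mathbb{S}$.
   Context: A finite GQ of order $(s,t)$: every line has $s+1$ points, every point lies on $t+1$ lines, and for each point $p$ and line $L$ not through $p$ exactly one point of $L$ is collinear with $p$; thick means $s,t\ge2$. An EGQ $(\mathcal{S}^x,H)$: $H\le\mathrm{Aut}(\mathcal{S})$ fixes every line through $x$ and acts sharply transitively on the points not collinear with $x$. A symmetry with center $x$ fixes every point collinear with $x$; an STGQ is an EGQ of order $(s,t)$ whose elation group contains a group $\mathbb{S}$ of $t$ symmetries with center $x$. Affine lines are lines not through $x$. For an affine line $L$, $\mathrm{proj}_Lx$ is the unique point of $L$ collinear with $x$ and $\mathrm{proj}_xL$ is the line through $x$ and $\mathrm{proj}_Lx$. $H_L$ denotes the stabilizer of $L$ in $H$. For $\alpha\in H_L\setminus\{\mathrm{id}\}$, $[\alpha]$ is the set of points of the line $\mathrm{proj}_xL$ incident with some affine line fixed by $\alpha$. Property (*): whenever an element of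 $H$ fixes a point $y$ collinear with $x$, $y\neq x$, it fixes every point of the line $xy$. -}

module Defs where

open import Data.Nat using (ℕ; suc; _*_; _%_; _≤_)
open import Data.Fin using (Fin)
open import Data.Bool using (Bool; T)
open import Data.Product using (Σ; ∃; _×_; _,_; proj₁; proj₂)
open import Data.Sum using (_⊎_)
open import Relation.Nullary using (¬_)
open import Relation.Binary.PropositionalEquality using (_≡_; _≢_)
open import Function.Bundles using (_↔_; Inverse; _⇔_)
open import Function.Definitions using (Injective)

-- Cardinality of a (not necessarily propositional) predicate on Fin n:
-- the elements satisfying P are exactly the image of an injection Fin k → Fin n.

CardIs : ∀ {n} → (Fin n → Set) → ℕ → Set
CardIs {n} P k =
  Σ (Fin k → Fin n) λ f →
    Injective _≡_ _≡_ f × (∀ i → P (f i)) × (∀ p → P p → ∃ λ i → f i ≡ p)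

record IncStr : Set where
  field
    nP nL : ℕ
    inc   : Fin nP → Fin nL → Bool

  Pt Ln : Set
  Pt = Fin nP
  Ln = Fin nL

  _I_ : Pt → Ln → Set
  p I L = T (inc p L)

  -- p and q are collinear (a point is collinear with itself)
  Col : Pt → Pt → Set
  Col p q = ∃ λ L → p I L × q I L

record IsGQ (S : IncStr) (s t : ℕ) : Set where
  open IncStr S
  field
    linePts  : ∀ L → CardIs (λ p → p I L) (suc s)
    ptLines  : ∀ p → CardIs (λ L → p I L) (suc t)
    partial  : ∀ p q L M → p I L → q I L → p I M → q I M → p ≡ q ⊎ L ≡ M
    gqAxiom  : ∀ p L → ¬ (p I L) →
               Σ (Σ Pt λ q → q I L × Col p q)
                 (λ w → ∀ q' → q' I L → Col p q' → proj₁ w ≡ q')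

  projPt : (x : Pt) (L : Ln) → ¬ (x I L) → Pt
  projPt x L nx = proj₁ (proj₁ (gqAxiom x L nx))

  projLn : (x : Pt) (L : Ln) → ¬ (x I L) → Ln
  projLn x L nx = proj₁ (proj₂ (proj₂ (proj₁ (gqAxiom x L nx))))

Thick : ℕ → ℕ → Set
Thick s t = 2 ≤ s × 2 ≤ t

record Aut (S : IncStr) : Set where
  open IncStr S
  field
    πP   : Pt ↔ Pt
    πL   : Ln ↔ Ln
    pres : ∀ p L → inc p L ≡ inc (Inverse.to πP p) (Inverse.to πL L)

  ap : Pt → Pt
  ap = Inverse.to πP
  al : Ln → Ln
  al = Inverse.to πL

module _ {S : IncStr} where
  open IncStr S
  open Aut

  _≈A_ : Aut S → Aut S → Set
  α ≈A β = (∀ p → ap α p ≡ ap β p) × (∀ L → al α L ≡ al β L)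

  IsComp : Aut S → Aut S → Aut S → Set
  IsComp γ α β = (∀ p → ap γ p ≡ ap α (ap β p)) × (∀ L → al γ L ≡ al α (al β L))

  IsIdA : Aut S → Set
  IsIdA γ = (∀ p → ap γ p ≡ p) × (∀ L → al γ L ≡ L)

  IsInvA : Aut S → Aut S → Set
  IsInvA γ α = IsIdA' × (∀ L → al γ (al α L) ≡ L)
    where IsIdA' = ∀ p → ap γ (ap α p) ≡ p

  record IsSubgroup (H : Aut S → Set) : Set where
    field
      resp  : ∀ {α β} → α ≈A β → H α → H β
      hasId : ∃ λ γ → H γ × IsIdA γ
      comp  : ∀ {α β} → H α → H β → ∃ λ γ → H γ × IsComp γ α β
      inv   : ∀ {α} → H α → ∃ λ γ → H γ × IsInvA γ α

  CardA : (Aut S → Set) → ℕ → Set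
  CardA P k =
    Σ (Fin k → Aut S) λ f →
      (∀ i j → f i ≈A f j → i ≡ j) × (∀ i → P (f i)) × (∀ α → P α → ∃ λ i → α ≈A f i)

  Commute : Aut S → Aut S → Set
  Commute α β = (∀ p → ap α (ap β p) ≡ ap β (ap α p)) × (∀ L → al α (al β L) ≡ al β (al α L))

  IsSymmetry : Pt → Aut S → Set
  IsSymmetry x α = ∀ y → Col x y → ap α y ≡ y

  record IsEGQ (x : Pt) (H : Aut S → Set) : Set where
    field
      subgroup  : IsSubgroup H
      fixLines  : ∀ α → H α → ∀ L → x I L → al α L ≡ L
      transitive : ∀ y z → ¬ Col x y → ¬ Col x z → ∃ λ α → H α × ap α y ≡ z
      sharp     : ∀ α β y → H α → H β → ¬ Col x y → ap α y ≡ ap β y → α ≈A β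

  record IsSTGQ (x : Pt) (H 𝕊 : Aut S → Set) (t : ℕ) : Set where
    field
      egq       : IsEGQ x H
      𝕊-sub     : IsSubgroup 𝕊
      𝕊⊆H       : ∀ α → 𝕊 α → H α
      𝕊-sym     : ∀ α → 𝕊 α → IsSymmetry x α
      𝕊-card    : CardA 𝕊 t

  Star : Pt → (Aut S → Set) → Set
  Star x H = ∀ α → H α → ∀ y → Col x y → y ≢ x → ap α y ≡ y →
             ∀ M → x I M → y I M → ∀ z → z I M → ap α z ≡ z

  Bracket : ∀ {s t} → IsGQ S s t → (x : Pt) (L : Ln) → ¬ (x I L) → Aut S → Pt → Set
  Bracket G x L nx α p =
    p I IsGQ.projLn G x L nx × ∃ λ M → ¬ (x I M) × p I M × al α M ≡ M

{-# OPTIONS --safe #-}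

-- Fix a point y not collinear with x and identify H with the orbit of y.  The stabilisers A k of the
-- t + 1 lines on y form a Kantor family, and by (*) the groups A* k = A k S are normal, S being the
-- group of symmetries.  Hence H / S is abelian.
--
-- H is a p-group: if G ≤ H has index prime to p then each A k fixes a coset of G, so by counting some
-- conjugate of G contains enough of the A k to act on a subquadrangle, which is too large unless
-- G = H.  The class equation then yields a central chain.
--
-- For 1 ≠ a ∈ A i the commutators [a , h] fill S modulo any N ⊇ [H , S] + [a , H]: for odd t since
-- b b′ ∈ a c N (c ∈ S ∖ N) defines a graph with t ∣N∣ ordered edges on the elements of the other
-- components, for even t by the divisibility of the trace of an integer matrix M with M² = m M.
--
-- Going down the central chain, the Hall–Witt identity then shows that S is central, and that every
-- 1 ≠ a ∈ A i has [a , H] = S, so that ∣C(a)∣ = s².  All three statements are read off from this.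
module Submission where

open import Defs
open import Data.Nat using (ℕ; _*_; _%_)
open import Data.Product using (Σ; ∃; _×_)
open import Relation.Nullary using (¬_)
open import Relation.Binary.PropositionalEquality using (_≡_; _≢_)
open import Function.Bundles using (_⇔_)

open import Algebra.Bundles using (Group)
open import Algebra.Structures using (IsCommutativeMonoid; IsGroup)
open import Data.Bool.Base using (Bool; true; false; if_then_else_; T; _xor_; _∧_)
open import Data.Bool.Properties using (T?)
open import Data.Empty using (⊥; ⊥-elim)
open import Data.Fin.Base using (Fin; zero; suc; toℕ; fromℕ<)
open import Data.Fin.Properties using (_≟_; any?; all?; pigeonhole; toℕ<n; toℕ-fromℕ<; toℕ-injective)
import Data.Integer.Base as ℤ
open ℤ using (ℤ; 0ℤ; 1ℤ; -1ℤ)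
import Data.Integer.Divisibility.Signed as ℤ
import Data.Integer.Properties as ℤ
open import Data.Integer.Tactic.RingSolver using (solve-∀)
open import Data.List.Base using (List; []; _∷_)
open import Data.List.Relation.Unary.All using (All; []; _∷_)
open import Data.Nat.Base hiding (_!; ℕ; _*_; _%_; _/_)
open import Data.Nat.Coprimality using (Coprime; coprime-divisor)
open import Data.Nat.Divisibility
open import Data.Nat.DivMod using (_/_; m≡m%n+[m/n]*n; m%n<n)
open import Data.Nat.ListAction using (product)
open import Data.Nat.Primality using (Prime; prime?; euclidsLemma; prime⇒irreducible; prime⇒nonTrivial)
open import Data.Nat.Primality.Factorisation using (PrimeFactorisation; factorise)
open import Data.Nat.Properties hiding (_≟_)
open import Data.Nat.Properties using () renaming (_≟_ to _≟ₙ_)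
open import Data.Product.Base using (_,_; proj₁; proj₂)
open import Data.Sum.Base using (_⊎_; inj₁; inj₂)
open import Data.Unit.Base using (⊤; tt)
open import Data.Vec.Base using (Vec; []; _∷_; lookup)
open import Function.Base using (_∘_; id)
open import Function.Bundles using (Inverse; mk⇔)
open import Level using (0ℓ)
open import Relation.Binary.PropositionalEquality
  using (refl; sym; trans; cong; cong₂; subst; subst₂; isEquivalence; module ≡-Reasoning)
import Relation.Binary.Reasoning.Setoid as SetoidReasoning
open import Relation.Nullary using (Dec; yes; no; does)
open import Relation.Nullary.Decidable using (_×-dec_; _⊎-dec_; ¬?; _→-dec_; from-yes)
open import Relation.Nullary.Negation using (contradiction)
open import Relation.Unary using (Decidable)


-- At the outset `S` is not even known to be abelian, so `h ↦ [a , h]` is no homomorphism and its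
-- values need not form a subgroup. This is why the filling of `S` is stated for subgroups `N` that
-- absorb all commutators with `S`. Later `N` is the centraliser in `S` of some element `x`: as soon
-- as the commutators of a single `a` commute with `x`, all of `S` does.
--
-- The subquadrangle attached to a proper `G` has order (s , w) with w = ∣S ∩ G∣. The bounds s w ≤ t
-- ≤ s leave only w = 1, with s = t equal to the index of `G`; this index is then a multiple of p
-- after all.
--
-- For even t, the trace obtained from `ΣK` alone would be n (t + 1), and its divisibility by t (s +
-- t) says nothing if, for instance, s = t². The factor 1 - a lowers the diagonal entry from t + 1
-- to t, so that s + t divides a power of 2. With s = 2 ^ f this is impossible for t < s but not for
-- t = s: here the parity assumption enters.

module Sum {A : Set} {_∙_ : A → A → A} {ε : A} (cm : IsCommutativeMonoid _≡_ _∙_ ε) where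
  open IsCommutativeMonoid cm using (assoc; comm; identityˡ)

  sum : ∀ {n} → (Fin n → A) → A
  sum {zero}  f = ε
  sum {suc n} f = f zero ∙ sum (f ∘ suc)

  sum-cong-≗ : ∀ {n} {f g : Fin n → A} → (∀ i → f i ≡ g i) → sum f ≡ sum g
  sum-cong-≗ {zero}  h = refl
  sum-cong-≗ {suc n} h = cong₂ _∙_ (h zero) (sum-cong-≗ (h ∘ suc))

  sum-ε : ∀ n → sum {n} (λ _ → ε) ≡ ε
  sum-ε zero    = refl
  sum-ε (suc n) = trans (identityˡ _) (sum-ε n)

  interchange : ∀ a b c d → ((a ∙ b) ∙ (c ∙ d)) ≡ ((a ∙ c) ∙ (b ∙ d))
  interchange a b c d = trans (assoc a b (c ∙ d)) (trans (cong (a ∙_)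
    (trans (sym (assoc b c d)) (trans (cong (_∙ d) (comm b c)) (assoc c b d)))) (sym (assoc a c (b ∙ d))))

  ∑-distrib-+ : ∀ {n} (f g : Fin n → A) → sum (λ i → f i ∙ g i) ≡ (sum f ∙ sum g)
  ∑-distrib-+ {zero}  f g = sym (identityˡ ε)
  ∑-distrib-+ {suc n} f g = trans (cong ((f zero ∙ g zero) ∙_) (∑-distrib-+ (f ∘ suc) (g ∘ suc)))
                                    (interchange _ _ _ _)

  ∑-comm : ∀ {m n} (f : Fin m → Fin n → A) → sum (λ i → sum (f i)) ≡ sum (λ j → sum (λ i → f i j))
  ∑-comm {zero}  {n} f = sym (sum-ε n)
  ∑-comm {suc m} f = trans (cong (sum (f zero) ∙_) (∑-comm (f ∘ suc)))
                             (sym (∑-distrib-+ (f zero) (λ j → sum (λ i → f (suc i) j))))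

open Sum +-0-isCommutativeMonoid public

-- Counting decidable subsets of finite sets

ind : ∀ {P : Set} → Dec P → ℕ
ind d = if does d then 1 else 0

# : ∀ {n} {P : Fin n → Set} → Decidable P → ℕ
# P? = sum (λ i → ind (P? i))

ind-yes : ∀ {P : Set} (d : Dec P) → P → ind d ≡ 1
ind-yes (yes _) _ = refl
ind-yes (no ¬p) p = contradiction p ¬p

ind-no : ∀ {P : Set} (d : Dec P) → ¬ P → ind d ≡ 0
ind-no (yes p) ¬p = contradiction p ¬p
ind-no (no _)  _  = refl

ind-mono : ∀ {P Q : Set} (d : Dec P) (e : Dec Q) → (P → Q) → ind d ≤ ind e
ind-mono (yes p) e f = ≤-reflexive (sym (ind-yes e (f p)))
ind-mono (no _)  e f = z≤n

ind-cong : ∀ {P Q : Set} (d : Dec P) (e : Dec Q) → (P → Q) → (Q → P) → ind d ≡ ind e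
ind-cong d e f g = ≤-antisym (ind-mono d e f) (ind-mono e d g)

ind-× : ∀ {P Q : Set} (d : Dec P) (e : Dec Q) → ind (d ×-dec e) ≡ ind d * ind e
ind-× (yes _) (yes _) = refl
ind-× (yes _) (no _)  = refl
ind-× (no _)  _       = refl

sum-mono : ∀ {n} {f g : Fin n → ℕ} → (∀ i → f i ≤ g i) → sum f ≤ sum g
sum-mono {zero}  h = z≤n
sum-mono {suc n} h = +-mono-≤ (h zero) (sum-mono (h ∘ suc))

sum-*ˡ : ∀ {n} c (f : Fin n → ℕ) → sum (λ i → c * f i) ≡ c * sum f
sum-*ˡ {zero}  c f = sym (*-zeroʳ c)
sum-*ˡ {suc n} c f = trans (cong (c * f zero +_) (sum-*ˡ c (f ∘ suc)))
                           (sym (*-distribˡ-+ c (f zero) (sum (f ∘ suc))))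

sum-0 : ∀ n → sum {n} (λ _ → 0) ≡ 0
sum-0 zero    = refl
sum-0 (suc n) = sum-0 n

sum-const : ∀ n c → sum {n} (λ _ → c) ≡ n * c
sum-const zero    c = refl
sum-const (suc n) c = cong (c +_) (sum-const n c)

sum-≥ : ∀ {n} (f : Fin n → ℕ) i → f i ≤ sum f
sum-≥ {suc n} f zero    = m≤m+n (f zero) _
sum-≥ {suc n} f (suc i) = ≤-trans (sum-≥ (f ∘ suc) i) (m≤n+m _ (f zero))

module _ {n} {P Q : Fin n → Set} (P? : Decidable P) (Q? : Decidable Q) where

  #-mono : (∀ x → P x → Q x) → # P? ≤ # Q?
  #-mono f = sum-mono (λ i → ind-mono (P? i) (Q? i) (f i))

  #-cong : (∀ x → P x → Q x) → (∀ x → Q x → P x) → # P? ≡ # Q?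
  #-cong f g = sum-cong-≗ (λ i → ind-cong (P? i) (Q? i) (f i) (g i))

#-all : ∀ {n} {P : Fin n → Set} (P? : Decidable P) → (∀ x → P x) → # P? ≡ n
#-all {n} P? f = trans (sum-cong-≗ (λ i → ind-yes (P? i) (f i)))
                       (trans (sum-const n 1) (*-identityʳ n))

whole : ∀ {n} → Decidable (λ (_ : Fin n) → ⊤)
whole _ = yes tt

#-whole : ∀ {n} → # (whole {n}) ≡ n
#-whole = #-all whole (λ _ → tt)

#-none : ∀ {n} {P : Fin n → Set} (P? : Decidable P) → (∀ x → ¬ P x) → # P? ≡ 0
#-none {n} P? f = trans (sum-cong-≗ (λ i → ind-no (P? i) (f i))) (sum-0 n)

#-∃ : ∀ {n} {P : Fin n → Set} (P? : Decidable P) {x} → P x → 1 ≤ # P?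
#-∃ P? {x} p = ≤-trans (≤-reflexive (sym (ind-yes (P? x) p))) (sum-≥ (λ i → ind (P? i)) x)

#-! : ∀ {n} {P : Fin n → Set} (P? : Decidable P) → (∀ x y → P x → P y → x ≡ y) → # P? ≤ 1
#-! {zero}  P? u = z≤n
#-! {suc n} P? u with P? zero
... | no _  = #-! (P? ∘ suc) (λ x y p q → suc-inj (u (suc x) (suc y) p q))
  where suc-inj : ∀ {k} {x y : Fin k} → Fin.suc x ≡ suc y → x ≡ y
        suc-inj refl = refl
... | yes p = ≤-reflexive (cong suc (#-none (P? ∘ suc) (λ x q → 0≢s (u zero (suc x) p q))))
  where 0≢s : ∀ {k} {x : Fin k} → Fin.zero ≢ suc x
        0≢s ()

#-witness : ∀ {n} {P : Fin n → Set} (P? : Decidable P) → 1 ≤ # P? → ∃ P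
#-witness P? h with any? P?
... | yes w = w
... | no ¬w = contradiction h (<⇒≱ (≤-reflexive (cong suc (#-none P? (λ x p → ¬w (x , p))))))

#-unique : ∀ {n} {P : Fin n → Set} (P? : Decidable P) {x} → P x → (∀ y → P y → y ≡ x) → # P? ≡ 1
#-unique P? p u = ≤-antisym (#-! P? (λ y z q r → trans (u y q) (sym (u z r)))) (#-∃ P? p)

module _ {m n} {P : Fin m → Set} {Q : Fin n → Set} {R : Fin m → Fin n → Set}
         (P? : Decidable P) (Q? : Decidable Q) (R? : ∀ x y → Dec (R x y)) where

  row : ∀ x → Decidable (λ y → Q y × R x y)
  row x y = Q? y ×-dec R? x y

  col : ∀ y → Decidable (λ x → P x × R x y)
  col y x = P? x ×-dec R? x y

  -- Both sides sum the indicator of `P x × Q y × R x y`, in the two possible orders.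
  rows≡cols : sum (λ x → ind (P? x) * # (row x)) ≡ sum (λ y → ind (Q? y) * # (col y))
  rows≡cols = begin
    sum (λ x → ind (P? x) * # (row x))
      ≡⟨ sum-cong-≗ (λ x → sym (sum-*ˡ (ind (P? x)) (λ y → ind (row x y)))) ⟩
    sum (λ x → sum (λ y → ind (P? x) * ind (row x y)))
      ≡⟨ ∑-comm (λ x y → ind (P? x) * ind (row x y)) ⟩
    sum (λ y → sum (λ x → ind (P? x) * ind (row x y)))
      ≡⟨ sum-cong-≗ (λ y → sum-cong-≗ (λ x → swap x y)) ⟩
    sum (λ y → sum (λ x → ind (Q? y) * ind (col y x)))
      ≡⟨ sum-cong-≗ (λ y → sum-*ˡ (ind (Q? y)) (λ x → ind (col y x))) ⟩
    sum (λ y → ind (Q? y) * # (col y)) ∎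
    where
    open ≡-Reasoning
    swap : ∀ x y → ind (P? x) * ind (row x y) ≡ ind (Q? y) * ind (col y x)
    swap x y = begin
      ind (P? x) * ind (row x y)               ≡⟨ cong (ind (P? x) *_) (ind-× (Q? y) (R? x y)) ⟩
      ind (P? x) * (ind (Q? y) * ind (R? x y)) ≡⟨ sym (*-assoc (ind (P? x)) (ind (Q? y)) _) ⟩
      ind (P? x) * ind (Q? y) * ind (R? x y)   ≡⟨ cong (_* ind (R? x y)) (*-comm (ind (P? x)) (ind (Q? y))) ⟩
      ind (Q? y) * ind (P? x) * ind (R? x y)   ≡⟨ *-assoc (ind (Q? y)) (ind (P? x)) _ ⟩
      ind (Q? y) * (ind (P? x) * ind (R? x y)) ≡⟨ cong (ind (Q? y) *_) (sym (ind-× (P? x) (R? x y))) ⟩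
      ind (Q? y) * ind (col y x) ∎

  rows≥ : ∀ a → (∀ x → P x → a ≤ # (row x)) → a * # P? ≤ sum (λ x → ind (P? x) * # (row x))
  rows≥ a h = begin
    a * # P?                           ≡⟨ sym (sum-*ˡ a (λ x → ind (P? x))) ⟩
    sum (λ x → a * ind (P? x))         ≤⟨ sum-mono step ⟩
    sum (λ x → ind (P? x) * # (row x)) ∎
    where
    open ≤-Reasoning
    step : ∀ x → a * ind (P? x) ≤ ind (P? x) * # (row x)
    step x with P? x
    ... | yes p = ≤-trans (≤-reflexive (*-identityʳ a)) (≤-trans (h x p) (≤-reflexive (sym (+-identityʳ _))))
    ... | no  _ = ≤-reflexive (*-zeroʳ a)

  cols≤ : ∀ b → (∀ y → Q y → # (col y) ≤ b) → sum (λ y → ind (Q? y) * # (col y)) ≤ b * # Q?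
  cols≤ b h = begin
    sum (λ y → ind (Q? y) * # (col y)) ≤⟨ sum-mono step ⟩
    sum (λ y → b * ind (Q? y))         ≡⟨ sum-*ˡ b (λ y → ind (Q? y)) ⟩
    b * # Q?                           ∎
    where
    open ≤-Reasoning
    step : ∀ y → ind (Q? y) * # (col y) ≤ b * ind (Q? y)
    step y with Q? y
    ... | yes q = ≤-trans (≤-reflexive (+-identityʳ _)) (≤-trans (h y q) (≤-reflexive (sym (*-identityʳ b))))
    ... | no  _ = z≤n

  double-≤ : ∀ a b → (∀ x → P x → a ≤ # (row x)) → (∀ y → Q y → # (col y) ≤ b) → a * # P? ≤ b * # Q?
  double-≤ a b f g = ≤-trans (rows≥ a f) (≤-trans (≤-reflexive rows≡cols) (cols≤ b g))

module _ {m n} {P : Fin m → Set} {Q : Fin n → Set} {R : Fin m → Fin n → Set}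
         (P? : Decidable P) (Q? : Decidable Q) (R? : ∀ x y → Dec (R x y)) where

  -- With `a = 1` the relation is a function from `P` onto `Q` with fibres of size `b`; most orders
  -- below are computed in this way.
  double-≡ : ∀ a b → (∀ x → P x → # (row P? Q? R? x) ≡ a) → (∀ y → Q y → # (col P? Q? R? y) ≡ b) →
             a * # P? ≡ b * # Q?
  double-≡ a b f g = ≤-antisym
    (double-≤ P? Q? R? a b (λ x p → ≤-reflexive (sym (f x p))) (λ y q → ≤-reflexive (g y q)))
    (double-≤ Q? P? (λ y x → R? x y) b a (λ y q → ≤-reflexive (sym (g y q))) (λ x p → ≤-reflexive (f x p)))

module _ {m n} {P : Fin m → Set} {Q : Fin n → Set} (P? : Decidable P) (Q? : Decidable Q) where

  #-inj : (f : Fin m → Fin n) → (∀ x → P x → Q (f x)) →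
          (∀ x y → P x → P y → f x ≡ f y → x ≡ y) → # P? ≤ # Q?
  #-inj f pq inj = begin
    # P?     ≡⟨ sym (*-identityˡ _) ⟩
    1 * # P? ≤⟨ double-≤ P? Q? (λ x y → f x ≟ y) 1 1
                  (λ x p → #-∃ (row P? Q? (λ x y → f x ≟ y) x) (pq x p , refl))
                  (λ y q → #-! (col P? Q? (λ x y → f x ≟ y) y)
                             (λ { x x′ (p , e) (p′ , e′) → inj x x′ p p′ (trans e (sym e′)) })) ⟩
    1 * # Q? ≡⟨ *-identityˡ _ ⟩
    # Q?     ∎
    where open ≤-Reasoning

#-bij : ∀ {m n} {P : Fin m → Set} {Q : Fin n → Set} (P? : Decidable P) (Q? : Decidable Q)
        (f : Fin m → Fin n) (g : Fin n → Fin m) →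
        (∀ x → P x → Q (f x)) → (∀ y → Q y → P (g y)) →
        (∀ x → P x → g (f x) ≡ x) → (∀ y → Q y → f (g y) ≡ y) → # P? ≡ # Q?
#-bij P? Q? f g pq qp gf fg = ≤-antisym
  (#-inj P? Q? f pq (λ x y p q e → trans (sym (gf x p)) (trans (cong g e) (gf y q))))
  (#-inj Q? P? g qp (λ x y p q e → trans (sym (fg x p)) (trans (cong f e) (fg y q))))

#-split : ∀ {n} {P Q : Fin n → Set} (P? : Decidable P) (Q? : Decidable Q) →
          # P? ≡ # (λ x → P? x ×-dec Q? x) + # (λ x → P? x ×-dec ¬? (Q? x))
#-split P? Q? = trans (sum-cong-≗ (λ x → lem (P? x) (Q? x)))
                      (∑-distrib-+ (λ x → ind (P? x ×-dec Q? x)) (λ x → ind (P? x ×-dec ¬? (Q? x))))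
  where
  lem : ∀ {A B : Set} (a : Dec A) (b : Dec B) → ind a ≡ ind (a ×-dec b) + ind (a ×-dec ¬? b)
  lem (yes _) (yes _) = refl
  lem (yes _) (no _)  = refl
  lem (no _)  _       = refl

#-full : ∀ {n} {P Q : Fin n → Set} (P? : Decidable P) (Q? : Decidable Q) →
         (∀ x → P x → Q x) → # Q? ≤ # P? → ∀ x → Q x → P x
#-full {P = P} {Q} P? Q? sub h x q with P? x
... | yes p = p
... | no ¬p = contradiction h (<⇒≱ (begin
        suc (# P?)   ≤⟨ +-mono-≤ (#-∃ Q∖P? {x} (q , ¬p)) ≤-refl ⟩
        # Q∖P? + # P? ≡⟨ +-comm _ (# P?) ⟩
        # P? + # Q∖P? ≡⟨ cong (_+ # Q∖P?) (#-cong P? (λ y → Q? y ×-dec P? y) (λ y p → sub y p , p) (λ y → proj₂)) ⟩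
        # (λ y → Q? y ×-dec P? y) + # Q∖P? ≡⟨ sym (#-split Q? P?) ⟩
        # Q? ∎))
  where
  open ≤-Reasoning
  Q∖P? : Decidable (λ y → Q y × ¬ P y)
  Q∖P? y = Q? y ×-dec ¬? (P? y)

-- Splitting off index zero leaves its row and its column, equal by symmetry, and a smaller
-- symmetric matrix.
2∣-handshake : ∀ {n} (f : Fin n → Fin n → ℕ) → (∀ i j → f i j ≡ f j i) → (∀ i → f i i ≡ 0) →
              2 ∣ sum (λ i → sum (f i))
2∣-handshake {zero}  f s d = 2 ∣0
2∣-handshake {suc n} f s d = subst (2 ∣_) (sym eq)
  (∣m∣n⇒∣m+n (m∣m*n {2} (sum (f zero ∘ suc)))
             (2∣-handshake (λ i j → f (suc i) (suc j)) (λ i j → s (suc i) (suc j)) (d ∘ suc)))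
  where
  open ≡-Reasoning
  A = sum (f zero ∘ suc)
  B = sum (λ i → sum (λ j → f (suc i) (suc j)))
  eq : sum (λ i → sum (f i)) ≡ 2 * A + B
  eq = begin
    (f zero zero + A) + sum (λ i → f (suc i) zero + sum (λ j → f (suc i) (suc j)))
      ≡⟨ cong₂ _+_ (cong (_+ A) (d zero)) (∑-distrib-+ (λ i → f (suc i) zero) _) ⟩
    A + (sum (λ i → f (suc i) zero) + B)
      ≡⟨ cong (λ z → A + (z + B)) (sum-cong-≗ (λ i → s (suc i) zero)) ⟩
    A + (A + B)
      ≡⟨ sym (+-assoc A A B) ⟩
    A + A + B
      ≡⟨ cong (λ z → A + z + B) (sym (+-identityʳ A)) ⟩
    2 * A + B ∎

-- Quotients of finite sets by decidable equivalences

record Quotient {n} (_~_ : Fin n → Fin n → Set) : Set where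
  field
    size    : ℕ
    class   : Fin n → Fin size
    rep     : Fin size → Fin n
    class-rep : ∀ c → class (rep c) ≡ c
    sound   : ∀ {x y} → x ~ y → class x ≡ class y
    exact   : ∀ {x y} → class x ≡ class y → x ~ y

-- Induction on `n`: the element `zero` joins the class of a later element or opens a new one.
quotientBy : ∀ {n} {_~_ : Fin n → Fin n → Set} → (∀ x y → Dec (x ~ y)) → (∀ {x} → x ~ x) →
           (∀ {x y} → x ~ y → y ~ x) → (∀ {x y z} → x ~ y → y ~ z → x ~ z) → Quotient _~_
quotientBy {zero} d r s t = record
  { size = 0 ; class = λ () ; rep = λ () ; class-rep = λ () ; sound = λ { {()} } ; exact = λ { {()} } }
quotientBy {suc n} {_~_} d r s t with quotientBy (λ x y → d (suc x) (suc y)) r s t | any? (λ j → d zero (suc j))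
... | q | yes (j , 0~j) = record
  { size = size ; class = cl ; rep = suc ∘ rep ; class-rep = class-rep ; sound = so _ _ ; exact = ex _ _ }
  where
  open Quotient q
  cl : Fin (suc n) → Fin size
  cl zero    = class j
  cl (suc x) = class x
  so : ∀ x y → x ~ y → cl x ≡ cl y
  so zero    zero    _ = refl
  so zero    (suc y) e = sound (t (s 0~j) e)
  so (suc x) zero    e = sound (t e 0~j)
  so (suc x) (suc y) e = sound e
  ex : ∀ x y → cl x ≡ cl y → x ~ y
  ex zero    zero    _ = r
  ex zero    (suc y) e = t 0~j (exact e)
  ex (suc x) zero    e = t (exact e) (s 0~j)
  ex (suc x) (suc y) e = exact e
... | q | no ¬j = record
  { size = suc size ; class = cl ; rep = rp ; class-rep = cr ; sound = so _ _ ; exact = ex _ _ }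
  where
  open Quotient q
  cl : Fin (suc n) → Fin (suc size)
  cl zero    = zero
  cl (suc x) = suc (class x)
  rp : Fin (suc size) → Fin (suc n)
  rp zero    = zero
  rp (suc c) = suc (rep c)
  cr : ∀ c → cl (rp c) ≡ c
  cr zero    = refl
  cr (suc c) = cong suc (class-rep c)
  so : ∀ x y → x ~ y → cl x ≡ cl y
  so zero    zero    _ = refl
  so zero    (suc y) e = ⊥-elim (¬j (y , e))
  so (suc x) zero    e = ⊥-elim (¬j (x , s e))
  so (suc x) (suc y) e = cong suc (sound e)
  unsuc : ∀ {k} {x y : Fin k} → Fin.suc x ≡ suc y → x ≡ y
  unsuc refl = refl
  ex : ∀ x y → cl x ≡ cl y → x ~ y
  ex zero    zero    _ = r
  ex (suc x) (suc y) e = exact (unsuc e)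

-- Integer sums and traces of scaled idempotents

module ℤΣ = Sum ℤ.+-0-isCommutativeMonoid

∑ : ∀ {n} → (Fin n → ℤ) → ℤ
∑ = ℤΣ.sum

∑-cong : ∀ {n} {f g : Fin n → ℤ} → (∀ i → f i ≡ g i) → ∑ f ≡ ∑ g
∑-cong = ℤΣ.sum-cong-≗

∑-+ : ∀ {n} (f g : Fin n → ℤ) → ∑ (λ i → f i ℤ.+ g i) ≡ ∑ f ℤ.+ ∑ g
∑-+ = ℤΣ.∑-distrib-+

∑-*ˡ : ∀ {n} c (f : Fin n → ℤ) → ∑ (λ i → c ℤ.* f i) ≡ c ℤ.* ∑ f
∑-*ˡ {zero}  c f = sym (ℤ.*-zeroʳ c)
∑-*ˡ {suc n} c f = trans (cong (λ z → c ℤ.* f zero ℤ.+ z) (∑-*ˡ c (f ∘ suc))) (sym (ℤ.*-distribˡ-+ c (f zero) _))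

∑-zero : ∀ {n} {f : Fin n → ℤ} → (∀ i → f i ≡ 0ℤ) → ∑ f ≡ 0ℤ
∑-zero {n} h = trans (∑-cong h) (ℤΣ.sum-ε n)

∑-swap : ∀ {m n} (f : Fin m → Fin n → ℤ) → ∑ (λ i → ∑ (f i)) ≡ ∑ (λ j → ∑ (λ i → f i j))
∑-swap = ℤΣ.∑-comm

-- If M² = m M, one elimination step c M − (column j)(row i), where c = M i j ≠ 0, kills
-- column j, preserves the hypothesis with c m for m and turns the trace τ into c (τ − m).
module _ {n : ℕ} where

  Matrix : Set
  Matrix = Fin n → Fin n → ℤ

  trace : Matrix → ℤ
  trace M = ∑ (λ i → M i i)

  Scaled-Idempotent : Matrix → ℤ → Set
  Scaled-Idempotent M m = ∀ i k → ∑ (λ j → M i j ℤ.* M j k) ≡ m ℤ.* M i k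

  module Elimination (M : Matrix) (m : ℤ) (i j : Fin n) (h : Scaled-Idempotent M m) where

    c : ℤ
    c = M i j

    M′ : Matrix
    M′ a b = c ℤ.* M a b ℤ.- M a j ℤ.* M i b

    column-j : ∀ a → M′ a j ≡ 0ℤ
    column-j a = lem c (M a j)
      where lem : ∀ x y → x ℤ.* y ℤ.- y ℤ.* x ≡ 0ℤ
            lem = solve-∀

    scaled : Scaled-Idempotent M′ (c ℤ.* m)
    scaled a d = begin
      ∑ (λ b → M′ a b ℤ.* M′ b d)
        ≡⟨ ∑-cong (λ b → expand c (M a b) (M a j) (M i b) (M b d) (M b j) (M i d)) ⟩
      ∑ (λ b → (w ℤ.* T₁ b ℤ.+ x ℤ.* T₂ b) ℤ.+ (y ℤ.* T₃ b ℤ.+ z ℤ.* T₄ b))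
        ≡⟨ ∑-+ {n} _ _ ⟩
      ∑ (λ b → w ℤ.* T₁ b ℤ.+ x ℤ.* T₂ b) ℤ.+ ∑ (λ b → y ℤ.* T₃ b ℤ.+ z ℤ.* T₄ b)
        ≡⟨ cong₂ ℤ._+_ (∑-+ {n} _ _) (∑-+ {n} _ _) ⟩
      (∑ (λ b → w ℤ.* T₁ b) ℤ.+ ∑ (λ b → x ℤ.* T₂ b)) ℤ.+ (∑ (λ b → y ℤ.* T₃ b) ℤ.+ ∑ (λ b → z ℤ.* T₄ b))
        ≡⟨ cong₂ ℤ._+_ (cong₂ ℤ._+_ (pull w T₁ (h a d)) (pull x T₂ (h a j)))
                       (cong₂ ℤ._+_ (pull y T₃ (h i d)) (pull z T₄ (h i j))) ⟩
      (w ℤ.* (m ℤ.* M a d) ℤ.+ x ℤ.* (m ℤ.* M a j)) ℤ.+ (y ℤ.* (m ℤ.* M i d) ℤ.+ z ℤ.* (m ℤ.* c))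
        ≡⟨ collect c m (M a d) (M a j) (M i d) ⟩
      c ℤ.* m ℤ.* M′ a d ∎
      where
      open ≡-Reasoning
      w = c ℤ.* c
      x = ℤ.- (c ℤ.* M i d)
      y = ℤ.- (c ℤ.* M a j)
      z = M a j ℤ.* M i d
      T₁ T₂ T₃ T₄ : Fin n → ℤ
      T₁ b = M a b ℤ.* M b d
      T₂ b = M a b ℤ.* M b j
      T₃ b = M i b ℤ.* M b d
      T₄ b = M i b ℤ.* M b j
      expand : ∀ c p q r s t u → (c ℤ.* p ℤ.- q ℤ.* r) ℤ.* (c ℤ.* s ℤ.- t ℤ.* u) ≡
        ((c ℤ.* c) ℤ.* (p ℤ.* s) ℤ.+ (ℤ.- (c ℤ.* u)) ℤ.* (p ℤ.* t))
          ℤ.+ ((ℤ.- (c ℤ.* q)) ℤ.* (r ℤ.* s) ℤ.+ (q ℤ.* u) ℤ.* (r ℤ.* t))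
      expand = solve-∀
      collect : ∀ c m p q r → ((c ℤ.* c) ℤ.* (m ℤ.* p) ℤ.+ (ℤ.- (c ℤ.* r)) ℤ.* (m ℤ.* q))
          ℤ.+ ((ℤ.- (c ℤ.* q)) ℤ.* (m ℤ.* r) ℤ.+ (q ℤ.* r) ℤ.* (m ℤ.* c)) ≡ c ℤ.* m ℤ.* (c ℤ.* p ℤ.- q ℤ.* r)
      collect = solve-∀
      pull : ∀ w (T : Fin n → ℤ) {v} → ∑ T ≡ v → ∑ (λ b → w ℤ.* T b) ≡ w ℤ.* v
      pull w T e = trans (∑-*ˡ w T) (cong (w ℤ.*_) e)

    trace-M′ : trace M′ ≡ c ℤ.* (trace M ℤ.- m)
    trace-M′ = begin
      ∑ (λ a → c ℤ.* M a a ℤ.- M a j ℤ.* M i a)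
        ≡⟨ ∑-cong (λ a → flip c (M a a) (M a j) (M i a)) ⟩
      ∑ (λ a → c ℤ.* M a a ℤ.+ ℤ.-1ℤ ℤ.* (M i a ℤ.* M a j))
        ≡⟨ ∑-+ {n} _ _ ⟩
      ∑ (λ a → c ℤ.* M a a) ℤ.+ ∑ (λ a → ℤ.-1ℤ ℤ.* (M i a ℤ.* M a j))
        ≡⟨ cong₂ ℤ._+_ (∑-*ˡ c (λ a → M a a)) (trans (∑-*ˡ ℤ.-1ℤ (λ a → M i a ℤ.* M a j)) (cong (ℤ.-1ℤ ℤ.*_) (h i j))) ⟩
      c ℤ.* trace M ℤ.+ ℤ.-1ℤ ℤ.* (m ℤ.* c)
        ≡⟨ collect c (trace M) m ⟩
      c ℤ.* (trace M ℤ.- m) ∎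
      where
      open ≡-Reasoning
      flip : ∀ c p q r → c ℤ.* p ℤ.- q ℤ.* r ≡ c ℤ.* p ℤ.+ ℤ.-1ℤ ℤ.* (r ℤ.* q)
      flip = solve-∀
      collect : ∀ c p m → c ℤ.* p ℤ.+ ℤ.-1ℤ ℤ.* (m ℤ.* c) ≡ c ℤ.* (p ℤ.- m)
      collect = solve-∀

  -- The columns are cleared from the last one down, and once all vanish the trace is zero. On the
  -- way back, `c * m` divides `c * (trace M - m)`, and cancelling `c` shows that `m` divides
  -- `trace M`.
  ∣trace-step : ∀ k (M : Matrix) m → m ≢ 0ℤ → Scaled-Idempotent M m →
                (∀ i j → k ≤ toℕ j → M i j ≡ 0ℤ) → m ℤ.∣ trace M
  ∣trace-step zero    M m m≢0 h z = ℤ.divides 0ℤ (∑-zero (λ i → z i i z≤n))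
  ∣trace-step (suc k) M m m≢0 h z with k <? n
  ... | no k≮n = ∣trace-step k M m m≢0 h (λ i j k≤j → contradiction (≤-<-trans k≤j (toℕ<n j)) k≮n)
  ... | yes k<n with any? (λ i → ¬? (M i (fromℕ< k<n) ℤ.≟ 0ℤ))
  ...   | no none = ∣trace-step k M m m≢0 h zero-cols
    where
    zero-cols : ∀ i j → k ≤ toℕ j → M i j ≡ 0ℤ
    zero-cols i j k≤j with k ≟ₙ toℕ j
    ... | no k≢j = z i j (≤∧≢⇒< k≤j k≢j)
    ... | yes k≡j with M i j ℤ.≟ 0ℤ
    ...   | yes e = e
    ...   | no ¬e = contradiction (i , λ e → ¬e (trans (cong (M i) (toℕ-injective (trans (sym k≡j) (sym (toℕ-fromℕ< k<n))))) e)) none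
  ...   | yes (i , Mij≢0) = ∣-up (∣trace-step k M′ (c ℤ.* m) cm≢0 scaled zero-cols)
    where
    j₀ = fromℕ< k<n
    open Elimination M m i j₀ h
    cm≢0 : c ℤ.* m ≢ 0ℤ
    cm≢0 e with ℤ.i*j≡0⇒i≡0∨j≡0 c e
    ... | inj₁ e′ = Mij≢0 e′
    ... | inj₂ e′ = m≢0 e′
    zero-cols : ∀ a j → k ≤ toℕ j → M′ a j ≡ 0ℤ
    zero-cols a j k≤j with k ≟ₙ toℕ j
    ... | yes k≡j = subst (λ j → M′ a j ≡ 0ℤ) (toℕ-injective (trans (toℕ-fromℕ< k<n) k≡j)) (column-j a)
    ... | no k≢j = begin
      c ℤ.* M a j ℤ.- M a j₀ ℤ.* M i j ≡⟨ cong₂ (λ u v → c ℤ.* u ℤ.- M a j₀ ℤ.* v) (z a j k<j) (z i j k<j) ⟩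
      c ℤ.* 0ℤ ℤ.- M a j₀ ℤ.* 0ℤ       ≡⟨ lem c (M a j₀) ⟩
      0ℤ ∎
      where
      open ≡-Reasoning
      k<j = ≤∧≢⇒< k≤j k≢j
      lem : ∀ x y → x ℤ.* 0ℤ ℤ.- y ℤ.* 0ℤ ≡ 0ℤ
      lem = solve-∀
    ∣-up : c ℤ.* m ℤ.∣ trace M′ → m ℤ.∣ trace M
    ∣-up d = subst (m ℤ.∣_) (add (trace M) m) (ℤ.∣m∣n⇒∣m+n m∣ ℤ.∣-refl)
      where
      m∣ : m ℤ.∣ trace M ℤ.- m
      m∣ = ℤ.*-cancelˡ-∣ c {{ℤ.≢-nonZero Mij≢0}} (subst (c ℤ.* m ℤ.∣_) trace-M′ d)
      add : ∀ x m → x ℤ.- m ℤ.+ m ≡ x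
      add = solve-∀

  ∣trace : ∀ (M : Matrix) m → m ≢ 0ℤ → Scaled-Idempotent M m → m ℤ.∣ trace M
  ∣trace M m m≢0 h = ∣trace-step n M m m≢0 h (λ i j n≤j → contradiction (toℕ<n j) (≤⇒≯ n≤j))

-- A solver for identities in groups

infixl 7 _⊙_
data Expr (k : ℕ) : Set where
  var : Fin k → Expr k
  _⊙_ : Expr k → Expr k → Expr k
  one : Expr k
  inv : Expr k → Expr k

module _ {k : ℕ} where

  Word : Set
  Word = List (Bool × Fin k)

  push : Bool × Fin k → Word → Word
  push l [] = l ∷ []
  push (b , i) ((c , j) ∷ w) = if does (i ≟ j) ∧ (b xor c) then w else (b , i) ∷ (c , j) ∷ w

  -- An expression acts on reduced words by left multiplication. Its value on the empty word is its
  -- normal form in the free group, so an identity holding in all groups is recognised by `refl`.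
  -- Letting `act⁻` act by the inverse avoids inverting words.
  act act⁻ : Expr k → Word → Word
  act (var i) w = push (true , i) w
  act (x ⊙ y) w = act x (act y w)
  act one     w = w
  act (inv x) w = act⁻ x w
  act⁻ (var i) w = push (false , i) w
  act⁻ (x ⊙ y) w = act⁻ y (act⁻ x w)
  act⁻ one     w = w
  act⁻ (inv x) w = act x w

x₀ : ∀ {k} → Expr (suc k)
x₀ = var zero
x₁ : ∀ {k} → Expr (suc (suc k))
x₁ = var (suc zero)
x₂ : ∀ {k} → Expr (suc (suc (suc k)))
x₂ = var (suc (suc zero))
x₃ : ∀ {k} → Expr (suc (suc (suc (suc k))))
x₃ = var (suc (suc (suc zero)))
x₄ : ∀ {k} → Expr (suc (suc (suc (suc (suc k)))))
x₄ = var (suc (suc (suc (suc zero))))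

module GroupSolver (𝔾 : Group 0ℓ 0ℓ) where
  open Group 𝔾 renaming (refl to ≈-refl; sym to ≈-sym; trans to ≈-trans; _-_ to infixl 7 _-ᴳ_)
  open import Algebra.Properties.Group 𝔾 using (⁻¹-involutive; ⁻¹-anti-homo-∙; ε⁻¹≈ε)
  open SetoidReasoning setoid

  module _ {k : ℕ} (ρ : Vec Carrier k) where

    ⟦_⟧ : Expr k → Carrier
    ⟦ var i ⟧ = lookup ρ i
    ⟦ x ⊙ y ⟧ = ⟦ x ⟧ ∙ ⟦ y ⟧
    ⟦ one ⟧     = ε
    ⟦ inv x ⟧ = ⟦ x ⟧ ⁻¹

    letter : Bool × Fin k → Carrier
    letter (true  , i) = lookup ρ i
    letter (false , i) = lookup ρ i ⁻¹

    word : Word → Carrier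
    word []      = ε
    word (l ∷ w) = letter l ∙ word w

    cancel : ∀ {x y} w → x ∙ y ≈ ε → w ≈ x ∙ (y ∙ w)
    cancel {x} {y} w h = ≈-sym (≈-trans (≈-sym (assoc x y w)) (≈-trans (∙-congʳ h) (identityˡ w)))

    push-correct : ∀ l w → word (push l w) ≈ letter l ∙ word w
    push-correct l [] = ≈-refl
    push-correct (b , i) ((c , j) ∷ w) with i ≟ j
    ... | no _ = ≈-refl
    push-correct (true  , i) ((true  , .i) ∷ w) | yes refl = ≈-refl
    push-correct (true  , i) ((false , .i) ∷ w) | yes refl = cancel (word w) (inverseʳ _)
    push-correct (false , i) ((true  , .i) ∷ w) | yes refl = cancel (word w) (inverseˡ _)
    push-correct (false , i) ((false , .i) ∷ w) | yes refl = ≈-refl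

    act-correct  : ∀ x w → word (act x w) ≈ ⟦ x ⟧ ∙ word w
    act⁻-correct : ∀ x w → word (act⁻ x w) ≈ ⟦ x ⟧ ⁻¹ ∙ word w
    act-correct (var i) w = push-correct (true , i) w
    act-correct (x ⊙ y) w = begin
      word (act x (act y w))         ≈⟨ act-correct x (act y w) ⟩
      ⟦ x ⟧ ∙ word (act y w)         ≈⟨ ∙-congˡ (act-correct y w) ⟩
      ⟦ x ⟧ ∙ (⟦ y ⟧ ∙ word w)       ≈⟨ assoc _ _ _ ⟨
      ⟦ x ⟧ ∙ ⟦ y ⟧ ∙ word w         ∎
    act-correct one w = ≈-sym (identityˡ _)
    act-correct (inv x) w = act⁻-correct x w
    act⁻-correct (var i) w = push-correct (false , i) w
    act⁻-correct (x ⊙ y) w = begin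
      word (act⁻ y (act⁻ x w))       ≈⟨ act⁻-correct y (act⁻ x w) ⟩
      ⟦ y ⟧ ⁻¹ ∙ word (act⁻ x w)     ≈⟨ ∙-congˡ (act⁻-correct x w) ⟩
      ⟦ y ⟧ ⁻¹ ∙ (⟦ x ⟧ ⁻¹ ∙ word w) ≈⟨ assoc _ _ _ ⟨
      ⟦ y ⟧ ⁻¹ ∙ ⟦ x ⟧ ⁻¹ ∙ word w   ≈⟨ ∙-congʳ (⁻¹-anti-homo-∙ _ _) ⟨
      (⟦ x ⟧ ∙ ⟦ y ⟧) ⁻¹ ∙ word w    ∎
    act⁻-correct one w = ≈-sym (≈-trans (∙-congʳ ε⁻¹≈ε) (identityˡ _))
    act⁻-correct (inv x) w = ≈-trans (act-correct x w) (∙-congʳ (≈-sym (⁻¹-involutive _)))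

    solve : ∀ x y → act x [] ≡ act y [] → ⟦ x ⟧ ≈ ⟦ y ⟧
    solve x y h = begin
      ⟦ x ⟧           ≈⟨ identityʳ _ ⟨
      ⟦ x ⟧ ∙ ε       ≈⟨ act-correct x [] ⟨
      word (act x []) ≡⟨ cong word h ⟩
      word (act y []) ≈⟨ act-correct y [] ⟩
      ⟦ y ⟧ ∙ ε       ≈⟨ identityʳ _ ⟩
      ⟦ y ⟧           ∎

-- Commuting elements in a group up to equivalence

module Commuting (𝔾 : Group 0ℓ 0ℓ) where
  open Group 𝔾 renaming (refl to ≈-refl; sym to ≈-sym; trans to ≈-trans; _-_ to infixl 7 _-ᴳ_)
  open import Algebra.Properties.Group 𝔾 using (∙-cancelˡ; ∙-cancelʳ)
  open GroupSolver 𝔾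
  open SetoidReasoning setoid

  Comm : Carrier → Carrier → Set
  Comm x y = x ∙ y ≈ y ∙ x

  -- The commutator with `x y ⟨ x , y ⟩ = y x`. In the group modulo `M`, where `x ≈ y` is
  -- `x ⁻¹ ∙ y ∈ M`, membership `⟨ x , y ⟩ ∈ M` is by definition the statement `Comm x y`, so the
  -- two are used interchangeably.
  ⟨_,_⟩ : Carrier → Carrier → Carrier
  ⟨ x , y ⟩ = (x ∙ y) ⁻¹ ∙ (y ∙ x)

  Comm-∙ : ∀ {x y z} → Comm x y → Comm x z → Comm x (y ∙ z)
  Comm-∙ {x} {y} {z} p q = begin
    x ∙ (y ∙ z) ≈⟨ assoc _ _ _ ⟨
    x ∙ y ∙ z   ≈⟨ ∙-congʳ p ⟩
    y ∙ x ∙ z   ≈⟨ assoc _ _ _ ⟩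
    y ∙ (x ∙ z) ≈⟨ ∙-congˡ q ⟩
    y ∙ (z ∙ x) ≈⟨ assoc _ _ _ ⟨
    y ∙ z ∙ x   ∎

  Comm-ε : ∀ {x} → Comm x ε
  Comm-ε = ≈-trans (identityʳ _) (≈-sym (identityˡ _))

  Comm-⁻¹ : ∀ {x y} → Comm x y → Comm x (y ⁻¹)
  Comm-⁻¹ {x} {y} p = begin
    x ∙ y ⁻¹                  ≈⟨ solve (x ∷ y ∷ []) (x₀ ⊙ inv x₁) (inv x₁ ⊙ (x₁ ⊙ x₀) ⊙ inv x₁) refl ⟩
    y ⁻¹ ∙ (y ∙ x) ∙ y ⁻¹     ≈⟨ ∙-congʳ (∙-congˡ p) ⟨
    y ⁻¹ ∙ (x ∙ y) ∙ y ⁻¹     ≈⟨ solve (x ∷ y ∷ []) (inv x₁ ⊙ (x₀ ⊙ x₁) ⊙ inv x₁) (inv x₁ ⊙ x₀) refl ⟩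
    y ⁻¹ ∙ x                  ∎

  Comm-resp : ∀ {x y z} → y ≈ z → Comm x y → Comm x z
  Comm-resp h p = ≈-trans (∙-congˡ (≈-sym h)) (≈-trans p (∙-congʳ h))

  Comm-conj : ∀ {x y} h → Comm x y → Comm (h ⁻¹ ∙ x ∙ h) (h ⁻¹ ∙ y ∙ h)
  Comm-conj {x} {y} h p = begin
    h ⁻¹ ∙ x ∙ h ∙ (h ⁻¹ ∙ y ∙ h) ≈⟨ solve (x ∷ y ∷ h ∷ []) (inv x₂ ⊙ x₀ ⊙ x₂ ⊙ (inv x₂ ⊙ x₁ ⊙ x₂)) (inv x₂ ⊙ (x₀ ⊙ x₁) ⊙ x₂) refl ⟩
    h ⁻¹ ∙ (x ∙ y) ∙ h            ≈⟨ ∙-congʳ (∙-congˡ p) ⟩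
    h ⁻¹ ∙ (y ∙ x) ∙ h            ≈⟨ solve (x ∷ y ∷ h ∷ []) (inv x₂ ⊙ x₁ ⊙ x₂ ⊙ (inv x₂ ⊙ x₀ ⊙ x₂)) (inv x₂ ⊙ (x₁ ⊙ x₀) ⊙ x₂) refl ⟨
    h ⁻¹ ∙ y ∙ h ∙ (h ⁻¹ ∙ x ∙ h) ∎

  conj-⟨⟩ : ∀ x h → h ⁻¹ ∙ x ∙ h ≈ x ∙ ⟨ h , x ⟩
  conj-⟨⟩ x h = solve (x ∷ h ∷ []) (inv x₁ ⊙ x₀ ⊙ x₁) (x₀ ⊙ (inv (x₁ ⊙ x₀) ⊙ (x₀ ⊙ x₁))) refl

  conjugates-commute : ∀ {a c} h → Comm a c → Comm (a ∙ ⟨ h , a ⟩) (c ∙ ⟨ h , c ⟩)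
  conjugates-commute {a} {c} h p = Comm-resp (conj-⟨⟩ c h)
    (≈-sym (Comm-resp (conj-⟨⟩ a h) (≈-sym (Comm-conj h p))))

  -- The next two lemmas, instances of the Hall–Witt identity, expand the fact that the conjugates
  -- of commuting elements commute.
  comm-⟨⟩-of-central : ∀ {a c d} → Comm a c → (∀ y → Comm y ⟨ d , a ⟩) → Comm a ⟨ d , c ⟩
  comm-⟨⟩-of-central {a} {c} {d} p u = ∙-cancelˡ c _ _ (∙-cancelʳ μ _ _ (begin
    c ∙ (a ∙ ρ) ∙ μ   ≈⟨ ∙-congʳ (assoc _ _ _) ⟨
    c ∙ a ∙ ρ ∙ μ     ≈⟨ ∙-congʳ (∙-congʳ p) ⟨
    a ∙ c ∙ ρ ∙ μ     ≈⟨ ∙-congʳ (assoc _ _ _) ⟩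
    a ∙ (c ∙ ρ) ∙ μ   ≈⟨ assoc _ _ _ ⟩
    a ∙ (c ∙ ρ ∙ μ)   ≈⟨ ∙-congˡ (u (c ∙ ρ)) ⟩
    a ∙ (μ ∙ (c ∙ ρ)) ≈⟨ assoc _ _ _ ⟨
    a ∙ μ ∙ (c ∙ ρ)   ≈⟨ conjugates-commute d p ⟩
    c ∙ ρ ∙ (a ∙ μ)   ≈⟨ assoc _ _ _ ⟨
    c ∙ ρ ∙ a ∙ μ     ≈⟨ ∙-congʳ (assoc _ _ _) ⟩
    c ∙ (ρ ∙ a) ∙ μ   ∎))
    where
    ρ = ⟨ d , c ⟩
    μ = ⟨ d , a ⟩

  comm-of-commuting-⟨⟩ : ∀ {a c h} → Comm a c → Comm a ⟨ h , a ⟩ → Comm a ⟨ h , c ⟩ → Comm ⟨ h , a ⟩ ⟨ h , c ⟩ → Comm c ⟨ h , a ⟩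
  comm-of-commuting-⟨⟩ {a} {c} {h} p q r z = ≈-sym (∙-cancelˡ a _ _ (∙-cancelʳ ρ _ _ (begin
    a ∙ (σ ∙ c) ∙ ρ   ≈⟨ solve (a ∷ σ ∷ c ∷ ρ ∷ []) (x₀ ⊙ (x₁ ⊙ x₂) ⊙ x₃) (x₀ ⊙ x₁ ⊙ (x₂ ⊙ x₃)) refl ⟩
    a ∙ σ ∙ (c ∙ ρ)   ≈⟨ conjugates-commute h p ⟩
    c ∙ ρ ∙ (a ∙ σ)   ≈⟨ assoc _ _ _ ⟨
    c ∙ ρ ∙ a ∙ σ     ≈⟨ ∙-congʳ (assoc _ _ _) ⟩
    c ∙ (ρ ∙ a) ∙ σ   ≈⟨ ∙-congʳ (∙-congˡ r) ⟨
    c ∙ (a ∙ ρ) ∙ σ   ≈⟨ solve (a ∷ σ ∷ c ∷ ρ ∷ []) (x₂ ⊙ (x₀ ⊙ x₃) ⊙ x₁) (x₂ ⊙ x₀ ⊙ (x₃ ⊙ x₁)) refl ⟩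
    c ∙ a ∙ (ρ ∙ σ)   ≈⟨ ∙-cong p z ⟨
    a ∙ c ∙ (σ ∙ ρ)   ≈⟨ solve (a ∷ σ ∷ c ∷ ρ ∷ []) (x₀ ⊙ x₂ ⊙ (x₁ ⊙ x₃)) (x₀ ⊙ (x₂ ⊙ x₁) ⊙ x₃) refl ⟩
    a ∙ (c ∙ σ) ∙ ρ   ∎)))
    where
    σ = ⟨ h , a ⟩
    ρ = ⟨ h , c ⟩

-- Finite groups: subgroups, cosets, orders of elements

record FinGroup (n : ℕ) : Set where
  field
    _·_     : Fin n → Fin n → Fin n
    1#      : Fin n
    _⁻      : Fin n → Fin n
    isGroup : IsGroup _≡_ _·_ 1# _⁻

  group : Group 0ℓ 0ℓ
  group = record { isGroup = isGroup }

least : ∀ {P : ℕ → Set} → Decidable P → ∀ k → P k → ∃ λ m → P m × (∀ i → i < m → ¬ P i)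
least {P} P? k p with P? 0
... | yes p₀ = 0 , p₀ , λ _ ()
least P? zero p | no ¬p₀ = contradiction p ¬p₀
least P? (suc k) p | no ¬p₀ with least (P? ∘ suc) k p
... | m , pm , min = suc m , pm , λ { zero _ q → ¬p₀ q ; (suc i) (s≤s lt) q → min i lt q }

module FinGroupTheory {n : ℕ} (𝔾 : FinGroup n) where
  open FinGroup 𝔾 public
  open Group group public using (_∙_; ε; _⁻¹; assoc; identityˡ; identityʳ; inverseˡ; inverseʳ)
  open GroupSolver group public using (solve)
  open Commuting group public using (⟨_,_⟩)

  H : Set
  H = Fin n

  record Subgroup : Set₁ where
    field
      mem  : H → Set
      mem? : Decidable mem
      ε∈   : mem ε
      ∙∈   : ∀ {x y} → mem x → mem y → mem (x ∙ y)
      ⁻¹∈  : ∀ {x} → mem x → mem (x ⁻¹)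
  open Subgroup public

  infix 4 _∈_ _⊆_
  _∈_ : H → Subgroup → Set
  x ∈ G = mem G x

  _⊆_ : Subgroup → Subgroup → Set
  G ⊆ K = ∀ {x} → x ∈ G → x ∈ K

  ∣_∣ : Subgroup → ℕ
  ∣ G ∣ = # (mem? G)

  ∣G∣≥1 : ∀ G → 1 ≤ ∣ G ∣
  ∣G∣≥1 G = #-∃ (mem? G) (ε∈ G)

  ≡∈ : ∀ G {x y} → x ≡ y → x ∈ G → y ∈ G
  ≡∈ G refl h = h

  ∈-cancelˡ : ∀ G {x y} → x ∈ G → x ∙ y ∈ G → y ∈ G
  ∈-cancelˡ G {x} {y} p q = ≡∈ G (solve (x ∷ y ∷ []) (inv x₀ ⊙ (x₀ ⊙ x₁)) x₁ refl) (∙∈ G (⁻¹∈ G p) q)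

  ∈-cancelʳ : ∀ G {x y} → y ∈ G → x ∙ y ∈ G → x ∈ G
  ∈-cancelʳ G {x} {y} p q = ≡∈ G (solve (x ∷ y ∷ []) (x₀ ⊙ x₁ ⊙ inv x₁) x₀ refl) (∙∈ G q (⁻¹∈ G p))

  coset-sym : ∀ G {x y} → x ⁻¹ ∙ y ∈ G → y ⁻¹ ∙ x ∈ G
  coset-sym G {x} {y} p = ≡∈ G (solve (x ∷ y ∷ []) (inv (inv x₀ ⊙ x₁)) (inv x₁ ⊙ x₀) refl) (⁻¹∈ G p)

  coset-trans : ∀ G {x y z} → x ⁻¹ ∙ y ∈ G → y ⁻¹ ∙ z ∈ G → x ⁻¹ ∙ z ∈ G
  coset-trans G {x} {y} {z} p q =
    ≡∈ G (solve (x ∷ y ∷ z ∷ []) (inv x₀ ⊙ x₁ ⊙ (inv x₁ ⊙ x₂)) (inv x₀ ⊙ x₂) refl) (∙∈ G p q)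

  cosets : (G : Subgroup) → Quotient (λ x y → x ⁻¹ ∙ y ∈ G)
  cosets G = quotientBy (λ x y → mem? G (x ⁻¹ ∙ y)) (λ {x} → ≡∈ G (sym (inverseˡ x)) (ε∈ G))
    (coset-sym G) (coset-trans G)

  #-translateˡ : ∀ {P : H → Set} (P? : Decidable P) g → # (λ x → P? (g ∙ x)) ≡ # P?
  #-translateˡ {P} P? g = #-bij (λ x → P? (g ∙ x)) P? (g ∙_) (g ⁻¹ ∙_)
    (λ _ p → p) (λ y p → subst P (sym (eq₁ y)) p) (λ x _ → eq₂ x) (λ y _ → eq₁ y)
    where
    eq₁ : ∀ y → g ∙ (g ⁻¹ ∙ y) ≡ y
    eq₁ y = solve (g ∷ y ∷ []) (x₀ ⊙ (inv x₀ ⊙ x₁)) x₁ refl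
    eq₂ : ∀ y → g ⁻¹ ∙ (g ∙ y) ≡ y
    eq₂ y = solve (g ∷ y ∷ []) (inv x₀ ⊙ (x₀ ⊙ x₁)) x₁ refl

  #-translateʳ : ∀ {P : H → Set} (P? : Decidable P) g → # (λ x → P? (x ∙ g)) ≡ # P?
  #-translateʳ {P} P? g = #-bij (λ x → P? (x ∙ g)) P? (_∙ g) (_∙ g ⁻¹)
    (λ _ p → p) (λ y p → subst P (sym (eq₁ y)) p) (λ x _ → eq₂ x) (λ y _ → eq₁ y)
    where
    eq₁ : ∀ y → y ∙ g ⁻¹ ∙ g ≡ y
    eq₁ y = solve (g ∷ y ∷ []) (x₁ ⊙ inv x₀ ⊙ x₀) x₁ refl
    eq₂ : ∀ y → y ∙ g ∙ g ⁻¹ ≡ y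
    eq₂ y = solve (g ∷ y ∷ []) (x₁ ⊙ x₀ ⊙ inv x₀) x₁ refl

  lagrange : ∀ G K → G ⊆ K → ∣ G ∣ ∣ ∣ K ∣
  lagrange G K G⊆K = divides (# K?) (trans (sym (*-identityˡ _)) (trans eq (*-comm ∣ G ∣ _)))
    where
    open Quotient (cosets G)
    K? : Decidable (λ c → rep c ∈ K)
    K? c = mem? K (rep c)
    rep~ : ∀ x → rep (class x) ⁻¹ ∙ x ∈ G
    rep~ x = exact (class-rep (class x))
    eq : 1 * ∣ K ∣ ≡ ∣ G ∣ * # K?
    eq = double-≡ (mem? K) K? (λ x c → class x ≟ c) 1 ∣ G ∣
      (λ x k → #-unique (row (mem? K) K? (λ x c → class x ≟ c) x) {class x}
        (≡∈ K (solve (x ∷ rep (class x) ∷ []) (x₀ ⊙ inv (inv x₁ ⊙ x₀)) x₁ refl) (∙∈ K k (⁻¹∈ K (G⊆K (rep~ x)))) , refl)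
        (λ c → sym ∘ proj₂))
      (λ c k → trans (#-cong (col (mem? K) K? (λ x c → class x ≟ c) c) (λ x → mem? G (rep c ⁻¹ ∙ x))
          (λ { x (_ , refl) → rep~ x })
          (λ x g → ≡∈ K (solve (x ∷ rep c ∷ []) (x₁ ⊙ (inv x₁ ⊙ x₀)) x₀ refl) (∙∈ K k (G⊆K g))
                 , trans (sym (sound g)) (class-rep c)))
        (#-translateˡ (mem? G) (rep c ⁻¹)))

  full : Subgroup
  full = record { mem = λ _ → ⊤ ; mem? = λ _ → yes tt ; ε∈ = tt ; ∙∈ = λ _ _ → tt ; ⁻¹∈ = λ _ → tt }

  ∣full∣ : ∣ full ∣ ≡ n
  ∣full∣ = #-all (mem? full) (λ _ → tt)

  trivial : Subgroup
  trivial = record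
    { mem = _≡ ε ; mem? = _≟ ε ; ε∈ = refl
    ; ∙∈ = λ { refl refl → identityˡ ε }
    ; ⁻¹∈ = λ { refl → solve [] (inv one) one refl } }

  ∣trivial∣ : ∣ trivial ∣ ≡ 1
  ∣trivial∣ = #-unique (mem? trivial) refl (λ _ h → h)

  _∩_ : Subgroup → Subgroup → Subgroup
  G ∩ K = record
    { mem = λ x → x ∈ G × x ∈ K ; mem? = λ x → mem? G x ×-dec mem? K x ; ε∈ = ε∈ G , ε∈ K
    ; ∙∈ = λ { (a , b) (c , d) → ∙∈ G a c , ∙∈ K b d } ; ⁻¹∈ = λ { (a , b) → ⁻¹∈ G a , ⁻¹∈ K b } }

  -- the conjugate g G g⁻¹
  conj : H → Subgroup → Subgroup
  conj g G = record
    { mem = λ x → g ⁻¹ ∙ x ∙ g ∈ G ; mem? = λ x → mem? G (g ⁻¹ ∙ x ∙ g)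
    ; ε∈ = ≡∈ G (solve (g ∷ []) one (inv x₀ ⊙ one ⊙ x₀) refl) (ε∈ G)
    ; ∙∈ = λ {x} {y} p q → ≡∈ G (solve (g ∷ x ∷ y ∷ []) (inv x₀ ⊙ x₁ ⊙ x₀ ⊙ (inv x₀ ⊙ x₂ ⊙ x₀)) (inv x₀ ⊙ (x₁ ⊙ x₂) ⊙ x₀) refl) (∙∈ G p q)
    ; ⁻¹∈ = λ {x} p → ≡∈ G (solve (g ∷ x ∷ []) (inv (inv x₀ ⊙ x₁ ⊙ x₀)) (inv x₀ ⊙ inv x₁ ⊙ x₀) refl) (⁻¹∈ G p) }

  ∣conj∣ : ∀ g G → ∣ conj g G ∣ ≡ ∣ G ∣
  ∣conj∣ g G = trans (#-translateˡ (λ x → mem? G (x ∙ g)) (g ⁻¹)) (#-translateʳ (mem? G) g)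

  pow : H → ℕ → H
  pow x zero    = ε
  pow x (suc k) = x ∙ pow x k

  pow-+ : ∀ x i j → pow x (i + j) ≡ pow x i ∙ pow x j
  pow-+ x zero    j = sym (identityˡ _)
  pow-+ x (suc i) j = trans (cong (x ∙_) (pow-+ x i j)) (sym (assoc _ _ _))

  pow-* : ∀ x i j → pow (pow x i) j ≡ pow x (j * i)
  pow-* x i zero    = refl
  pow-* x i (suc j) = trans (cong (pow x i ∙_) (pow-* x i j)) (sym (pow-+ x i (j * i)))

  pow-ε : ∀ k → pow ε k ≡ ε
  pow-ε zero    = refl
  pow-ε (suc k) = trans (identityˡ _) (pow-ε k)

  pow-∈ : ∀ G {x} k → x ∈ G → pow x k ∈ G
  pow-∈ G zero    p = ε∈ G
  pow-∈ G (suc k) p = ∙∈ G p (pow-∈ G k p)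

  pow-1 : ∀ x → pow x 1 ≡ x
  pow-1 x = identityʳ x

  pow-returns : ∀ x → ∃ λ k → pow x (suc k) ≡ ε
  pow-returns x with pigeonhole (n<1+n n) (λ i → pow x (toℕ i))
  ... | i , j , i<j , eq with m≤n⇒∃[o]m+o≡n i<j
  ...   | k , 1+i+k≡j = k , (begin
    pow x (suc k)                                       ≡⟨ solve (pow x (toℕ i) ∷ pow x (suc k) ∷ []) x₁ (inv x₀ ⊙ (x₀ ⊙ x₁)) refl ⟩
    pow x (toℕ i) ⁻¹ ∙ (pow x (toℕ i) ∙ pow x (suc k)) ≡⟨ cong (pow x (toℕ i) ⁻¹ ∙_) (pow-+ x (toℕ i) (suc k)) ⟨
    pow x (toℕ i) ⁻¹ ∙ pow x (toℕ i + suc k)           ≡⟨ cong (λ m → pow x (toℕ i) ⁻¹ ∙ pow x m) (trans (+-suc (toℕ i) k) 1+i+k≡j) ⟩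
    pow x (toℕ i) ⁻¹ ∙ pow x (toℕ j)                   ≡⟨ cong (pow x (toℕ i) ⁻¹ ∙_) eq ⟨
    pow x (toℕ i) ⁻¹ ∙ pow x (toℕ i)                   ≡⟨ inverseˡ _ ⟩
    ε ∎)
    where open ≡-Reasoning

  -- The subgroup `D ⟨x⟩` for an `x` normalising `D`: `order` is the order of `x` modulo `D`, and
  -- `InPower k` is the coset `x ^ k D`.
  module Adjoin (D : Subgroup) (x : H) (norm : ∀ {d} → d ∈ D → ⟨ x , d ⟩ ∈ D) where

    abstract
      order′ : ∃ λ m → pow x (suc m) ∈ D × (∀ i → i < m → ¬ pow x (suc i) ∈ D)
      order′ = least (λ k → mem? D (pow x (suc k))) (proj₁ (pow-returns x))
                 (≡∈ D (sym (proj₂ (pow-returns x))) (ε∈ D))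

    order : ℕ
    order = suc (proj₁ order′)

    pow-order : pow x order ∈ D
    pow-order = proj₁ (proj₂ order′)

    order-min : ∀ i → 0 < i → i < order → ¬ pow x i ∈ D
    order-min (suc i) _ (s≤s lt) = proj₂ (proj₂ order′) i lt

    pow-order-* : ∀ k → pow x (k * order) ∈ D
    pow-order-* k = ≡∈ D (pow-* x order k) (pow-∈ D k pow-order)

    order-∣ : ∀ k → pow x k ∈ D → order ∣ k
    order-∣ k p with k % order in eq
    ... | zero  = m%n≡0⇒n∣m k order eq
    ... | suc r = contradiction
      (∈-cancelʳ D (pow-order-* (k / order))
        (≡∈ D (trans (cong (pow x) (m≡m%n+[m/n]*n k order)) (pow-+ x (k % order) _)) p))
      (subst (λ i → ¬ pow x i ∈ D) (sym eq) (order-min (suc r) (s≤s z≤n) (subst (_< order) eq (m%n<n k order))))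

    InPower : ℕ → H → Set
    InPower k g = pow x k ⁻¹ ∙ g ∈ D

    norm-conj : ∀ {d} → d ∈ D → x ⁻¹ ∙ d ∙ x ∈ D
    norm-conj {d} p = ≡∈ D (solve (x ∷ d ∷ []) (x₁ ⊙ (inv (x₀ ⊙ x₁) ⊙ (x₁ ⊙ x₀))) (inv x₀ ⊙ x₁ ⊙ x₀) refl) (∙∈ D p (norm p))

    pow-conj : ∀ k {d} → d ∈ D → pow x k ⁻¹ ∙ d ∙ pow x k ∈ D
    pow-conj zero    {d} p = ≡∈ D (solve (d ∷ []) x₀ (inv one ⊙ x₀ ⊙ one) refl) p
    pow-conj (suc k) {d} p = ≡∈ D (solve (x ∷ d ∷ pow x k ∷ []) (inv x₂ ⊙ (inv x₀ ⊙ x₁ ⊙ x₀) ⊙ x₂) (inv (x₀ ⊙ x₂) ⊙ x₁ ⊙ (x₀ ⊙ x₂)) refl)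
      (pow-conj k (norm-conj p))

    InPower-∙ : ∀ i j {g h} → InPower i g → InPower j h → InPower (i + j) (g ∙ h)
    InPower-∙ i j {g} {h} p q = ≡∈ D
      (trans (solve (X ∷ Y ∷ g ∷ h ∷ []) (inv x₁ ⊙ (inv x₀ ⊙ x₂) ⊙ x₁ ⊙ (inv x₁ ⊙ x₃)) (inv (x₀ ⊙ x₁) ⊙ (x₂ ⊙ x₃)) refl)
             (cong (λ z → z ⁻¹ ∙ (g ∙ h)) (sym (pow-+ x i j))))
      (∙∈ D (pow-conj j p) q)
      where X = pow x i
            Y = pow x j

    InPower-pow : ∀ i k {g} → InPower i g → InPower (k * i) (pow g k)
    InPower-pow i zero    p = ≡∈ D (solve [] one (inv one ⊙ one) refl) (ε∈ D)
    InPower-pow i (suc k) p = InPower-∙ i (k * i) p (InPower-pow i k p)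

    InPower-D : ∀ k {g} → pow x k ∈ D → InPower k g → g ∈ D
    InPower-D k {g} p q = ∈-cancelˡ D (⁻¹∈ D p) q

    InPower-% : ∀ k {g} → InPower k g → InPower (k % order) g
    InPower-% k {g} p = ≡∈ D (begin
      pow x (q * order) ∙ (pow x k ⁻¹ ∙ g)
        ≡⟨ cong (λ z → pow x (q * order) ∙ (z ⁻¹ ∙ g))
             (trans (cong (pow x) (trans (m≡m%n+[m/n]*n k order) (+-comm (k % order) _))) (pow-+ x (q * order) (k % order))) ⟩
      pow x (q * order) ∙ ((pow x (q * order) ∙ pow x (k % order)) ⁻¹ ∙ g)
        ≡⟨ cong (λ z → pow x (q * order) ∙ (z ⁻¹ ∙ g)) (comm (q * order) (k % order)) ⟩
      pow x (q * order) ∙ ((pow x (k % order) ∙ pow x (q * order)) ⁻¹ ∙ g)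
        ≡⟨ solve (pow x (q * order) ∷ pow x (k % order) ∷ g ∷ []) (x₀ ⊙ (inv (x₁ ⊙ x₀) ⊙ x₂)) (inv x₁ ⊙ x₂) refl ⟩
      pow x (k % order) ⁻¹ ∙ g ∎) (∙∈ D (pow-order-* q) p)
      where
      open ≡-Reasoning
      q = k / order
      comm : ∀ i j → pow x i ∙ pow x j ≡ pow x j ∙ pow x i
      comm i j = trans (sym (pow-+ x i j)) (trans (cong (pow x) (+-comm i j)) (pow-+ x j i))

    InPower-⁻¹ : ∀ k {g} → k ≤ order → InPower k g → InPower (order ∸ k) (g ⁻¹)
    InPower-⁻¹ k {g} k≤ p = ≡∈ D (begin
      pow x j ⁻¹ ∙ (pow x k ⁻¹ ∙ g) ⁻¹ ∙ pow x j ∙ (pow x k ∙ pow x j) ⁻¹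
        ≡⟨ solve (pow x k ∷ pow x j ∷ g ∷ []) (inv x₁ ⊙ inv (inv x₀ ⊙ x₂) ⊙ x₁ ⊙ inv (x₀ ⊙ x₁)) (inv x₁ ⊙ inv x₂) refl ⟩
      pow x j ⁻¹ ∙ g ⁻¹ ∎)
      (∙∈ D (pow-conj j (⁻¹∈ D p)) (⁻¹∈ D (≡∈ D (trans (cong (pow x) (sym (m+[n∸m]≡n k≤))) (pow-+ x k j)) pow-order)))
      where
      open ≡-Reasoning
      j = order ∸ k

    InPower-mem : ∀ k {g} → InPower k g → ∃ λ (i : Fin order) → InPower (toℕ i) g
    InPower-mem k {g} p = fromℕ< (m%n<n k order) , subst (λ i → InPower i g) (sym (toℕ-fromℕ< (m%n<n k order))) (InPower-% k p)

    adjoin : Subgroup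
    adjoin = record
      { mem  = λ g → ∃ λ (i : Fin order) → InPower (toℕ i) g
      ; mem? = λ g → any? (λ i → mem? D (pow x (toℕ i) ⁻¹ ∙ g))
      ; ε∈   = InPower-mem 0 (≡∈ D (solve [] one (inv one ⊙ one) refl) (ε∈ D))
      ; ∙∈   = λ { (i , p) (j , q) → InPower-mem (toℕ i + toℕ j) (InPower-∙ (toℕ i) (toℕ j) p q) }
      ; ⁻¹∈  = λ { (i , p) → InPower-mem (order ∸ toℕ i) (InPower-⁻¹ (toℕ i) (<⇒≤ (toℕ<n i)) p) }
      }

    D⊆adjoin : D ⊆ adjoin
    D⊆adjoin {g} p = InPower-mem 0 (≡∈ D (solve (g ∷ []) x₀ (inv one ⊙ x₀) refl) p)

    x∈adjoin : x ∈ adjoin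
    x∈adjoin = InPower-mem 1 (≡∈ D (solve (x ∷ []) one (inv (x₀ ⊙ one) ⊙ x₀) refl) (ε∈ D))

    adjoin⊆ : ∀ {K} → D ⊆ K → x ∈ K → adjoin ⊆ K
    adjoin⊆ {K} D⊆K x∈K {g} (i , p) = ∈-cancelˡ K (⁻¹∈ K (pow-∈ K (toℕ i) x∈K)) (D⊆K p)

    unique-power : ∀ i j {g} → i < order → j < order → InPower i g → InPower j g → i ≤ j
    unique-power i j {g} i< j< p q with i ≤? j
    ... | yes i≤j = i≤j
    ... | no  i≰j = contradiction
      (≡∈ D (trans (cong (pow x j ⁻¹ ∙_) (trans (cong (pow x) (sym (m+[n∸m]≡n j≤i))) (pow-+ x j k)))
                   (solve (pow x j ∷ pow x k ∷ []) (inv x₀ ⊙ (x₀ ⊙ x₁)) x₁ refl))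
            (coset-trans D q (coset-sym D p)))
      (order-min k (m<n⇒0<n∸m (≰⇒> i≰j)) (≤-<-trans (m∸n≤m i j) i<))
      where
      j≤i = <⇒≤ (≰⇒> i≰j)
      k = i ∸ j

    ∣adjoin∣ : ∣ adjoin ∣ ≡ order * ∣ D ∣
    ∣adjoin∣ = trans (sym (*-identityˡ _)) (trans
      (double-≡ (mem? adjoin) whole R? 1 ∣ D ∣
        (λ { g (i , p) → #-unique (row (mem? adjoin) whole R? g) {i} (tt , p)
             (λ { j (_ , q) → toℕ-injective (≤-antisym (unique-power _ _ (toℕ<n j) (toℕ<n i) q p) (unique-power _ _ (toℕ<n i) (toℕ<n j) p q)) }) })
        (λ i _ → trans (#-cong (col (mem? adjoin) whole R? i) (λ g → mem? D (pow x (toℕ i) ⁻¹ ∙ g)) (λ _ → proj₂) (λ g p → (i , p) , p))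
                       (#-translateˡ (mem? D) _)))
      (trans (cong (∣ D ∣ *_) #-whole) (*-comm ∣ D ∣ order)))
      where
      R? : ∀ g (i : Fin order) → Dec (InPower (toℕ i) g)
      R? g i = mem? D (pow x (toℕ i) ⁻¹ ∙ g)

  norm-trivial : ∀ x {d} → d ∈ trivial → ⟨ x , d ⟩ ∈ trivial
  norm-trivial x refl = solve (x ∷ []) (inv (x₀ ⊙ one) ⊙ (one ⊙ x₀)) one refl

  -- Lagrange for the cyclic subgroup of `x`, obtained by adjoining `x` to the trivial subgroup.
  pow-∣G∣ : ∀ G {x} → x ∈ G → pow x ∣ G ∣ ≡ ε
  pow-∣G∣ G {x} x∈G = from (lagrange adjoin G (adjoin⊆ {G} (λ { refl → ε∈ G }) x∈G))
    where
    open Adjoin trivial x (norm-trivial x)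
    from : ∣ adjoin ∣ ∣ ∣ G ∣ → pow x ∣ G ∣ ≡ ε
    from (divides q eq) = trans (cong (pow x) (trans eq (cong (q *_)
      (trans ∣adjoin∣ (trans (cong (order *_) ∣trivial∣) (*-identityʳ order)))))) (pow-order-* q)

#-fibres : ∀ {m k} {P : Fin m → Set} (P? : Decidable P) (f : Fin m → Fin k) →
           # P? ≡ sum (λ c → # (λ i → P? i ×-dec (f i ≟ c)))
#-fibres {m} {k} P? f = trans (sum-cong-≗ lem) (∑-comm (λ i c → ind (P? i ×-dec (f i ≟ c))))
  where
  lem : ∀ i → ind (P? i) ≡ sum (λ c → ind (P? i ×-dec (f i ≟ c)))
  lem i with P? i
  ... | yes _ = sym (#-unique (λ c → f i ≟ c) refl (λ c → sym))
  ... | no  _ = sym (sum-0 k)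

-- Actions of p-groups and Cauchy's theorem

prime≥2 : ∀ {p} → Prime p → 2 ≤ p
prime≥2 {p} pr = nonTrivial⇒n>1 p {{prime⇒nonTrivial pr}}

∣prime-power : ∀ {p} → Prime p → ∀ N {d} → d ∣ p ^ N → d ≡ 1 ⊎ p ∣ d
∣prime-power {p} pr zero    h = inj₁ (∣1⇒≡1 h)
∣prime-power {p} pr (suc N) {d} h with p ∣? d
... | yes p∣d = inj₂ p∣d
... | no  p∤d = ∣prime-power pr N (coprime-divisor cop h)
  where
  cop : Coprime d p
  cop (i∣d , i∣p) with prime⇒irreducible pr i∣p
  ... | inj₁ refl = refl
  ... | inj₂ refl = contradiction i∣d p∤d

module GroupActions {n : ℕ} (𝔾 : FinGroup n) where
  open FinGroupTheory 𝔾

  ⊆-dec : ∀ K G → (K ⊆ G) ⊎ ∃ λ x → x ∈ K × ¬ x ∈ G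
  ⊆-dec K G = from (any? (λ x → mem? K x ×-dec ¬? (mem? G x)))
    where
    from : Dec (∃ λ x → x ∈ K × ¬ x ∈ G) → (K ⊆ G) ⊎ ∃ λ x → x ∈ K × ¬ x ∈ G
    from (yes w) = inj₂ w
    from (no ¬w) = inj₁ sub
      where
      sub : K ⊆ G
      sub {x} k with mem? G x
      ... | yes g = g
      ... | no ¬g = contradiction (x , k , ¬g) ¬w

  ⊆⇒≤ : ∀ G K → G ⊆ K → ∣ G ∣ ≤ ∣ K ∣
  ⊆⇒≤ G K h = #-mono (mem? G) (mem? K) (λ _ → h)

  -- Automatic for groups of order a power of p; for the whole group it replaces Sylow theory.
  IndexDivisible : ℕ → Subgroup → Set₁
  IndexDivisible p K = ∀ G → G ⊆ K → (K ⊆ G) ⊎ p * ∣ G ∣ ∣ ∣ K ∣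

  Abelian : Subgroup → Set
  Abelian K = ∀ {x y} → x ∈ K → y ∈ K → ⟨ x , y ⟩ ≡ ε

  module _ {p : ℕ} (pr : Prime p) where

    -- Adjoining to `G` an element `x` of `K` outside it multiplies the order by the order of `x`
    -- modulo `G`. This is a divisor of `p ^ N` other than 1, hence a multiple of `p`.
    exponent⇒IndexDivisible : ∀ N K → Abelian K → (∀ {x} → x ∈ K → pow x (p ^ N) ≡ ε) → IndexDivisible p K
    exponent⇒IndexDivisible N K ab ex G G⊆K = from (⊆-dec K G)
      where
      from : ((K ⊆ G) ⊎ ∃ λ x → x ∈ K × ¬ x ∈ G) → (K ⊆ G) ⊎ p * ∣ G ∣ ∣ ∣ K ∣
      from (inj₁ s) = inj₁ s
      from (inj₂ (x , x∈K , x∉G)) = inj₂ (case (∣prime-power pr N (order-∣ (p ^ N) (≡∈ G (sym (ex x∈K)) (ε∈ G)))))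
        where
        open Adjoin G x (λ d∈G → ≡∈ G (sym (ab x∈K (G⊆K d∈G))) (ε∈ G))
        case : order ≡ 1 ⊎ p ∣ order → p * ∣ G ∣ ∣ ∣ K ∣
        case (inj₁ o≡1) = contradiction (≡∈ G (trans (cong (pow x) o≡1) (pow-1 x)) pow-order) x∉G
        case (inj₂ p∣o) = ∣-trans (*-monoˡ-∣ ∣ G ∣ p∣o)
          (subst (_∣ ∣ K ∣) ∣adjoin∣ (lagrange adjoin K (adjoin⊆ {K} G⊆K x∈K)))

    module Action (D : Subgroup) (isP : IndexDivisible p D) {m : ℕ} (_▷_ : H → Fin m → Fin m)
                  (▷-ε : ∀ i → ε ▷ i ≡ i) (▷-∙ : ∀ g h i → (g ∙ h) ▷ i ≡ g ▷ (h ▷ i)) where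

      Fixed : Fin m → Set
      Fixed i = ∀ g → g ∈ D → g ▷ i ≡ i

      Fixed? : Decidable Fixed
      Fixed? i = all? (λ g → mem? D g →-dec (g ▷ i ≟ i))

      _~_ : Fin m → Fin m → Set
      i ~ j = ∃ λ g → g ∈ D × g ▷ i ≡ j

      ~-sym : ∀ {i j} → i ~ j → j ~ i
      ~-sym {i} (g , d , refl) = g ⁻¹ , ⁻¹∈ D d , trans (sym (▷-∙ (g ⁻¹) g i)) (trans (cong (_▷ i) (inverseˡ g)) (▷-ε i))

      orbits : Quotient _~_
      orbits = quotientBy (λ i j → any? (λ g → mem? D g ×-dec (g ▷ i ≟ j)))
        (λ {i} → ε , ε∈ D , ▷-ε i) ~-sym
        (λ { {i} (g , d , refl) (h , d′ , refl) → h ∙ g , ∙∈ D d′ d , ▷-∙ h g i })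

      open Quotient orbits

      orbit? : ∀ c → Decidable (λ i → ⊤ × class i ≡ c)
      orbit? c i = whole i ×-dec (class i ≟ c)

      fixed-in? : ∀ c → Decidable (λ i → Fixed i × class i ≡ c)
      fixed-in? c i = Fixed? i ×-dec (class i ≟ c)

      stab : Fin m → Subgroup
      stab i = record
        { mem = λ g → g ∈ D × g ▷ i ≡ i ; mem? = λ g → mem? D g ×-dec (g ▷ i ≟ i) ; ε∈ = ε∈ D , ▷-ε i
        ; ∙∈ = λ {g} {h} (d , p) (d′ , q) → ∙∈ D d d′ , trans (▷-∙ g h i) (trans (cong (g ▷_) q) p)
        ; ⁻¹∈ = λ {g} (d , p) → ⁻¹∈ D d , trans (cong ((g ⁻¹) ▷_) (sym p))
                  (trans (sym (▷-∙ (g ⁻¹) g i)) (trans (cong (_▷ i) (inverseˡ g)) (▷-ε i))) }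

      module Orbit (c : Fin size) where
        i₀ = rep c

        from-i₀ : ∀ {i} → class i ≡ c → i₀ ~ i
        from-i₀ q = exact (trans (class-rep c) (sym q))

        -- Orbit and stabiliser: the fibres of `g ↦ g ▷ i₀` are cosets of the stabiliser.
        ∣orbit∣ : 1 * ∣ D ∣ ≡ ∣ stab i₀ ∣ * # (orbit? c)
        ∣orbit∣ = double-≡ (mem? D) (orbit? c) R? 1 ∣ stab i₀ ∣
          (λ g d → #-unique (row (mem? D) (orbit? c) R? g) {g ▷ i₀}
             ((tt , trans (sym (sound (g , d , refl))) (class-rep c)) , refl) (λ i → sym ∘ proj₂))
          (λ { i (_ , q) → column i (from-i₀ q) })
          where
          R? : ∀ g i → Dec (g ▷ i₀ ≡ i)
          R? g i = g ▷ i₀ ≟ i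
          column : ∀ i → i₀ ~ i → # (col (mem? D) (orbit? c) R? i) ≡ ∣ stab i₀ ∣
          column i (g₀ , d₀ , refl) = trans
            (#-cong (col (mem? D) (orbit? c) R? i) (λ g → mem? (stab i₀) (g₀ ⁻¹ ∙ g))
              (λ { g (d , q) → ∙∈ D (⁻¹∈ D d₀) d , trans (▷-∙ _ _ _) (trans (cong ((g₀ ⁻¹) ▷_) q)
                     (trans (sym (▷-∙ _ _ _)) (trans (cong (_▷ i₀) (inverseˡ g₀)) (▷-ε i₀)))) })
              (λ { g (d , q) → ∈-cancelˡ D (⁻¹∈ D d₀) d , trans (cong (_▷ i₀) (solve (g₀ ∷ g ∷ []) x₁ (x₀ ⊙ (inv x₀ ⊙ x₁)) refl))
                     (trans (▷-∙ _ _ _) (cong (g₀ ▷_) q)) }))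
            (#-translateˡ (mem? (stab i₀)) (g₀ ⁻¹))

        -- A fixed representative is its whole orbit. Otherwise the orbit has no fixed point, and
        -- its length is the index of a proper subgroup of `D`.
        orbit-size : Dec (Fixed i₀) → ∃ λ q → # (orbit? c) ≡ # (fixed-in? c) + p * q
        orbit-size (yes f) = 0 , trans
          (#-unique (orbit? c) (tt , class-rep c) (λ { i (_ , q) → only i q }))
          (sym (trans (cong (# (fixed-in? c) +_) (*-zeroʳ p)) (trans (+-identityʳ _)
            (#-unique (fixed-in? c) (f , class-rep c) (λ { i (_ , q) → only i q })))))
          where
          only : ∀ i → class i ≡ c → i ≡ i₀
          only i q with from-i₀ q
          ... | g , d , e = trans (sym e) (f g d)
        orbit-size (no ¬f) = from (isP (stab i₀) proj₁)
          where
          none : # (fixed-in? c) ≡ 0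
          none = #-none (fixed-in? c) (λ { i (f , q) → ¬f (moved i f (~-sym (from-i₀ q))) })
            where
            moved : ∀ i → Fixed i → i ~ i₀ → Fixed i₀
            moved i f (g , d , e) = subst Fixed (trans (sym (f g d)) e) f
          from : (D ⊆ stab i₀) ⊎ p * ∣ stab i₀ ∣ ∣ ∣ D ∣ → ∃ λ q → # (orbit? c) ≡ # (fixed-in? c) + p * q
          from (inj₁ s) = contradiction (λ g d → proj₂ (s d)) ¬f
          from (inj₂ (divides q e)) = q , trans (*-cancelˡ-≡ _ _ ∣ stab i₀ ∣ {{>-nonZero (∣G∣≥1 (stab i₀))}} (begin
              ∣ stab i₀ ∣ * # (orbit? c) ≡⟨ sym ∣orbit∣ ⟩
              1 * ∣ D ∣                  ≡⟨ trans (*-identityˡ _) e ⟩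
              q * (p * ∣ stab i₀ ∣)      ≡⟨ sym (*-assoc q p _) ⟩
              q * p * ∣ stab i₀ ∣        ≡⟨ *-comm (q * p) _ ⟩
              ∣ stab i₀ ∣ * (q * p)      ≡⟨ cong (∣ stab i₀ ∣ *_) (*-comm q p) ⟩
              ∣ stab i₀ ∣ * (p * q)      ∎)) (cong (_+ p * q) (sym none))
            where open ≡-Reasoning

      fixed-count : ∃ λ q → m ≡ # Fixed? + p * q
      fixed-count = sum q , (begin
        m                                          ≡⟨ sym #-whole ⟩
        # (whole {m})                                    ≡⟨ #-fibres whole class ⟩
        sum (λ c → # (orbit? c))                   ≡⟨ sum-cong-≗ (λ c → proj₂ (sizes c)) ⟩
        sum (λ c → # (fixed-in? c) + p * q c)      ≡⟨ ∑-distrib-+ (λ c → # (fixed-in? c)) (λ c → p * q c) ⟩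
        sum (λ c → # (fixed-in? c)) + sum (λ c → p * q c) ≡⟨ cong₂ _+_ (sym (#-fibres Fixed? class)) (sum-*ˡ p q) ⟩
        # Fixed? + p * sum q                       ∎)
        where
        open ≡-Reasoning
        sizes : ∀ c → ∃ λ q → # (orbit? c) ≡ # (fixed-in? c) + p * q
        sizes c = Orbit.orbit-size c (Fixed? (rep c))
        q : Fin size → ℕ
        q c = proj₁ (sizes c)

    -- The induction is on k, a bound for ∣ Z ∣ − ∣ M ∣.
    cauchy : ∀ k M Z → ∣ Z ∣ ≤ ∣ M ∣ + k → M ⊆ Z → (∀ {x y} → x ∈ Z → y ∈ Z → ⟨ x , y ⟩ ∈ M) →
             p * ∣ M ∣ ∣ ∣ Z ∣ → ∃ λ z → z ∈ Z × ¬ z ∈ M × pow z p ∈ M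
    cauchy zero M Z le M⊆Z com d = contradiction
      (≤-trans (∣⇒≤ {{>-nonZero (∣G∣≥1 Z)}} d) (≤-trans le (≤-reflexive (+-identityʳ _))))
      (<⇒≱ (≤-trans (m<m*n ∣ M ∣ p {{>-nonZero (∣G∣≥1 M)}} (prime≥2 pr)) (≤-reflexive (*-comm ∣ M ∣ p))))
    cauchy (suc k) M Z le M⊆Z com d = from (⊆-dec Z M)
      where
      from : ((Z ⊆ M) ⊎ ∃ λ x → x ∈ Z × ¬ x ∈ M) → ∃ λ z → z ∈ Z × ¬ z ∈ M × pow z p ∈ M
      from (inj₁ Z⊆M) = cauchy zero M Z (≤-trans (⊆⇒≤ Z M Z⊆M) (≤-reflexive (sym (+-identityʳ _)))) M⊆Z com d
      from (inj₂ (x , x∈Z , x∉M)) = from-dec (p ∣? order)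
        where
        open Adjoin M x (λ d → com x∈Z (M⊆Z d))
        N = order
        M′ = adjoin
        M′⊆Z : M′ ⊆ Z
        M′⊆Z = adjoin⊆ {Z} M⊆Z x∈Z
        p*M′∣Z : ¬ p ∣ N → p * ∣ M′ ∣ ∣ ∣ Z ∣
        p*M′∣Z p∤N = step (lagrange M′ Z M′⊆Z) d
          where
          instance _ = >-nonZero (∣G∣≥1 M)
          step : ∣ M′ ∣ ∣ ∣ Z ∣ → p * ∣ M ∣ ∣ ∣ Z ∣ → p * ∣ M′ ∣ ∣ ∣ Z ∣
          step (divides q e) d = subst (p * ∣ M′ ∣ ∣_) (sym e) (*-monoˡ-∣ ∣ M′ ∣ p∣q)
            where
            p∣qN : p ∣ q * N
            p∣qN = *-cancelʳ-∣ ∣ M ∣ (subst (p * ∣ M ∣ ∣_) (trans e (trans (cong (q *_) ∣adjoin∣) (sym (*-assoc q N ∣ M ∣)))) d)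
            p∣q : p ∣ q
            p∣q with euclidsLemma q N pr p∣qN
            ... | inj₁ h = h
            ... | inj₂ h = contradiction h p∤N
        smaller : ∣ Z ∣ ≤ ∣ M′ ∣ + k
        smaller = ≤-trans le (≤-trans (≤-reflexive (+-suc ∣ M ∣ k)) (+-monoˡ-≤ k M<M′))
          where
          M<M′ : ∣ M ∣ < ∣ M′ ∣
          M<M′ = ≤∧≢⇒< (⊆⇒≤ M M′ D⊆adjoin)
            (λ eq → x∉M (#-full (mem? M) (mem? M′) (λ _ → D⊆adjoin) (≤-reflexive (sym eq)) x x∈adjoin))
        from-dec : Dec (p ∣ N) → ∃ λ z → z ∈ Z × ¬ z ∈ M × pow z p ∈ M
        -- Here `N = q p`, so `x ^ q` has order exactly `p` modulo `M`.
        from-dec (yes (divides q e)) = pow x q , pow-∈ Z q x∈Z , (λ h → N∤q (order-∣ q h)) ,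
          ≡∈ M (trans (cong (pow x) (trans e (*-comm q p))) (sym (pow-* x q p))) pow-order
          where
          q≢0 : q ≢ 0
          q≢0 refl = contradiction e λ ()
          N∤q : ¬ N ∣ q
          N∤q N∣q = contradiction (∣⇒≤ {{≢-nonZero q≢0}} N∣q)
            (<⇒≱ (≤-trans (m<m*n q p {{≢-nonZero q≢0}} (prime≥2 pr)) (≤-reflexive (sym e))))
        -- A solution `y` modulo `M ⟨x⟩` is raised to the power `N`. This moves `y ^ p`, which lies
        -- in some `x ^ i M`, into `M`, while `y ^ N` stays outside since `p` does not divide `N`.
        from-dec (no p∤N) = lift (cauchy k M′ Z smaller M′⊆Z (λ a b → D⊆adjoin (com a b)) (p*M′∣Z p∤N))
          where
          lift : (∃ λ z → z ∈ Z × ¬ z ∈ M′ × pow z p ∈ M′) → ∃ λ z → z ∈ Z × ¬ z ∈ M × pow z p ∈ M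
          lift (y , y∈Z , y∉M′ , i , yp) = pow y N , pow-∈ Z N y∈Z , y^N∉M , y^Np∈M
            where
            y^Np∈M : pow (pow y N) p ∈ M
            y^Np∈M = ≡∈ M (trans (pow-* y p N) (trans (cong (pow y) (*-comm N p)) (sym (pow-* y N p))))
              (InPower-D (N * toℕ i) (≡∈ M (cong (pow x) (*-comm (toℕ i) N)) (pow-order-* (toℕ i))) (InPower-pow (toℕ i) N yp))
            module Y = Adjoin M′ y (λ d → D⊆adjoin (com y∈Z (M′⊆Z d)))
            y^N∉M : ¬ pow y N ∈ M
            y^N∉M h with prime⇒irreducible pr (Y.order-∣ p (i , yp))
            ... | inj₁ o≡1 = y∉M′ (≡∈ M′ (trans (cong (pow y) o≡1) (pow-1 y)) Y.pow-order)
            ... | inj₂ o≡p = p∤N (subst (_∣ N) o≡p (Y.order-∣ N (D⊆adjoin h)))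

-- Normal subgroups, centres of quotients, central chains

module NormalSubgroups {n : ℕ} (𝔾 : FinGroup n) where
  open FinGroupTheory 𝔾
  open GroupActions 𝔾

  Normal : Subgroup → Set
  Normal M = ∀ h {x} → x ∈ M → h ⁻¹ ∙ x ∙ h ∈ M

  ⟨⟩-sym : ∀ G {x y} → ⟨ x , y ⟩ ∈ G → ⟨ y , x ⟩ ∈ G
  ⟨⟩-sym G {x} {y} p = ≡∈ G (solve (x ∷ y ∷ []) (inv (inv (x₀ ⊙ x₁) ⊙ (x₁ ⊙ x₀))) (inv (x₁ ⊙ x₀) ⊙ (x₀ ⊙ x₁)) refl) (⁻¹∈ G p)

  conj≡ : ∀ x h → h ⁻¹ ∙ x ∙ h ≡ x ∙ ⟨ h , x ⟩
  conj≡ x h = solve (x ∷ h ∷ []) (inv x₁ ⊙ x₀ ⊙ x₁) (x₀ ⊙ (inv (x₁ ⊙ x₀) ⊙ (x₀ ⊙ x₁))) refl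

  ⟨⟩≡ : ∀ h x → ⟨ h , x ⟩ ≡ x ⁻¹ ∙ (h ⁻¹ ∙ x ∙ h)
  ⟨⟩≡ h x = solve (x ∷ h ∷ []) (inv (x₁ ⊙ x₀) ⊙ (x₀ ⊙ x₁)) (inv x₀ ⊙ (inv x₁ ⊙ x₀ ⊙ x₁)) refl

  normal-⟨⟩ : ∀ M → Normal M → ∀ h {x} → x ∈ M → ⟨ h , x ⟩ ∈ M
  normal-⟨⟩ M N h {x} p = ≡∈ M (sym (⟨⟩≡ h x)) (∙∈ M (⁻¹∈ M p) (N h p))

  ⟨⟩-normal : ∀ M → (∀ h {x} → x ∈ M → ⟨ h , x ⟩ ∈ M) → Normal M
  ⟨⟩-normal M c h {x} p = ≡∈ M (sym (conj≡ x h)) (∙∈ M p (c h p))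

  conj⁻¹ : ∀ M → Normal M → ∀ h {x} → x ∈ M → h ∙ x ∙ h ⁻¹ ∈ M
  conj⁻¹ M N h {x} p = ≡∈ M (solve (x ∷ h ∷ []) (inv (inv x₁) ⊙ x₀ ⊙ inv x₁) (x₁ ⊙ x₀ ⊙ inv x₁) refl) (N (h ⁻¹) p)

  ∩-normal : ∀ M K → Normal M → Normal K → Normal (M ∩ K)
  ∩-normal M K a b h (p , q) = a h p , b h q

  -- H with equality modulo M plays the role of the quotient H / M.
  module Modulo (M : Subgroup) (N : Normal M) where
    modGroup : Group 0ℓ 0ℓ
    modGroup = record
      { Carrier = H
      ; _≈_ = λ x y → x ⁻¹ ∙ y ∈ M
      ; _∙_ = _∙_ ; ε = ε ; _⁻¹ = _⁻¹
      ; isGroup = record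
        { isMonoid = record
          { isSemigroup = record
            { isMagma = record
              { isEquivalence = record
                { refl = λ {x} → ≡∈ M (sym (inverseˡ x)) (ε∈ M) ; sym = coset-sym M ; trans = coset-trans M }
              ; ∙-cong = λ {x} {y} {u} {v} p q → ≡∈ M
                  (solve (x ∷ y ∷ u ∷ v ∷ []) (inv x₂ ⊙ (inv x₀ ⊙ x₁) ⊙ x₂ ⊙ (inv x₂ ⊙ x₃)) (inv (x₀ ⊙ x₂) ⊙ (x₁ ⊙ x₃)) refl)
                  (∙∈ M (N u p) q) }
            ; assoc = λ x y z → ≡≈ (assoc x y z) }
          ; identity = (λ x → ≡≈ (identityˡ x)) , (λ x → ≡≈ (identityʳ x)) }
        ; inverse = (λ x → ≡≈ (inverseˡ x)) , (λ x → ≡≈ (inverseʳ x))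
        ; ⁻¹-cong = λ {x} {y} p → ≡∈ M
            (solve (x ∷ y ∷ []) (inv (inv x₁) ⊙ (inv (inv x₀ ⊙ x₁)) ⊙ inv x₁) (inv (inv x₀) ⊙ inv x₁) refl) (N (y ⁻¹) (⁻¹∈ M p)) } }
      where
      ≡≈ : ∀ {x y} → x ≡ y → x ⁻¹ ∙ y ∈ M
      ≡≈ {x} refl = ≡∈ M (sym (inverseˡ x)) (ε∈ M)

    open Commuting modGroup public using (Comm; Comm-∙; Comm-ε; Comm-⁻¹; Comm-resp; Comm-conj; comm-⟨⟩-of-central; comm-of-commuting-⟨⟩)
    open Group modGroup public using (_≈_) renaming (refl to ≈-refl; sym to ≈-sym; trans to ≈-trans; ∙-congˡ to ≈-congˡ; ∙-congʳ to ≈-congʳ; ∙-cong to ≈-cong)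

    centraliser : H → Subgroup
    centraliser x = record
      { mem = λ y → ⟨ x , y ⟩ ∈ M ; mem? = λ y → mem? M ⟨ x , y ⟩
      ; ε∈ = Comm-ε {x} ; ∙∈ = λ {y} {z} → Comm-∙ {x} {y} {z} ; ⁻¹∈ = λ {y} → Comm-⁻¹ {x} {y} }

    centre : Subgroup
    centre = record
      { mem = λ z → ∀ h → ⟨ z , h ⟩ ∈ M ; mem? = λ z → all? (λ h → mem? M ⟨ z , h ⟩)
      ; ε∈ = λ h → flip ε h (Comm-ε {h})
      ; ∙∈ = λ {y} {z} p q h → flip (y ∙ z) h (Comm-∙ {h} {y} {z} (flip h y (p h)) (flip h z (q h)))
      ; ⁻¹∈ = λ {y} p h → flip (y ⁻¹) h (Comm-⁻¹ {h} {y} (flip h y (p h))) }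
      where
      flip : ∀ x y → ⟨ y , x ⟩ ∈ M → ⟨ x , y ⟩ ∈ M
      flip x y = ⟨⟩-sym M

    M⊆centre : M ⊆ centre
    M⊆centre p h = ⟨⟩-sym M (normal-⟨⟩ M N h p)

    ~ : Quotient (λ x y → x ⁻¹ ∙ y ∈ M)
    ~ = cosets M
    open Quotient ~ public renaming (size to index)

    ∣fibre∣ : ∀ c → # (λ x → class x ≟ c) ≡ ∣ M ∣
    ∣fibre∣ c = trans (#-cong (λ x → class x ≟ c) (λ x → mem? M (rep c ⁻¹ ∙ x))
        (λ { x e → exact (trans (class-rep c) (sym e)) }) (λ x p → trans (sym (sound p)) (class-rep c)))
      (#-translateˡ (mem? M) (rep c ⁻¹))

    n≡∣M∣*index : n ≡ ∣ M ∣ * index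
    n≡∣M∣*index = begin
      n                                             ≡⟨ sym #-whole ⟩
      # (whole {n})                                       ≡⟨ #-fibres whole class ⟩
      sum (λ c → # (λ x → whole x ×-dec (class x ≟ c))) ≡⟨ sum-cong-≗ (λ c → trans (#-cong (λ x → whole x ×-dec (class x ≟ c)) (λ x → class x ≟ c) (λ _ → proj₂) (λ _ e → tt , e)) (∣fibre∣ c)) ⟩
      sum {index} (λ _ → ∣ M ∣)                     ≡⟨ sum-const index ∣ M ∣ ⟩
      index * ∣ M ∣                                 ≡⟨ *-comm index ∣ M ∣ ⟩
      ∣ M ∣ * index ∎
      where
      open ≡-Reasoning

    instance
      M≢0 : NonZero ∣ M ∣
      M≢0 = >-nonZero (∣G∣≥1 M)

    module _ {p} (pr : Prime p) (isP : IndexDivisible p full) where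

      infixr 5 _▷_
      _▷_ : H → Fin index → Fin index
      h ▷ c = class (h ∙ rep c ∙ h ⁻¹)

      ▷-class : ∀ h x → h ▷ class x ≡ class (h ∙ x ∙ h ⁻¹)
      ▷-class h x = sound (≡∈ M
        (solve (h ∷ rep (class x) ∷ x ∷ []) (x₀ ⊙ (inv x₁ ⊙ x₂) ⊙ inv x₀) (inv (x₀ ⊙ x₁ ⊙ inv x₀) ⊙ (x₀ ⊙ x₂ ⊙ inv x₀)) refl)
        (conj⁻¹ M N h (exact (class-rep (class x)))))

      open Action pr full isP _▷_
        (λ c → trans (cong class (solve (rep c ∷ []) (one ⊙ x₀ ⊙ inv one) x₀ refl)) (class-rep c))
        (λ g h c → trans (cong class (solve (g ∷ h ∷ rep c ∷ []) (x₀ ⊙ x₁ ⊙ x₂ ⊙ inv (x₀ ⊙ x₁)) (x₀ ⊙ (x₁ ⊙ x₂ ⊙ inv x₁) ⊙ inv x₀) refl))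
                         (sym (▷-class g _)))
        using (Fixed; Fixed?; fixed-count)

      fixed⇒central : ∀ x → Fixed (class x) → x ∈ centre
      fixed⇒central x f h = ≡∈ M
        (solve (x ∷ h ∷ []) (inv (inv x₁ ⊙ x₀ ⊙ inv (inv x₁)) ⊙ x₀) (inv (x₀ ⊙ x₁) ⊙ (x₁ ⊙ x₀)) refl)
        (exact (trans (sym (▷-class (h ⁻¹) x)) (f (h ⁻¹) tt)))

      central⇒fixed : ∀ x → x ∈ centre → Fixed (class x)
      central⇒fixed x z h _ = trans (▷-class h x) (sound (≡∈ M
        (solve (x ∷ h ∷ []) (inv (x₀ ⊙ inv x₁) ⊙ (inv x₁ ⊙ x₀)) (inv (x₁ ⊙ x₀ ⊙ inv x₁) ⊙ x₀) refl)
        (z (h ⁻¹))))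

      ∣centre∣ : ∣ centre ∣ ≡ ∣ M ∣ * # Fixed?
      ∣centre∣ = trans (sym (*-identityˡ _)) (double-≡ (mem? centre) Fixed? (λ x c → class x ≟ c) 1 ∣ M ∣
        (λ x z → #-unique (row (mem? centre) Fixed? (λ x c → class x ≟ c) x) (central⇒fixed x z , refl) (λ c → sym ∘ proj₂))
        (λ { c f → trans (#-cong (col (mem? centre) Fixed? (λ x c → class x ≟ c) c) (λ x → class x ≟ c) (λ _ → proj₂)
                     (λ { x e → fixed⇒central x (subst Fixed (sym e) f) , e })) (∣fibre∣ c) }))

      proper⇒p∣index : ∀ {x} → ¬ x ∈ M → p ∣ index
      proper⇒p∣index {x} x∉M = from (isP M (λ _ → tt))
        where
        from : (full ⊆ M) ⊎ p * ∣ M ∣ ∣ ∣ full ∣ → p ∣ index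
        from (inj₁ s) = contradiction (s tt) x∉M
        from (inj₂ d) = *-cancelʳ-∣ ∣ M ∣ (subst (p * ∣ M ∣ ∣_) (trans ∣full∣ (trans n≡∣M∣*index (*-comm ∣ M ∣ index))) d)

      -- Class equation for conjugation on the cosets of `M`: the number of cosets is a multiple of
      -- `p`, hence so is that of the fixed ones. Their union is `centre`, and Cauchy applies to it
      -- modulo `M`.
      central-step : ∀ {x} → ¬ x ∈ M → ∃ λ z → z ∈ centre × ¬ z ∈ M × pow z p ∈ M
      central-step x∉M = cauchy pr ∣ centre ∣ M centre (m≤n+m _ _) M⊆centre (λ a _ → a _)
        (subst (p * ∣ M ∣ ∣_) (trans (*-comm (# Fixed?) ∣ M ∣) (sym ∣centre∣)) (*-monoˡ-∣ ∣ M ∣ p∣F))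
        where
        p∣F : p ∣ # Fixed?
        p∣F = ∣m+n∣m⇒∣n (subst (p ∣_) (trans (proj₂ fixed-count) (+-comm (# Fixed?) _)) (proper⇒p∣index x∉M)) (m∣m*n (proj₁ fixed-count))

  -- Indexed by the top of the chain; each `step` is a factor `M′ / M` centralised by the whole
  -- group.
  data CentralChain : Subgroup → Set₁ where
    base : ∀ {M} → Normal M → M ⊆ trivial → CentralChain M
    step : ∀ {M M′} → CentralChain M → Normal M′ → M ⊆ M′ → (∀ h {x} → x ∈ M′ → ⟨ h , x ⟩ ∈ M) → CentralChain M′

  chain-normal : ∀ {M} → CentralChain M → Normal M
  chain-normal (base N _)     = N
  chain-normal (step _ N _ _) = N

  record Nilpotent (p : ℕ) : Set₁ where
    field
      exponent : ℕ
      n≡p^     : n ≡ p ^ exponent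
      top      : Subgroup
      chain    : CentralChain top
      full⊆top : full ⊆ top

  module _ {p} (pr : Prime p) (isP : IndexDivisible p full) where

    -- As long as `M` is proper, an element of order `p` that is central modulo `M` is adjoined; `k`
    -- bounds the number of elements still missing.
    climb : ∀ k M j → CentralChain M → ∣ M ∣ ≡ p ^ j → n ≤ ∣ M ∣ + k → Nilpotent p
    climb k M j ch e le = from k le (⊆-dec full M)
      where
      N = chain-normal ch
      open Modulo M N
      from : ∀ k → n ≤ ∣ M ∣ + k → (full ⊆ M) ⊎ (∃ λ x → x ∈ full × ¬ x ∈ M) → Nilpotent p
      from k le (inj₁ s) = record { exponent = j ; n≡p^ = trans (sym ∣full∣) (trans (#-cong (mem? full) (mem? M) (λ _ → s) (λ _ _ → tt)) e)
                                  ; top = M ; chain = ch ; full⊆top = s }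
      from zero le (inj₂ (x , _ , x∉M)) = contradiction
        (#-full (mem? M) (mem? full) (λ _ _ → tt) (≤-trans (≤-reflexive ∣full∣) (≤-trans le (≤-reflexive (+-identityʳ _)))) x tt) x∉M
      from (suc k) le (inj₂ (x , _ , x∉M)) = add (central-step pr isP x∉M)
        where
        add : (∃ λ z → z ∈ centre × ¬ z ∈ M × pow z p ∈ M) → Nilpotent p
        add (z , z∈C , z∉M , zp) = climb k adjoin (suc j) chain′ size (≤-trans le (≤-trans (≤-reflexive (+-suc ∣ M ∣ k)) (+-monoˡ-≤ k bigger)))
          where
          open Adjoin M z (λ d → z∈C _)
          order≡p : order ≡ p
          order≡p with prime⇒irreducible pr (order-∣ p zp)
          ... | inj₁ o≡1 = contradiction (≡∈ M (trans (cong (pow z) o≡1) (pow-1 z)) pow-order) z∉M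
          ... | inj₂ o≡p = o≡p
          size : ∣ adjoin ∣ ≡ p ^ suc j
          size = trans ∣adjoin∣ (cong₂ _*_ order≡p e)
          bigger : ∣ M ∣ < ∣ adjoin ∣
          bigger = ≤-trans (m<m*n ∣ M ∣ p (prime≥2 pr)) (≤-reflexive (trans (*-comm ∣ M ∣ p) (sym (trans ∣adjoin∣ (cong (_* ∣ M ∣) order≡p)))))
          central : ∀ h {y} → y ∈ adjoin → ⟨ h , y ⟩ ∈ M
          central h q = ⟨⟩-sym M (adjoin⊆ {centre} M⊆centre z∈C q h)
          chain′ : CentralChain adjoin
          chain′ = step ch (⟨⟩-normal adjoin (λ h q → D⊆adjoin (central h q))) D⊆adjoin central

    nilpotent : Nilpotent p
    nilpotent = climb n trivial 0 (base (λ { h refl → solve (h ∷ []) (inv x₀ ⊙ one ⊙ x₀) one refl }) id) ∣trivial∣ (m≤n+m n _)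

#-remove : ∀ {n} {P : Fin n → Set} (P? : Decidable P) {a} → P a → # P? ≡ suc (# (λ x → P? x ×-dec ¬? (x ≟ a)))
#-remove {P = P} P? {a} pa = trans (#-split P? (_≟ a)) (cong (_+ # (λ x → P? x ×-dec ¬? (x ≟ a))) (#-unique (λ x → P? x ×-dec (x ≟ a)) (pa , refl) (λ _ → proj₂)))

-- Kantor families with normal tangent groups

two-others : ∀ {t} → 2 ≤ t → (k : Fin (suc t)) → ∃ λ i → ∃ λ j → i ≢ k × j ≢ k × i ≢ j
two-others (s≤s (s≤s _)) zero          = suc zero , suc (suc zero) , (λ ()) , (λ ()) , λ ()
two-others (s≤s (s≤s _)) (suc zero)    = zero , suc (suc zero) , (λ ()) , (λ ()) , λ ()
two-others (s≤s (s≤s _)) (suc (suc k)) = zero , suc zero , (λ ()) , (λ ()) , λ ()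

-- A k is the stabiliser of the k-th line on the base point, A* k that of its point collinear
-- with x, S the group of symmetries; A*-normal is property (*).
record Kantor {n} (𝔾 : FinGroup n) (s t : ℕ) : Set₁ where
  open FinGroupTheory 𝔾
  open NormalSubgroups 𝔾
  field
    A A*     : Fin (suc t) → Subgroup
    S        : Subgroup
    S-normal : Normal S
    A*-normal : ∀ k → Normal (A* k)
    A⊆A*     : ∀ k → A k ⊆ A* k
    S⊆A*     : ∀ k → S ⊆ A* k
    split    : ∀ k {h} → h ∈ A* k → ∃ λ σ → σ ∈ S × h ∙ σ ⁻¹ ∈ A k
    A∩A*     : ∀ {i j x} → i ≢ j → x ∈ A i → x ∈ A* j → x ≡ ε
    -- `cover` and `uniq` are existence and uniqueness in the quadrangle axiom for an affine point
    -- and a line on the base point; `prod` is the axiom for a point collinear with the centre.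
    cover    : ∀ k {h} → ¬ h ∈ A* k → ∃ λ j → j ≢ k × ∃ λ a → a ∈ A k × a ⁻¹ ∙ h ∈ A j
    uniq     : ∀ {k j l a b c} → j ≢ k → l ≢ k → a ∈ A k → b ∈ A j → c ∈ A l → b ≡ a ∙ c → a ≡ ε
    prod     : ∀ {i j} h → i ≢ j → ∃ λ a → a ∈ A i × a ⁻¹ ∙ h ∈ A* j
    ∣A∣      : ∀ k → ∣ A k ∣ ≡ s
    ∣S∣      : ∣ S ∣ ≡ t
    2≤s      : 2 ≤ s
    2≤t      : 2 ≤ t

module KantorTheory {n s t} {𝔾 : FinGroup n} (𝕂 : Kantor 𝔾 s t) where
  open FinGroupTheory 𝔾
  open GroupActions 𝔾
  open NormalSubgroups 𝔾
  open Kantor 𝕂 public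

  others : ∀ k → ∃ λ i → ∃ λ j → i ≢ k × j ≢ k × i ≢ j
  others = two-others 2≤t

  -- In `x = a σ` with `a ∈ A i` and `σ ∈ S`, the factor `a` also lies in `A* j` and so is trivial.
  A*∩A* : ∀ {i j x} → i ≢ j → x ∈ A* i → x ∈ A* j → x ∈ S
  A*∩A* {i} {j} {x} i≢j p q with split i p
  ... | σ , σ∈S , a = subst (_∈ S) (solve-for (A∩A* i≢j a (∙∈ (A* j) q (⁻¹∈ (A* j) (S⊆A* j σ∈S))))) σ∈S
    where
    solve-for : x ∙ σ ⁻¹ ≡ ε → σ ≡ x
    solve-for eq = begin
      σ                ≡⟨ identityˡ σ ⟨
      ε ∙ σ            ≡⟨ cong (_∙ σ) eq ⟨
      x ∙ σ ⁻¹ ∙ σ     ≡⟨ solve (x ∷ σ ∷ []) (x₀ ⊙ inv x₁ ⊙ x₁) x₀ refl ⟩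
      x                ∎
      where open ≡-Reasoning

  A∩S : ∀ {k x} → x ∈ A k → x ∈ S → x ≡ ε
  A∩S {k} p q with others k
  ... | i , _ , i≢k , _ = A∩A* (λ e → i≢k (sym e)) p (S⊆A* i q)

  open Modulo S S-normal using () renaming (Comm to CommS; Comm-∙ to CommS-∙; Comm-resp to CommS-resp)

  -- A commutator of elements of two normal subgroups lies in their intersection.
  A*-comm : ∀ {i j x y} → i ≢ j → x ∈ A* i → y ∈ A* j → ⟨ x , y ⟩ ∈ S
  A*-comm {i} {j} {x} {y} i≢j p q = A*∩A* i≢j
    (≡∈ (A* i) (solve (x ∷ y ∷ []) (inv (inv x₁ ⊙ x₀ ⊙ x₁) ⊙ x₀) (inv (x₀ ⊙ x₁) ⊙ (x₁ ⊙ x₀)) refl)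
      (∙∈ (A* i) (⁻¹∈ (A* i) (A*-normal i y p)) p))
    (normal-⟨⟩ (A* j) (A*-normal j) x q)

  -- Modulo S, each component commutes with the product of two others, which is everything.
  A*-central : ∀ k {y} → y ∈ A* k → ∀ h → ⟨ y , h ⟩ ∈ S
  A*-central k {y} q h with others k
  ... | i , j , i≢k , j≢k , i≢j with prod h i≢j
  ...   | a , a∈A , b∈A* = subst (λ z → ⟨ y , z ⟩ ∈ S) (solve (a ∷ h ∷ []) (x₀ ⊙ (inv x₀ ⊙ x₁)) x₁ refl)
    (CommS-∙ {y} {a} {a ⁻¹ ∙ h} (A*-comm (λ e → i≢k (sym e)) q (A⊆A* i a∈A)) (A*-comm (λ e → j≢k (sym e)) q b∈A*))

  commutator∈S : ∀ x y → ⟨ x , y ⟩ ∈ S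
  commutator∈S x y with others zero
  ... | i , j , _ , _ , i≢j with prod x i≢j
  ...   | a , a∈A , b∈A* = ⟨⟩-sym S (subst (λ z → ⟨ y , z ⟩ ∈ S) (solve (a ∷ x ∷ []) (x₀ ⊙ (inv x₀ ⊙ x₁)) x₁ refl)
    (CommS-∙ {y} {a} {a ⁻¹ ∙ x} (⟨⟩-sym S (A*-central i (A⊆A* i a∈A) y)) (⟨⟩-sym S (A*-central j b∈A* y))))

  A-abelian : ∀ k → Abelian (A k)
  A-abelian k {x} {y} p q = A∩S (∙∈ (A k) (⁻¹∈ (A k) (∙∈ (A k) p q)) (∙∈ (A k) q p)) (commutator∈S x y)

  nontrivial : ∀ k → ∃ λ a → a ∈ A k × a ≢ ε
  nontrivial k = from (⊆-dec (A k) trivial)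
    where
    from : (A k ⊆ trivial) ⊎ (∃ λ a → a ∈ A k × a ≢ ε) → ∃ λ a → a ∈ A k × a ≢ ε
    from (inj₂ w) = w
    from (inj₁ h) = contradiction (≤-trans 2≤s (≤-trans (≤-reflexive (sym (∣A∣ k))) (⊆⇒≤ (A k) trivial h)))
                                  (<⇒≱ (s≤s (≤-reflexive ∣trivial∣)))

  A∩A : ∀ {i j x} → x ∈ A i → x ∈ A j → x ≢ ε → i ≡ j
  A∩A {i} {j} p q x≢ε with i ≟ j
  ... | yes e = e
  ... | no ne = contradiction (A∩A* ne p (A⊆A* j q)) x≢ε

  A∖ε? : ∀ k → Decidable (λ x → x ∈ A k × x ≢ ε)
  A∖ε? k x = mem? (A k) x ×-dec ¬? (x ≟ ε)

  ∣A∖ε∣ : ∀ k → suc (# (A∖ε? k)) ≡ s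
  ∣A∖ε∣ k = trans (sym (#-remove (mem? (A k)) (ε∈ (A k)))) (∣A∣ k)

  -- Fix b ∈ A i; the elements c ∈ A j with b c ∈ A* l are distinct for distinct l.
  t≤s : t ≤ s
  t≤s with others zero
  ... | i , j , i≢0 , j≢0 , i≢j = s≤s⁻¹ (begin
    suc t                    ≡⟨ sym (#-whole {suc t}) ⟩
    # (whole {suc t})          ≡⟨ #-remove whole {i} tt ⟩
    suc (# (λ l → whole l ×-dec ¬? (l ≟ i)))  ≡⟨ cong suc (#-remove (λ l → whole l ×-dec ¬? (l ≟ i)) {j} (tt , λ e → i≢j (sym e))) ⟩
    suc (suc (# L?))         ≤⟨ s≤s (s≤s inj) ⟩
    suc (suc (# (A∖ε? j)))   ≡⟨ cong suc (∣A∖ε∣ j) ⟩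
    suc s                    ∎)
    where
    open ≤-Reasoning
    b = proj₁ (nontrivial i)
    b∈A = proj₁ (proj₂ (nontrivial i))
    b≢ε = proj₂ (proj₂ (nontrivial i))
    L? : Decidable (λ l → (⊤ × l ≢ i) × l ≢ j)
    L? l = (whole l ×-dec ¬? (l ≟ i)) ×-dec ¬? (l ≟ j)
    R? : ∀ l c → Dec (b ∙ c ∈ A* l)
    R? l c = mem? (A* l) (b ∙ c)
    inj : # L? ≤ # (A∖ε? j)
    inj = subst₂ _≤_ (*-identityˡ _) (*-identityˡ _) (double-≤ L? (A∖ε? j) R? 1 1
      (λ { l ((_ , l≢i) , l≢j) → some l l≢i l≢j (prod (b ⁻¹) (λ e → l≢j (sym e))) })
      (λ { c (c∈A , _) → #-! (col L? (A∖ε? j) R? c) (λ { l l′ (_ , p) (_ , q) → same c c∈A l l′ p q (l ≟ l′) }) }))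
      where
      some : ∀ l → l ≢ i → l ≢ j → (∃ λ a → a ∈ A j × a ⁻¹ ∙ b ⁻¹ ∈ A* l) → 1 ≤ # (row L? (A∖ε? j) R? l)
      some l l≢i l≢j (a , a∈A , p) = #-∃ (row L? (A∖ε? j) R? l) {a} ((a∈A , a≢ε) , ba∈)
        where
        ba∈ : b ∙ a ∈ A* l
        ba∈ = ≡∈ (A* l) (solve (a ∷ b ∷ []) (inv (inv x₀ ⊙ inv x₁)) (x₁ ⊙ x₀) refl) (⁻¹∈ (A* l) p)
        a≢ε : a ≢ ε
        a≢ε refl = b≢ε (A∩A* (λ e → l≢i (sym e)) b∈A (≡∈ (A* l) (identityʳ b) ba∈))
      same : ∀ c → c ∈ A j → ∀ l l′ → b ∙ c ∈ A* l → b ∙ c ∈ A* l′ → Dec (l ≡ l′) → l ≡ l′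
      same c c∈A l l′ p q (yes e) = e
      same c c∈A l l′ p q (no ne) = contradiction
        (A∩A* i≢j b∈A (∈-cancelʳ (A* j) (A⊆A* j c∈A) (S⊆A* j (A*∩A* ne p q)))) b≢ε

  module Containing (G : Subgroup) (k : Fin (suc t)) (A⊆G : A k ⊆ G) where

    S∩G = S ∩ G

    w : ℕ
    w = ∣ S∩G ∣

    inside? : Decidable (λ g → g ∈ G × g ∈ A* k)
    inside? g = mem? G g ×-dec mem? (A* k) g

    outside? : Decidable (λ g → g ∈ G × ¬ g ∈ A* k)
    outside? g = mem? G g ×-dec ¬? (mem? (A* k) g)

    B : H → Set
    B b = (b ∈ G × b ≢ ε) × ∃ λ j → j ≢ k × b ∈ A j

    B? : Decidable B
    B? b = (mem? G b ×-dec ¬? (b ≟ ε)) ×-dec any? (λ j → ¬? (j ≟ k) ×-dec mem? (A j) b)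

    ∣inside∣ : # inside? ≡ s * w
    ∣inside∣ = trans (sym (*-identityˡ _)) (double-≡ inside? (mem? S∩G) R? 1 s
      (λ { h (h∈G , h∈A*) → one-σ h h∈G (split k h∈A*) })
      (λ { σ (σ∈S , σ∈G) → trans (#-cong (col inside? (mem? S∩G) R? σ) (λ h → mem? (A k) (h ∙ σ ⁻¹)) (λ _ → proj₂)
          (λ h p → ( ∈-cancelʳ G (⁻¹∈ G σ∈G) (A⊆G p) , ∈-cancelʳ (A* k) (⁻¹∈ (A* k) (S⊆A* k σ∈S)) (A⊆A* k p)) , p))
          (trans (#-translateʳ (mem? (A k)) (σ ⁻¹)) (∣A∣ k)) }))
      where
      R? : ∀ h σ → Dec (h ∙ σ ⁻¹ ∈ A k)
      R? h σ = mem? (A k) (h ∙ σ ⁻¹)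
      one-σ : ∀ h → h ∈ G → (∃ λ σ → σ ∈ S × h ∙ σ ⁻¹ ∈ A k) → # (row inside? (mem? S∩G) R? h) ≡ 1
      one-σ h h∈G (σ , σ∈S , p) = #-unique (row inside? (mem? S∩G) R? h)
        ((σ∈S , ≡∈ G (solve (h ∷ σ ∷ []) (inv (x₀ ⊙ inv x₁) ⊙ x₀) x₁ refl) (∙∈ G (⁻¹∈ G (A⊆G p)) h∈G)) , p)
        (λ { τ ((τ∈S , _) , q) → begin
          τ                ≡⟨ solve (τ ∷ σ ∷ []) x₀ (x₀ ⊙ inv x₁ ⊙ x₁) refl ⟩
          τ ∙ σ ⁻¹ ∙ σ     ≡⟨ cong (_∙ σ) (A∩S (≡∈ (A k) (solve (h ∷ σ ∷ τ ∷ []) (inv (x₀ ⊙ inv x₂) ⊙ (x₀ ⊙ inv x₁)) (x₂ ⊙ inv x₁) refl)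
                                (∙∈ (A k) (⁻¹∈ (A k) q) p)) (∙∈ S τ∈S (⁻¹∈ S σ∈S))) ⟩
          ε ∙ σ            ≡⟨ identityˡ σ ⟩
          σ                ∎ })
        where open ≡-Reasoning

    left-factor? : ∀ g b → Dec (g ∙ b ⁻¹ ∈ A k)
    left-factor? g b = mem? (A k) (g ∙ b ⁻¹)
    one-b : ∀ g → g ∈ G → ¬ g ∈ A* k → # (row outside? B? left-factor? g) ≡ 1
    one-b g g∈G g∉A* = from (cover k g∉A*)
     where
     from : (∃ λ j → j ≢ k × ∃ λ a → a ∈ A k × a ⁻¹ ∙ g ∈ A j) → # (row outside? B? left-factor? g) ≡ 1
     from (j , j≢k , a , a∈A , b∈A) = #-unique (row outside? B? left-factor? g)
       (((∙∈ G (⁻¹∈ G (A⊆G a∈A)) g∈G , b≢ε) , j , j≢k , b∈A) , gb⁻¹∈A)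
       (λ { c (((_ , _) , l , l≢k , c∈A) , q) → begin
         c                          ≡⟨ solve (c ∷ b ∷ g ∷ []) x₀ (inv (x₁ ⊙ inv x₂ ⊙ (x₂ ⊙ inv x₀)) ⊙ x₁) refl ⟩
         (b ∙ g ⁻¹ ∙ (g ∙ c ⁻¹)) ⁻¹ ∙ b ≡⟨ cong (λ z → z ⁻¹ ∙ b) (uniq j≢k l≢k (∙∈ (A k) (≡∈ (A k) (solve (b ∷ g ∷ []) (inv (x₁ ⊙ inv x₀)) (x₀ ⊙ inv x₁) refl) (⁻¹∈ (A k) gb⁻¹∈A)) q) b∈A c∈A
                                                  (solve (c ∷ b ∷ g ∷ []) x₁ (x₁ ⊙ inv x₂ ⊙ (x₂ ⊙ inv x₀) ⊙ x₀) refl)) ⟩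
         ε ⁻¹ ∙ b                   ≡⟨ solve (b ∷ []) (inv one ⊙ x₀) x₀ refl ⟩
         b                          ∎ })
       where
       open ≡-Reasoning
       b = a ⁻¹ ∙ g
       gb⁻¹∈A : g ∙ b ⁻¹ ∈ A k
       gb⁻¹∈A = ≡∈ (A k) (solve (a ∷ g ∷ []) x₀ (x₁ ⊙ inv (inv x₀ ⊙ x₁)) refl) a∈A
       b≢ε : b ≢ ε
       b≢ε b≡ε = g∉A* (≡∈ (A* k) (trans (sym (identityʳ a)) (trans (cong (a ∙_) (sym b≡ε)) (solve (a ∷ g ∷ []) (x₀ ⊙ (inv x₀ ⊙ x₁)) x₁ refl))) (A⊆A* k a∈A))

    s-many : ∀ b → B b → # (col outside? B? left-factor? b) ≡ s
    s-many b ((b∈G , b≢ε) , j , j≢k , b∈A) =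
      trans (#-cong (col outside? B? left-factor? b) (λ g → mem? (A k) (g ∙ b ⁻¹)) (λ _ → proj₂)
          (λ g p → (∈-cancelʳ G (⁻¹∈ G b∈G) (A⊆G p)
                   , (λ g∈A* → b≢ε (A∩A* j≢k b∈A (≡∈ (A* k) (solve (g ∷ b ∷ []) (inv (x₀ ⊙ inv x₁) ⊙ x₀) x₁ refl)
                                       (∙∈ (A* k) (⁻¹∈ (A* k) (A⊆A* k p)) g∈A*))))) , p))
          (trans (#-translateʳ (mem? (A k)) (b ⁻¹)) (∣A∣ k))

    ∣outside∣ : # outside? ≡ s * # B?
    ∣outside∣ = trans (sym (*-identityˡ _)) (double-≡ outside? B? left-factor? 1 s (λ { g (g∈G , g∉A*) → one-b g g∈G g∉A* }) s-many)

    -- Inside `A* k` the elements of `G` are uniquely products from `A k` and `S ∩ G`. Each of the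
    -- others is uniquely `a b` with `a ∈ A k` and `b` in another component.
    ∣G∣≡ : ∣ G ∣ ≡ s * w + s * # B?
    ∣G∣≡ = trans (#-split (mem? G) (mem? (A* k))) (cong₂ _+_ ∣inside∣ ∣outside∣)

  module Whole (k : Fin (suc t)) = Containing full k (λ _ → tt)

  others? : ∀ k → Decidable (λ (j : Fin (suc t)) → ⊤ × j ≢ k)
  others? k j = whole j ×-dec ¬? (j ≟ k)

  ∣others∣ : ∀ k → # (others? k) ≡ t
  ∣others∣ k = suc-injective (trans (sym (#-remove whole {k} tt)) #-whole)

  -- There are `t` other components, meeting only in `ε`, with `s − 1` further elements each; adding
  -- `t` avoids the subtraction.
  ∣B∣ : ∀ k → # (Whole.B? k) + t ≡ t * s
  ∣B∣ k = trans (cong (_+ t) eq) (trans (+-comm _ t) (trans (cong (t +_) (*-comm _ t)) (trans (sym (*-suc t _)) (cong (t *_) (∣A∖ε∣ k)))))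
    where
    open Whole k using (B?)
    R? : ∀ b j → Dec (b ∈ A j)
    R? b j = mem? (A j) b
    s-1 = # (A∖ε? k)
    eq : # B? ≡ s-1 * t
    eq = trans (sym (*-identityˡ _)) (trans (double-≡ B? (others? k) R? 1 s-1
      (λ { b ((_ , b≢ε) , j , j≢k , b∈A) → #-unique (row B? (others? k) R? b) ((tt , j≢k) , b∈A)
              (λ { l (_ , b∈Al) → A∩A b∈Al b∈A b≢ε }) })
      (λ { j (_ , j≢k) → trans (#-cong (col B? (others? k) R? j) (A∖ε? j) (λ { b (((_ , b≢ε) , _) , b∈A) → b∈A , b≢ε })
              (λ { b (b∈A , b≢ε) → ((tt , b≢ε) , j , j≢k , b∈A) , b∈A }))
            (suc-injective (trans (∣A∖ε∣ j) (sym (∣A∖ε∣ k)))) }))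
      (cong (s-1 *_) (∣others∣ k)))

  n≡sst : n ≡ s * (s * t)
  n≡sst = begin
    n                        ≡⟨ sym ∣full∣ ⟩
    ∣ full ∣                 ≡⟨ Whole.∣G∣≡ zero ⟩
    s * w + s * # B?         ≡⟨ cong (λ z → s * z + s * # B?) (trans (#-cong (mem? (S ∩ full)) (mem? S) (λ _ → proj₁) (λ _ p → p , tt)) ∣S∣) ⟩
    s * t + s * # B?         ≡⟨ +-comm (s * t) _ ⟩
    s * # B? + s * t         ≡⟨ sym (*-distribˡ-+ s _ t) ⟩
    s * (# B? + t)           ≡⟨ cong (s *_) (trans (∣B∣ zero) (*-comm t s)) ⟩
    s * (s * t)              ∎
    where
    open ≡-Reasoning
    open Whole zero using (B?; w)

-- Subgroups of index prime to p are the whole group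

module KantorPrime {n s t} {𝔾 : FinGroup n} (𝕂 : Kantor 𝔾 s t) {p} (pr : Prime p)
                   (A-isP : ∀ k → GroupActions.IndexDivisible 𝔾 p (Kantor.A 𝕂 k)) where
  open FinGroupTheory 𝔾
  open GroupActions 𝔾
  open NormalSubgroups 𝔾
  open KantorTheory 𝕂

  ⊆? : ∀ K G → Dec (∀ x → x ∈ K → x ∈ G)
  ⊆? K G = all? (λ x → mem? K x →-dec mem? G x)

  #-by-cosets : ∀ G {P : H → Set} (P? : Decidable P) w → let open Quotient (cosets G) in
                (∀ c → # (λ x → P? x ×-dec (class x ≟ c)) ≡ w) → # P? ≡ w * size
  #-by-cosets G P? w h = trans (#-fibres P? class) (trans (sum-cong-≗ h) (trans (sum-const size w) (*-comm size w)))
    where open Quotient (cosets G)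

  ∣coset∣ : ∀ G c → let open Quotient (cosets G) in # (λ x → whole x ×-dec (class x ≟ c)) ≡ ∣ G ∣
  ∣coset∣ G c = trans (#-cong (λ x → whole x ×-dec (class x ≟ c)) (λ x → mem? G (rep c ⁻¹ ∙ x))
        (λ { x (_ , e) → exact (trans (class-rep c) (sym e)) }) (λ x p → tt , trans (sym (sound p)) (class-rep c)))
      (#-translateˡ (mem? G) (rep c ⁻¹))
    where open Quotient (cosets G)

  n≡∣G∣*index : ∀ G → n ≡ ∣ G ∣ * Quotient.size (cosets G)
  n≡∣G∣*index G = trans (sym (#-whole {n})) (#-by-cosets G whole ∣ G ∣ (∣coset∣ G))

  -- A p-group fixes a point of every set of size prime to p, here a coset of G.
  contains-conjugate : ∀ G → ¬ (p * ∣ G ∣ ∣ n) → ∀ k → ∃ λ u → A k ⊆ conj u G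
  contains-conjugate G p∤ k = from (any? Fixed?)
    where
    open Quotient (cosets G)
    _▷_ : H → Fin size → Fin size
    h ▷ c = class (h ∙ rep c)
    open Action pr (A k) (A-isP k) _▷_
      (λ c → trans (cong class (identityˡ _)) (class-rep c))
      (λ g h c → sound (≡∈ G (solve (g ∷ h ∷ rep c ∷ rep (class (h ∙ rep c)) ∷ [])
        (inv (inv x₃ ⊙ (x₁ ⊙ x₂))) (inv (x₀ ⊙ x₁ ⊙ x₂) ⊙ (x₀ ⊙ x₃)) refl)
        (⁻¹∈ G (exact (class-rep (class (h ∙ rep c)))))))
      using (Fixed; Fixed?; fixed-count)
    from : Dec (∃ Fixed) → ∃ λ u → A k ⊆ conj u G
    from (yes (c , f)) = rep c , λ {a} a∈A → ≡∈ G (solve (rep c ∷ a ∷ []) (inv x₀ ⊙ (x₁ ⊙ x₀)) (inv x₀ ⊙ x₁ ⊙ x₀) refl)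
      (exact (trans (class-rep c) (sym (f a a∈A))))
    from (no ¬f) = contradiction (subst (p * ∣ G ∣ ∣_) (trans (*-comm size ∣ G ∣) (sym (n≡∣G∣*index G)))
        (*-monoˡ-∣ ∣ G ∣ (divides (proj₁ fixed-count) (trans (proj₂ fixed-count)
          (trans (cong (_+ p * proj₁ fixed-count) (#-none Fixed? (λ c f → ¬f (c , f)))) (*-comm p _)))))) p∤

  module Index-prime-to-p (G : Subgroup) (p∤ : ¬ (p * ∣ G ∣ ∣ n)) where

    GS : Subgroup
    GS = record
      { mem = λ h → ∃ λ σ → σ ∈ S × h ∙ σ ⁻¹ ∈ G
      ; mem? = λ h → any? (λ σ → mem? S σ ×-dec mem? G (h ∙ σ ⁻¹))
      ; ε∈ = ε , ε∈ S , ≡∈ G (solve [] one (one ⊙ inv one) refl) (ε∈ G)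
      ; ∙∈ = λ { {x} {y} (σ , σ∈S , p) (τ , τ∈S , q) → (y ∙ τ ⁻¹) ⁻¹ ∙ σ ∙ (y ∙ τ ⁻¹) ∙ τ
             , ∙∈ S (S-normal (y ∙ τ ⁻¹) σ∈S) τ∈S
             , ≡∈ G (solve (x ∷ σ ∷ y ∷ τ ∷ []) (x₀ ⊙ inv x₁ ⊙ (x₂ ⊙ inv x₃)) (x₀ ⊙ x₂ ⊙ inv (inv (x₂ ⊙ inv x₃) ⊙ x₁ ⊙ (x₂ ⊙ inv x₃) ⊙ x₃)) refl) (∙∈ G p q) }
      ; ⁻¹∈ = λ { {x} (σ , σ∈S , p) → x ∙ σ ⁻¹ ∙ x ⁻¹ , conj⁻¹ S S-normal x (⁻¹∈ S σ∈S)
             , ≡∈ G (solve (x ∷ σ ∷ []) (inv (x₀ ⊙ inv x₁)) (inv x₀ ⊙ inv (x₀ ⊙ inv x₁ ⊙ inv x₀)) refl) (⁻¹∈ G p) } }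

    G⊆GS : G ⊆ GS
    G⊆GS {g} p = ε , ε∈ S , ≡∈ G (solve (g ∷ []) x₀ (x₀ ⊙ inv one) refl) p

    S⊆GS : S ⊆ GS
    S⊆GS {σ} p = σ , p , ≡∈ G (sym (inverseʳ σ)) (ε∈ G)

    -- Some conjugate of `GS` contains `A k`, and conjugation changes an element only by a
    -- commutator, which lies in `S ⊆ GS`.
    A⊆GS : ∀ k → A k ⊆ GS
    A⊆GS k {a} a∈A = from (contains-conjugate GS (λ d → p∤ (∣-trans (*-monoʳ-∣ p (lagrange G GS G⊆GS)) d)) k)
      where
      from : (∃ λ u → A k ⊆ conj u GS) → a ∈ GS
      from (u , sub) = ∈-cancelʳ GS (S⊆GS (commutator∈S u a)) (≡∈ GS (conj≡ a u) (sub a∈A))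

    GS-full : ∀ h → h ∈ GS
    GS-full h with others zero
    ... | i , j , _ , _ , i≢j with prod h i≢j
    ...   | a , a∈A , b∈A* with split j b∈A*
    ...     | σ , σ∈S , c∈A = ≡∈ GS (solve (a ∷ h ∷ σ ∷ []) (x₀ ⊙ (inv x₀ ⊙ x₁ ⊙ inv x₂ ⊙ x₂)) x₁ refl)
      (∙∈ GS (A⊆GS i a∈A) (∙∈ GS (A⊆GS j c∈A) (S⊆GS σ∈S)))

    -- Since `H = G S`, the conjugating element can be moved into `S`.
    contains-S-conjugate : ∀ k → ∃ λ σ → σ ∈ S × A k ⊆ conj σ G
    contains-S-conjugate k = from (contains-conjugate G p∤ k)
      where
      shift : ∀ u → A k ⊆ conj u G → u ⁻¹ ∈ GS → ∃ λ σ → σ ∈ S × A k ⊆ conj σ G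
      shift u sub (τ , τ∈S , g) = τ ⁻¹ , ⁻¹∈ S τ∈S , λ {a} a∈A → ≡∈ G
        (solve (u ∷ τ ∷ a ∷ []) (inv (inv x₀ ⊙ inv x₁) ⊙ (inv x₀ ⊙ x₂ ⊙ x₀) ⊙ (inv x₀ ⊙ inv x₁)) (inv (inv x₁) ⊙ x₂ ⊙ inv x₁) refl)
        (∙∈ G (∙∈ G (⁻¹∈ G g) (sub a∈A)) g)
      from : (∃ λ u → A k ⊆ conj u G) → ∃ λ σ → σ ∈ S × A k ⊆ conj σ G
      from (u , sub) = shift u sub (GS-full (u ⁻¹))

    w : ℕ
    w = ∣ S ∩ G ∣

    instance
      w≢0 : NonZero w
      w≢0 = >-nonZero (∣G∣≥1 (S ∩ G))
      s≢0 : NonZero s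
      s≢0 = >-nonZero (≤-trans (s≤s z≤n) 2≤s)

    open Quotient (cosets G)

    -- Since `H = G S`, every coset of `G` meets `S`, and does so in a translate of `S ∩ G`.
    t≡w*index : t ≡ w * size
    t≡w*index = trans (sym ∣S∣) (#-by-cosets G (mem? S) w coset∩S)
      where
      coset∩S : ∀ c → # (λ x → mem? S x ×-dec (class x ≟ c)) ≡ w
      coset∩S c = from (GS-full (rep c ⁻¹))
       where
       from : rep c ⁻¹ ∈ GS → # (λ x → mem? S x ×-dec (class x ≟ c)) ≡ w
       from (σ , σ∈S , g) = trans (#-cong (λ x → mem? S x ×-dec (class x ≟ c)) (λ x → mem? (S ∩ G) (σ ∙ x))
        (λ { x (x∈S , e) → ∙∈ S σ∈S x∈S , ≡∈ G (solve (rep c ∷ σ ∷ x ∷ []) (inv (inv x₀ ⊙ inv x₁) ⊙ (inv x₀ ⊙ x₂)) (x₁ ⊙ x₂) refl)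
               (∙∈ G (⁻¹∈ G g) (exact (trans (class-rep c) (sym e)))) })
        (λ { x (x∈S , e) → ∈-cancelˡ S σ∈S x∈S , trans (sym (sound (≡∈ G (solve (rep c ∷ σ ∷ x ∷ []) (inv x₀ ⊙ inv x₁ ⊙ (x₁ ⊙ x₂)) (inv x₀ ⊙ x₂) refl) (∙∈ G g e)))) (class-rep c) }))
        (#-translateˡ (mem? (S ∩ G)) σ)

    ∣G∣≡ssw : ∣ G ∣ ≡ s * (s * w)
    ∣G∣≡ssw = *-cancelʳ-≡ ∣ G ∣ (s * (s * w)) size {{m*n≢0⇒n≢0 w {{subst NonZero t≡w*index (>-nonZero (≤-trans (s≤s z≤n) 2≤t))}}}} (begin
      ∣ G ∣ * size         ≡⟨ sym (n≡∣G∣*index G) ⟩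
      n                    ≡⟨ n≡sst ⟩
      s * (s * t)          ≡⟨ cong (λ z → s * (s * z)) t≡w*index ⟩
      s * (s * (w * size)) ≡⟨ cong (s *_) (sym (*-assoc s w size)) ⟩
      s * (s * w * size)   ≡⟨ sym (*-assoc s (s * w) size) ⟩
      s * (s * w) * size   ∎)
      where open ≡-Reasoning

    within? : ∀ σ → Decidable (λ k → ∀ x → x ∈ A k → x ∈ conj σ G)
    within? σ k = ⊆? (A k) (conj σ G)

    -- By averaging, some S-conjugate of G contains more than w components.
    rich : ∃ λ σ → σ ∈ S × w < # (within? σ)
    rich = from (any? (λ σ → mem? S σ ×-dec (suc w ≤? # (within? σ))))
      where
      R? : ∀ (k : Fin (suc t)) σ → Dec (∀ x → x ∈ A k → x ∈ conj σ G)
      R? k σ = within? σ k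
      -- If `conj σ G` contains `A k`, then so does `conj τ G` for all `w` elements `τ` of the coset
      -- `σ (S ∩ G)`. With `suc t` components against `t` elements of `S`, some `σ` is used more
      -- than `w` times.
      many : ∀ k → ⊤ → w ≤ # (row whole (mem? S) R? k)
      many k _ = from-conj (contains-S-conjugate k)
       where
       from-conj : (∃ λ σ → σ ∈ S × A k ⊆ conj σ G) → w ≤ # (row whole (mem? S) R? k)
       from-conj (σ , σ∈S , sub) = ≤-trans (≤-reflexive (sym (#-translateˡ (mem? (S ∩ G)) (σ ⁻¹))))
        (#-mono (λ τ → mem? (S ∩ G) (σ ⁻¹ ∙ τ)) (row whole (mem? S) R? k) (λ { τ (p , q) → ∈-cancelˡ S (⁻¹∈ S σ∈S) p ,
          (λ a a∈A → ≡∈ G (solve (σ ∷ τ ∷ a ∷ []) (inv (inv x₀ ⊙ x₁) ⊙ (inv x₀ ⊙ x₂ ⊙ x₀) ⊙ (inv x₀ ⊙ x₁)) (inv x₁ ⊙ x₂ ⊙ x₁) refl)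
                         (∙∈ G (∙∈ G (⁻¹∈ G q) (sub a∈A)) q)) }))
      from : Dec (∃ λ σ → σ ∈ S × w < # (within? σ)) → ∃ λ σ → σ ∈ S × w < # (within? σ)
      from (yes r) = r
      from (no ¬r) = contradiction (*-cancelˡ-≤ w (begin
          w * suc t          ≡⟨ cong (w *_) (sym (#-whole {suc t})) ⟩
          w * # (whole {suc t}) ≤⟨ double-≤ whole (mem? S) R? w w many (λ σ σ∈S → ≤-trans (#-mono (col whole (mem? S) R? σ) (within? σ) (λ _ → proj₂)) (≮⇒≥ (λ lt → ¬r (σ , σ∈S , lt)))) ⟩
          w * ∣ S ∣           ≡⟨ cong (w *_) ∣S∣ ⟩
          w * t              ∎)) (<⇒≱ (n<1+n t))
        where open ≤-Reasoning

    module Rich (σ : H) (σ∈S : σ ∈ S) (w<K : w < # (within? σ)) (x : H) (x∈S : x ∈ S) (x∉G : ¬ x ∈ G) where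

      G′ : Subgroup
      G′ = conj σ G

      K : Fin (suc t) → Set
      K k = ∀ x → x ∈ A k → x ∈ G′

      K? : Decidable K
      K? = within? σ

      k₀ : Fin (suc t)
      k₀ = proj₁ (#-witness K? (≤-trans (s≤s z≤n) w<K))
      k₀∈K : K k₀
      k₀∈K = proj₂ (#-witness K? (≤-trans (s≤s z≤n) w<K))

      open Containing G′ k₀ (k₀∈K _) using (outside?; B?; ∣outside∣; ∣G∣≡)

      ∣S∩G′∣ : ∣ S ∩ G′ ∣ ≡ w
      ∣S∩G′∣ = trans (#-cong (mem? (S ∩ G′)) (mem? (conj σ (S ∩ G)))
          (λ { y (p , q) → S-normal σ p , q })
          (λ { y (p , q) → ≡∈ S (solve (σ ∷ y ∷ []) (x₀ ⊙ (inv x₀ ⊙ x₁ ⊙ x₀) ⊙ inv x₀) x₁ refl) (conj⁻¹ S S-normal σ p) , q }))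
        (∣conj∣ σ (S ∩ G))

      w+B≡sw : w + # B? ≡ s * w
      w+B≡sw = *-cancelˡ-≡ _ _ s (begin
        s * (w + # B?)               ≡⟨ *-distribˡ-+ s w _ ⟩
        s * w + s * # B?             ≡⟨ cong (λ z → s * z + s * # B?) (sym ∣S∩G′∣) ⟩
        s * ∣ S ∩ G′ ∣ + s * # B?    ≡⟨ sym ∣G∣≡ ⟩
        ∣ G′ ∣                       ≡⟨ trans (∣conj∣ σ G) ∣G∣≡ssw ⟩
        s * (s * w)                  ∎)
        where open ≡-Reasoning

      K₁? : Decidable (λ k → K k × k ≢ k₀)
      K₁? k = K? k ×-dec ¬? (k ≟ k₀)

      w≤K₁ : w ≤ # K₁?
      w≤K₁ = s≤s⁻¹ (≤-trans w<K (≤-reflexive (#-remove K? k₀∈K)))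

      InK : H → Set
      InK b = b ≢ ε × ∃ λ k → (K k × k ≢ k₀) × b ∈ A k

      InK? : Decidable InK
      InK? b = ¬? (b ≟ ε) ×-dec any? (λ k → K₁? k ×-dec mem? (A k) b)

      K₁≤InK : # (A∖ε? k₀) * # K₁? ≤ # InK?
      K₁≤InK = ≤-trans (double-≤ K₁? InK? R? (# (A∖ε? k₀)) 1
          (λ k k∈K → ≤-trans (≤-reflexive (suc-injective (trans (∣A∖ε∣ k₀) (sym (∣A∖ε∣ k)))))
             (#-mono (A∖ε? k) (row K₁? InK? R? k) (λ { b (b∈A , b≢ε) → (b≢ε , k , k∈K , b∈A) , b∈A })))
          (λ { b (b≢ε , _) → #-! (col K₁? InK? R? b) (λ { k l (_ , p) (_ , q) → A∩A p q b≢ε }) }))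
        (≤-reflexive (*-identityˡ _))
        where
        R? : ∀ k b → Dec (b ∈ A k)
        R? k b = mem? (A k) b

      -- By `w+B≡sw` the set `B?` has `(s − 1) w` elements. The components inside `G′` other than
      -- `A k₀`, at least `w` in number, already provide that many, so `G′` meets the remaining
      -- components trivially.
      B≤InK : # B? ≤ # InK?
      B≤InK = ≤-trans (+-cancelˡ-≤ w _ _ (≤-reflexive (trans w+B≡sw (cong (_* w) (sym (∣A∖ε∣ k₀))))))
                      (≤-trans (*-monoʳ-≤ (# (A∖ε? k₀)) w≤K₁) K₁≤InK)

      outside-K : ∀ j {b} → ¬ K j → b ∈ A j → b ∈ G′ → b ≡ ε
      outside-K j {b} j∉K b∈A b∈G′ = by-cases (b ≟ ε)
       where
       by-cases : Dec (b ≡ ε) → b ≡ ε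
       by-cases (yes e) = e
       by-cases (no b≢ε) = from (#-full InK? B? (λ { c (c≢ε , k , (k∈K , k≢) , c∈A) → (k∈K c c∈A , c≢ε) , k , k≢ , c∈A }) B≤InK b
                       ((b∈G′ , b≢ε) , j , (λ { refl → j∉K k₀∈K }) , b∈A))
        where
        from : InK b → b ≡ ε
        from (_ , k , (k∈K , _) , b∈Ak) = contradiction (subst K (A∩A b∈Ak b∈A b≢ε) k∈K) j∉K

      -- The orbit of G′ is a subquadrangle of order (s , w) and σ₀ a point outside it; each of its
      -- lines carries one point collinear with σ₀, on distinct lines through σ₀, whence s w ≤ t.
      σ₀ : H
      σ₀ = σ ∙ x ∙ σ ⁻¹
      σ₀∈S : σ₀ ∈ S
      σ₀∈S = conj⁻¹ S S-normal σ x∈S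
      σ₀∉G′ : ¬ σ₀ ∈ G′
      σ₀∉G′ h = x∉G (≡∈ G (solve (σ ∷ x ∷ []) (inv x₀ ⊙ (x₀ ⊙ x₁ ⊙ inv x₀) ⊙ x₀) x₁ refl) h)

      ∁K? : Decidable (λ j → ⊤ × ¬ K j)
      ∁K? j = whole j ×-dec ¬? (K? j)

      w+∁K≤t : w + # ∁K? ≤ t
      w+∁K≤t = s≤s⁻¹ (begin
        suc w + # ∁K?                                ≤⟨ +-monoˡ-≤ (# ∁K?) w<K ⟩
        # K? + # ∁K?                                 ≡⟨ cong (_+ # ∁K?) (#-cong K? (λ j → whole j ×-dec K? j) (λ _ k → tt , k) (λ _ → proj₂)) ⟩
        # (λ j → whole j ×-dec K? j) + # ∁K?           ≡⟨ sym (#-split whole K?) ⟩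
        # (whole {suc t})                              ≡⟨ #-whole ⟩
        suc t                                        ∎)
        where open ≤-Reasoning

      projects-along? : ∀ g j → Dec (∃ λ a → a ∈ A k₀ × a ⁻¹ ∙ (g ⁻¹ ∙ σ₀) ∈ A j)
      projects-along? g j = any? (λ a → mem? (A k₀) a ×-dec mem? (A j) (a ⁻¹ ∙ (g ⁻¹ ∙ σ₀)))

      outside≤ : # outside? ≤ s * # ∁K?
      outside≤ = subst (_≤ s * # ∁K?) (*-identityˡ _) (double-≤ outside? ∁K? projects-along? 1 s each-g each-j)
        where
        each-g : ∀ g → g ∈ G′ × ¬ g ∈ A* k₀ → 1 ≤ # (row outside? ∁K? projects-along? g)
        each-g g (g∈G′ , g∉A*) = from (cover k₀ {g ⁻¹ ∙ σ₀}
            (λ q → g∉A* (≡∈ (A* k₀) (solve (g ∷ σ₀ ∷ []) (x₁ ⊙ inv (inv x₀ ⊙ x₁)) x₀ refl) (∙∈ (A* k₀) (S⊆A* k₀ σ₀∈S) (⁻¹∈ (A* k₀) q)))))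
         where
         from : (∃ λ j → j ≢ k₀ × ∃ λ a → a ∈ A k₀ × a ⁻¹ ∙ (g ⁻¹ ∙ σ₀) ∈ A j) → 1 ≤ # (row outside? ∁K? projects-along? g)
         from (j , j≢k₀ , a , a∈A , b∈A) = #-∃ (row outside? ∁K? projects-along? g) {j}
          ((tt , (λ j∈K → σ₀∉G′ (≡∈ G′ (solve (g ∷ a ∷ σ₀ ∷ []) (x₀ ⊙ x₁ ⊙ (inv x₁ ⊙ (inv x₀ ⊙ x₂))) x₂ refl)
               (∙∈ G′ (∙∈ G′ g∈G′ (k₀∈K a a∈A)) (j∈K _ b∈A)))))
          , a , a∈A , b∈A)
        each-j : ∀ j → ⊤ × ¬ K j → # (col outside? ∁K? projects-along? j) ≤ s
        each-j j (_ , j∉K) = from (any? (col outside? ∁K? projects-along? j))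
          where
          from : Dec (∃ λ g → (g ∈ G′ × ¬ g ∈ A* k₀) × ∃ λ a → a ∈ A k₀ × a ⁻¹ ∙ (g ⁻¹ ∙ σ₀) ∈ A j) → # (col outside? ∁K? projects-along? j) ≤ s
          from (no ¬g) = ≤-trans (≤-reflexive (#-none (col outside? ∁K? projects-along? j) (λ g q → ¬g (g , q)))) z≤n
          from (yes (g , (g∈G′ , _) , a , a∈A , b∈A)) = ≤-trans
            (#-mono (col outside? ∁K? projects-along? j) (λ h → mem? (A k₀) (g ⁻¹ ∙ h))
              (λ { h ((h∈G′ , _) , c , c∈A , d∈A) → same-line h h∈G′ c c∈A d∈A }))
            (≤-reflexive (trans (#-translateˡ (mem? (A k₀)) (g ⁻¹)) (∣A∣ k₀)))
            where
            -- For two such points `g` and `h`, the element `a ⁻¹ ∙ g ⁻¹ ∙ h ∙ c` lies in `G′` and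
            -- in the component `A j` outside `K`. It is therefore trivial, so `g` and `h` are among
            -- the `s` points of one coset of `A k₀`.
            same-line : ∀ h → h ∈ G′ → ∀ c → c ∈ A k₀ → c ⁻¹ ∙ (h ⁻¹ ∙ σ₀) ∈ A j → g ⁻¹ ∙ h ∈ A k₀
            same-line h h∈G′ c c∈A d∈A = ≡∈ (A k₀) (begin
              a ∙ c ⁻¹                      ≡⟨ solve (a ∷ c ∷ []) (x₀ ⊙ inv x₁) (x₀ ⊙ one ⊙ inv x₁) refl ⟩
              a ∙ ε ∙ c ⁻¹                  ≡⟨ cong (λ z → a ∙ z ∙ c ⁻¹) (sym trivial-quotient) ⟩
              a ∙ (a ⁻¹ ∙ g ⁻¹ ∙ h ∙ c) ∙ c ⁻¹ ≡⟨ solve (a ∷ g ∷ h ∷ c ∷ []) (x₀ ⊙ (inv x₀ ⊙ inv x₁ ⊙ x₂ ⊙ x₃) ⊙ inv x₃) (inv x₁ ⊙ x₂) refl ⟩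
              g ⁻¹ ∙ h                      ∎) (∙∈ (A k₀) a∈A (⁻¹∈ (A k₀) c∈A))
              where
              open ≡-Reasoning
              trivial-quotient : a ⁻¹ ∙ g ⁻¹ ∙ h ∙ c ≡ ε
              trivial-quotient = outside-K j j∉K
                (≡∈ (A j) (solve (a ∷ g ∷ h ∷ c ∷ σ₀ ∷ []) (inv x₀ ⊙ (inv x₁ ⊙ x₄) ⊙ inv (inv x₃ ⊙ (inv x₂ ⊙ x₄))) (inv x₀ ⊙ inv x₁ ⊙ x₂ ⊙ x₃) refl)
                  (∙∈ (A j) b∈A (⁻¹∈ (A j) d∈A)))
                (∙∈ G′ (∙∈ G′ (∙∈ G′ (⁻¹∈ G′ (k₀∈K a a∈A)) (⁻¹∈ G′ g∈G′)) h∈G′) (k₀∈K c c∈A))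

      sw≤t : s * w ≤ t
      sw≤t = begin
        s * w      ≡⟨ sym w+B≡sw ⟩
        w + # B?   ≤⟨ +-monoʳ-≤ w (*-cancelˡ-≤ s (≤-trans (≤-reflexive (sym ∣outside∣)) outside≤)) ⟩
        w + # ∁K?  ≤⟨ w+∁K≤t ⟩
        t          ∎
        where open ≤-Reasoning

      p∣s : p ∣ s
      p∣s = from (A-isP k₀ trivial (λ { refl → ε∈ (A k₀) }))
        where
        from : (A k₀ ⊆ trivial) ⊎ p * ∣ trivial ∣ ∣ ∣ A k₀ ∣ → p ∣ s
        from (inj₁ h) = contradiction (proj₁ (proj₂ (nontrivial k₀))) (λ a → proj₂ (proj₂ (nontrivial k₀)) (h a))
        from (inj₂ d) = subst₂ _∣_ (trans (cong (p *_) ∣trivial∣) (*-identityʳ p)) (∣A∣ k₀) d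

      absurd : ⊥
      absurd = p∤ (subst (p * ∣ G ∣ ∣_) (trans (*-comm size ∣ G ∣) (sym (n≡∣G∣*index G))) (*-monoˡ-∣ ∣ G ∣ p∣index))
        where
        w≡1 : w ≡ 1
        w≡1 = ≤-antisym (*-cancelˡ-≤ s (≤-trans sw≤t (≤-trans t≤s (≤-reflexive (sym (*-identityʳ s)))))) (∣G∣≥1 (S ∩ G))
        s≡index : s ≡ size
        s≡index = trans (≤-antisym (≤-trans (≤-reflexive (trans (sym (*-identityʳ s)) (cong (s *_) (sym w≡1)))) sw≤t) t≤s)
                        (trans t≡w*index (trans (cong (_* size) w≡1) (*-identityˡ size)))
        p∣index : p ∣ size
        p∣index = subst (p ∣_) s≡index p∣s

    everything : full ⊆ G
    everything {h} _ = from (⊆-dec S G)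
      where
      from : (S ⊆ G) ⊎ (∃ λ x → x ∈ S × ¬ x ∈ G) → h ∈ G
      from (inj₁ S⊆G) = back (GS-full h)
        where
        back : h ∈ GS → h ∈ G
        back (σ , σ∈S , g) = ∈-cancelʳ G (⁻¹∈ G (S⊆G σ∈S)) g
      from (inj₂ (x , x∈S , x∉G)) = ⊥-elim (Rich.absurd (proj₁ rich) (proj₁ (proj₂ rich)) (proj₂ (proj₂ rich)) x x∈S x∉G)

  index-divisible : IndexDivisible p full
  index-divisible G _ = from (p * ∣ G ∣ ∣? n)
    where
    from : Dec (p * ∣ G ∣ ∣ n) → (full ⊆ G) ⊎ p * ∣ G ∣ ∣ ∣ full ∣
    from (yes d) = inj₂ (subst (p * ∣ G ∣ ∣_) (sym ∣full∣) d)
    from (no ¬d) = inj₁ (Index-prime-to-p.everything G ¬d)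

-- Restriction to the p-torsion part: s is a prime power

record Enumeration {n} (P : Fin n → Set) (k : ℕ) : Set where
  field
    elem     : Fin k → Fin n
    elem∈    : ∀ i → P (elem i)
    injective : ∀ {i j} → elem i ≡ elem j → i ≡ j
    index    : ∀ {x} → P x → Fin k
    elem-index : ∀ {x} (p : P x) → elem (index p) ≡ x

module _ where
  open Enumeration
  private
    unsuc : ∀ {k} {x y : Fin k} → Fin.suc x ≡ suc y → x ≡ y
    unsuc refl = refl

  enumerate : ∀ {n} {P : Fin n → Set} (P? : Decidable P) → Enumeration P (# P?)
  enumerate {zero} P? = record { elem = λ () ; elem∈ = λ () ; injective = λ { {()} } ; index = λ { {()} } ; elem-index = λ { {()} } }
  enumerate {suc n} {P} P? with P? zero | enumerate (P? ∘ suc)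
  ... | no ¬p | r = record
    { elem = suc ∘ elem r ; elem∈ = elem∈ r ; injective = injective r ∘ unsuc
    ; index = λ { {zero} p → contradiction p ¬p ; {suc x} p → index r p }
    ; elem-index = λ { {zero} p → contradiction p ¬p ; {suc x} p → cong suc (elem-index r p) } }
  ... | yes p₀ | r = record
    { elem = λ { zero → zero ; (suc i) → suc (elem r i) }
    ; elem∈ = λ { zero → p₀ ; (suc i) → elem∈ r i }
    ; injective = λ { {zero} {zero} _ → refl ; {suc i} {suc j} e → cong suc (injective r (unsuc e)) }
    ; index = λ { {zero} p → zero ; {suc x} p → suc (index r p) }
    ; elem-index = λ { {zero} p → refl ; {suc x} p → cong suc (elem-index r p) } }

module Restriction {n} (𝔾 : FinGroup n) (X : FinGroupTheory.Subgroup 𝔾) where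
  open FinGroupTheory 𝔾
  open Enumeration (enumerate (mem? X)) public

  m : ℕ
  m = ∣ X ∣

  _×ₓ_ : Fin m → Fin m → Fin m
  i ×ₓ j = index (∙∈ X (elem∈ i) (elem∈ j))

  1ₓ : Fin m
  1ₓ = index (ε∈ X)

  invₓ : Fin m → Fin m
  invₓ i = index (⁻¹∈ X (elem∈ i))

  elem-∙ : ∀ i j → elem (i ×ₓ j) ≡ elem i ∙ elem j
  elem-∙ i j = elem-index _

  elem-ε : elem 1ₓ ≡ ε
  elem-ε = elem-index _

  elem-⁻¹ : ∀ i → elem (invₓ i) ≡ elem i ⁻¹
  elem-⁻¹ i = elem-index _

  restricted : FinGroup m
  restricted = record
    { _·_ = _×ₓ_ ; 1# = 1ₓ ; _⁻ = invₓ
    ; isGroup = record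
      { isMonoid = record
        { isSemigroup = record
          { isMagma = record { isEquivalence = isEquivalence ; ∙-cong = cong₂ _×ₓ_ }
          ; assoc = λ i j k → injective (begin
              elem ((i ×ₓ j) ×ₓ k)        ≡⟨ trans (elem-∙ _ k) (cong (_∙ elem k) (elem-∙ i j)) ⟩
              elem i ∙ elem j ∙ elem k    ≡⟨ assoc _ _ _ ⟩
              elem i ∙ (elem j ∙ elem k)  ≡⟨ sym (trans (elem-∙ i _) (cong (elem i ∙_) (elem-∙ j k))) ⟩
              elem (i ×ₓ (j ×ₓ k))        ∎) }
        ; identity = (λ i → injective (trans (elem-∙ _ i) (trans (cong (_∙ elem i) elem-ε) (identityˡ _))))
                   , (λ i → injective (trans (elem-∙ i _) (trans (cong (elem i ∙_) elem-ε) (identityʳ _)))) }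
      ; inverse = (λ i → injective (trans (elem-∙ _ i) (trans (cong (_∙ elem i) (elem-⁻¹ i)) (trans (inverseˡ _) (sym elem-ε)))))
                , (λ i → injective (trans (elem-∙ i _) (trans (cong (elem i ∙_) (elem-⁻¹ i)) (trans (inverseʳ _) (sym elem-ε)))))
      ; ⁻¹-cong = cong invₓ } }
    where open ≡-Reasoning

  module R = FinGroupTheory restricted

  pull : Subgroup → R.Subgroup
  pull G = record
    { mem = λ i → elem i ∈ G ; mem? = λ i → mem? G (elem i)
    ; ε∈ = ≡∈ G (sym elem-ε) (ε∈ G)
    ; ∙∈ = λ {i} {j} p q → ≡∈ G (sym (elem-∙ i j)) (∙∈ G p q)
    ; ⁻¹∈ = λ {i} p → ≡∈ G (sym (elem-⁻¹ i)) (⁻¹∈ G p) }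

  ∣pull∣ : ∀ G → R.∣ pull G ∣ ≡ ∣ X ∩ G ∣
  ∣pull∣ G = trans (sym (*-identityˡ _)) (trans (double-≡ (R.mem? (pull G)) (mem? (X ∩ G)) R? 1 1
      (λ i p → #-unique (row (R.mem? (pull G)) (mem? (X ∩ G)) R? i) ((elem∈ i , p) , refl) (λ x → sym ∘ proj₂))
      (λ { x (x∈X , p) → #-unique (col (R.mem? (pull G)) (mem? (X ∩ G)) R? x) {index x∈X}
             (≡∈ G (sym (elem-index x∈X)) p , elem-index x∈X) (λ { i (_ , e) → injective (trans e (sym (elem-index x∈X))) }) }))
    (*-identityˡ _))
    where
    R? : ∀ i x → Dec (elem i ≡ x)
    R? i x = elem i ≟ x

  elem-pow : ∀ i k → elem (R.pow i k) ≡ pow (elem i) k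
  elem-pow i zero    = elem-ε
  elem-pow i (suc k) = trans (elem-∙ i _) (cong (elem i ∙_) (elem-pow i k))

  elem-⟨⟩ : ∀ i j → elem R.⟨ i , j ⟩ ≡ ⟨ elem i , elem j ⟩
  elem-⟨⟩ i j = trans (elem-∙ _ _) (cong₂ _∙_ (trans (elem-⁻¹ _) (cong _⁻¹ (elem-∙ i j))) (elem-∙ j i))

module PrimeComponent {n s t} {𝔾 : FinGroup n} (𝕂 : Kantor 𝔾 s t) {p} (pr : Prime p) (p∣s : p ∣ s) where
  open FinGroupTheory 𝔾
  open GroupActions 𝔾
  open NormalSubgroups 𝔾
  open KantorTheory 𝕂
  open Modulo S S-normal using (Comm-∙; _≈_; ≈-refl; ≈-sym; ≈-trans; ≈-congˡ; ≈-congʳ)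

  -- Written as a power of `p` to match the exponent required by `exponent⇒IndexDivisible`.
  e : ℕ
  e = p ^ 1

  pow-mod-S : ∀ x y k → pow x k ∙ pow y k ≈ pow (x ∙ y) k
  pow-mod-S x y zero    = ≡∈ S (solve [] one (inv (one ⊙ one) ⊙ one) refl) (ε∈ S)
  pow-mod-S x y (suc k) = ≈-trans {x ∙ X ∙ (y ∙ Y)} {x ∙ y ∙ (X ∙ Y)} (≡∈ S
      (solve (x ∷ X ∷ y ∷ Y ∷ []) (inv x₃ ⊙ (inv (x₁ ⊙ x₂) ⊙ (x₂ ⊙ x₁)) ⊙ x₃) (inv (x₀ ⊙ x₁ ⊙ (x₂ ⊙ x₃)) ⊙ (x₀ ⊙ x₂ ⊙ (x₁ ⊙ x₃))) refl)
      (S-normal Y (commutator∈S X y)))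
    (≈-congˡ {x ∙ y} {X ∙ Y} (pow-mod-S x y k))
    where X = pow x k
          Y = pow y k

  pow-∙∈ : ∀ {x y} → pow x e ∙ pow y e ∈ S → pow (x ∙ y) e ∈ S
  pow-∙∈ {x} {y} h = ∈-cancelˡ S (⁻¹∈ S h) (pow-mod-S x y e)

  -- The preimage of the elements of exponent `p` of the abelian group `H / S`. It keeps all of `S`
  -- but only the `p`-torsion of each component.
  X : Subgroup
  X = record
    { mem = λ h → pow h e ∈ S ; mem? = λ h → mem? S (pow h e) ; ε∈ = ≡∈ S (sym (pow-ε e)) (ε∈ S)
    ; ∙∈ = λ p q → pow-∙∈ (∙∈ S p q)
    ; ⁻¹∈ = λ {x} p → ∈-cancelˡ S p (∈-cancelʳ S {_} {(pow x e ∙ pow (x ⁻¹) e) ⁻¹ ∙ pow (x ∙ x ⁻¹) e} (pow-mod-S x (x ⁻¹) e)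
         (≡∈ S (trans (sym (pow-ε e)) (trans (cong (λ z → pow z e) (sym (inverseʳ x)))
            (solve (pow x e ∙ pow (x ⁻¹) e ∷ pow (x ∙ x ⁻¹) e ∷ []) x₁ (x₀ ⊙ (inv x₀ ⊙ x₁)) refl))) (ε∈ S))) }

  S⊆X : S ⊆ X
  S⊆X = pow-∈ S e

  torsion : ∀ {k a} → a ∈ A k → a ∈ X → pow a e ≡ ε
  torsion {k} a∈A h = A∩S (pow-∈ (A k) e a∈A) h

  torsion⇒X : ∀ {a} → pow a e ≡ ε → a ∈ X
  torsion⇒X h = ≡∈ S (sym h) (ε∈ S)

  -- Modulo `S` taking powers is multiplicative, so the powers of the two factors have product in
  -- `S`; then `pow a e` lies in both `A i` and `A* j`.
  factor∈X : ∀ {i j a h} → i ≢ j → a ∈ A i → a ⁻¹ ∙ h ∈ A* j → h ∈ X → a ∈ X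
  factor∈X {i} {j} {a} {h} i≢j a∈A b∈A* h∈X = torsion⇒X (A∩A* i≢j (pow-∈ (A i) e a∈A)
    (∈-cancelʳ (A* j) (pow-∈ (A* j) e b∈A*) (S⊆A* j product∈S)))
    where
    product∈S : pow a e ∙ pow (a ⁻¹ ∙ h) e ∈ S
    product∈S = ∈-cancelʳ S {_} {(pow a e ∙ pow (a ⁻¹ ∙ h) e) ⁻¹ ∙ pow (a ∙ (a ⁻¹ ∙ h)) e} (pow-mod-S a (a ⁻¹ ∙ h) e)
      (≡∈ S (trans (cong (λ z → pow z e) (solve (a ∷ h ∷ []) x₁ (x₀ ⊙ (inv x₀ ⊙ x₁)) refl))
         (solve (pow a e ∙ pow (a ⁻¹ ∙ h) e ∷ pow (a ∙ (a ⁻¹ ∙ h)) e ∷ []) x₁ (x₀ ⊙ (inv x₀ ⊙ x₁)) refl)) h∈X)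

  third : ∀ (i j : Fin (suc t)) → ∃ λ l → l ≢ i × l ≢ j
  third i j = from (others i)
    where
    from : (∃ λ a → ∃ λ b → a ≢ i × b ≢ i × a ≢ b) → ∃ λ l → l ≢ i × l ≢ j
    from (a , b , a≢i , b≢i , a≢b) with a ≟ j
    ... | no a≢j = a , a≢i , a≢j
    ... | yes refl = b , b≢i , λ e → a≢b (sym e)

  -- A third component `A l` matches `a ∈ A i` with the `b ∈ A j` for which `a b ∈ A* l`, and
  -- torsion passes from `a` to `b`.
  ∣X∩A∣≤ : ∀ i j → i ≢ j → ∣ X ∩ A i ∣ ≤ ∣ X ∩ A j ∣
  ∣X∩A∣≤ i j i≢j = from (third i j)
    where
    from : (∃ λ l → l ≢ i × l ≢ j) → ∣ X ∩ A i ∣ ≤ ∣ X ∩ A j ∣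
    from (l , l≢i , l≢j) = subst₂ _≤_ (*-identityˡ _) (*-identityˡ _) (double-≤ (mem? (X ∩ A i)) (mem? (X ∩ A j)) R? 1 1
        (λ { a (a∈X , a∈A) → partner a a∈X a∈A (prod (a ⁻¹) (λ e → l≢j (sym e))) })
        (λ b _ → #-! (col (mem? (X ∩ A i)) (mem? (X ∩ A j)) R? b) (λ { a c ((_ , a∈A) , p) ((_ , c∈A) , q) → same a c b a∈A c∈A p q })))
      where
      R? : ∀ a b → Dec (a ∙ b ∈ A* l)
      R? a b = mem? (A* l) (a ∙ b)
      partner : ∀ a → a ∈ X → a ∈ A i → (∃ λ b → b ∈ A j × b ⁻¹ ∙ a ⁻¹ ∈ A* l) → 1 ≤ # (row (mem? (X ∩ A i)) (mem? (X ∩ A j)) R? a)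
      partner a a∈X a∈A (b , b∈A , q) = #-∃ (row (mem? (X ∩ A i)) (mem? (X ∩ A j)) R? a) {b}
        ((factor∈X (λ e → l≢j (sym e)) b∈A q (⁻¹∈ X a∈X) , b∈A)
        , ≡∈ (A* l) (solve (a ∷ b ∷ []) (inv (inv x₁ ⊙ inv x₀)) (x₀ ⊙ x₁) refl) (⁻¹∈ (A* l) q))
      same : ∀ a c b → a ∈ A i → c ∈ A i → a ∙ b ∈ A* l → c ∙ b ∈ A* l → a ≡ c
      same a c b a∈A c∈A p q = trans (solve (a ∷ c ∷ []) x₀ (x₀ ⊙ inv x₁ ⊙ x₁) refl) (trans (cong (_∙ c)
        (A∩A* (λ e → l≢i (sym e)) (∙∈ (A i) a∈A (⁻¹∈ (A i) c∈A))
          (≡∈ (A* l) (solve (a ∷ c ∷ b ∷ []) (x₀ ⊙ x₂ ⊙ inv (x₁ ⊙ x₂)) (x₀ ⊙ inv x₁) refl) (∙∈ (A* l) p (⁻¹∈ (A* l) q)))))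
        (identityˡ c))

  s′ : ℕ
  s′ = ∣ X ∩ A zero ∣

  ∣X∩A∣ : ∀ k → ∣ X ∩ A k ∣ ≡ s′
  ∣X∩A∣ k with k ≟ zero
  ... | yes refl = refl
  ... | no ne = ≤-antisym (∣X∩A∣≤ k zero ne) (∣X∩A∣≤ zero k (λ e → ne (sym e)))

  2≤s′ : 2 ≤ s′
  2≤s′ = from (cauchy pr s trivial (A zero) (≤-trans (≤-reflexive (∣A∣ zero)) (m≤n+m s _)) (λ { refl → ε∈ (A zero) })
           (A-abelian zero) (subst₂ _∣_ (sym (trans (cong (p *_) ∣trivial∣) (*-identityʳ p))) (sym (∣A∣ zero)) p∣s))
    where
    from : (∃ λ z → z ∈ A zero × z ≢ ε × pow z p ≡ ε) → 2 ≤ s′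
    from (z , z∈A , z≢ε , zp) = ≤-trans (s≤s (#-∃ (λ x → mem? (X ∩ A zero) x ×-dec ¬? (x ≟ ε)) {z}
        ((torsion⇒X (trans (cong (pow z) (*-comm p (p ^ 0))) (trans (sym (pow-* z p (p ^ 0))) (trans (cong (λ y → pow y (p ^ 0)) zp) (pow-ε (p ^ 0))))) , z∈A) , z≢ε)))
      (≤-reflexive (sym (#-remove (mem? (X ∩ A zero)) (ε∈ (X ∩ A zero)))))

  open Restriction 𝔾 X

  elem-conj : ∀ h x → elem ((invₓ h ×ₓ x) ×ₓ h) ≡ elem h ⁻¹ ∙ elem x ∙ elem h
  elem-conj h x = trans (elem-∙ _ h) (cong (_∙ elem h) (trans (elem-∙ _ x) (cong (_∙ elem x) (elem-⁻¹ h))))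

  elem-⁻¹∙ : ∀ h x → elem (invₓ h ×ₓ x) ≡ elem h ⁻¹ ∙ elem x
  elem-⁻¹∙ h x = trans (elem-∙ _ x) (cong (_∙ elem x) (elem-⁻¹ h))

  -- The axioms restrict to `X` because factorisations of its elements stay in it, by `factor∈X`.
  -- The parameter `t` is unchanged as `S ⊆ X`.
  component : Kantor restricted s′ t
  component = record
    { A = λ k → pull (A k) ; A* = λ k → pull (A* k) ; S = pull S
    ; S-normal = λ h {x} q → ≡∈ S (sym (elem-conj h x)) (S-normal (elem h) q)
    ; A*-normal = λ k h {x} q → ≡∈ (A* k) (sym (elem-conj h x)) (A*-normal k (elem h) q)
    ; A⊆A* = λ k → A⊆A* k ; S⊆A* = λ k → S⊆A* k
    ; split = λ k {h} h∈A* → split′ k h (split k h∈A*)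
    ; A∩A* = λ i≢j p q → injective (trans (A∩A* i≢j p q) (sym elem-ε))
    ; cover = λ k {h} h∉A* → cover′ k h (cover k h∉A*)
    ; uniq = λ {k} {j} {l} {a} {b} {c} j≢k l≢k p q r eq → injective (trans (uniq j≢k l≢k p q r (trans (cong elem eq) (elem-∙ a c))) (sym elem-ε))
    ; prod = λ {i} {j} h i≢j → prod′ i j h i≢j (prod (elem h) i≢j)
    ; ∣A∣ = λ k → trans (∣pull∣ (A k)) (∣X∩A∣ k)
    ; ∣S∣ = trans (∣pull∣ S) (trans (#-cong (mem? (X ∩ S)) (mem? S) (λ _ → proj₂) (λ _ q → S⊆X q , q)) ∣S∣)
    ; 2≤s = 2≤s′ ; 2≤t = 2≤t }
    where
    split′ : ∀ k h → (∃ λ σ → σ ∈ S × elem h ∙ σ ⁻¹ ∈ A k) → ∃ λ σ → elem σ ∈ S × elem (h ×ₓ invₓ σ) ∈ A k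
    split′ k h (σ , σ∈S , q) = i , ≡∈ S (sym (elem-index _)) σ∈S ,
      ≡∈ (A k) (sym (trans (elem-∙ h _) (cong (elem h ∙_) (trans (elem-⁻¹ i) (cong _⁻¹ (elem-index _)))))) q
      where i = index (S⊆X σ∈S)
    cover′ : ∀ k h → (∃ λ j → j ≢ k × ∃ λ a → a ∈ A k × a ⁻¹ ∙ elem h ∈ A j) →
             ∃ λ j → j ≢ k × ∃ λ a → elem a ∈ A k × elem (invₓ a ×ₓ h) ∈ A j
    cover′ k h (j , j≢k , a , a∈A , q) = j , j≢k , i , ≡∈ (A k) (sym (elem-index a∈X)) a∈A ,
      ≡∈ (A j) (sym (trans (elem-⁻¹∙ i h) (cong (λ z → z ⁻¹ ∙ elem h) (elem-index a∈X)))) q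
      where
      a∈X = factor∈X (λ e → j≢k (sym e)) a∈A (A⊆A* j q) (elem∈ h)
      i = index a∈X
    prod′ : ∀ i j h → i ≢ j → (∃ λ a → a ∈ A i × a ⁻¹ ∙ elem h ∈ A* j) → ∃ λ a → elem a ∈ A i × elem (invₓ a ×ₓ h) ∈ A* j
    prod′ i j h i≢j (a , a∈A , q) = i′ , ≡∈ (A i) (sym (elem-index a∈X)) a∈A ,
      ≡∈ (A* j) (sym (trans (elem-⁻¹∙ i′ h) (cong (λ z → z ⁻¹ ∙ elem h) (elem-index a∈X)))) q
      where
      a∈X = factor∈X i≢j a∈A q (elem∈ h)
      i′ = index a∈X

  component-isP : ∀ k → GroupActions.IndexDivisible restricted p (pull (A k))
  component-isP k = GroupActions.exponent⇒IndexDivisible restricted pr 1 (pull (A k))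
    (λ {x} {y} q r → injective (trans (elem-⟨⟩ x y) (trans (A-abelian k q r) (sym elem-ε))))
    (λ {x} q → injective (trans (elem-pow x e) (trans (torsion q (elem∈ x)) (sym elem-ε))))

  -- The components of this family have exponent `p`, so its group, of order `s′ * (s′ * t)`, is a
  -- p-group. As `t ≥ 2` has only one such prime, `s` cannot have two prime divisors.
  t∣p-power : ∃ λ j → t ∣ p ^ j
  t∣p-power = exponent , subst (t ∣_) n≡p^ (subst (t ∣_) (sym (KantorTheory.n≡sst component)) (∣n⇒∣m*n s′ (n∣m*n s′)))
    where open NormalSubgroups.Nilpotent (NormalSubgroups.nilpotent restricted pr (KantorPrime.index-divisible component pr component-isP))

prime∣prime-power : ∀ {p q} → Prime p → Prime q → ∀ j → p ∣ q ^ j → p ≡ q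
prime∣prime-power {p} {q} pr qr j d with ∣prime-power qr j d
... | inj₁ refl = contradiction (prime≥2 pr) λ { (s≤s ()) }
... | inj₂ q∣p with prime⇒irreducible pr q∣p
...   | inj₁ refl = contradiction (prime≥2 qr) λ { (s≤s ()) }
...   | inj₂ q≡p = sym q≡p

same-prime : ∀ {t p q} → 2 ≤ t → Prime p → Prime q → (∃ λ j → t ∣ p ^ j) → (∃ λ j → t ∣ q ^ j) → p ≡ q
same-prime 2≤t pr qr (i , d) (j , d′) with ∣prime-power pr i d
... | inj₁ refl = contradiction 2≤t λ { (s≤s ()) }
... | inj₂ p∣t = prime∣prime-power pr qr j (∣-trans p∣t d′)

prime-divisor : ∀ {s} → 2 ≤ s → ∃ λ p → Prime p × p ∣ s
prime-divisor {s} 2≤s = from (factorise s {{>-nonZero (≤-trans (s≤s z≤n) 2≤s)}})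
  where
  from : PrimeFactorisation s → ∃ λ p → Prime p × p ∣ s
  from record { factors = [] ; isFactorisation = eq } = contradiction (subst (2 ≤_) eq 2≤s) λ { (s≤s ()) }
  from record { factors = p ∷ ps ; isFactorisation = eq ; factorsPrime = pr ∷ _ } = p , pr , subst (p ∣_) (sym eq) (m∣m*n (product ps))

only-prime⇒power : ∀ {s p} → 2 ≤ s → (∀ q → Prime q → q ∣ s → q ≡ p) → ∃ λ f → s ≡ p ^ f
only-prime⇒power {s} {p} 2≤s only = from (factorise s {{>-nonZero (≤-trans (s≤s z≤n) 2≤s)}})
  where
  power : ∀ ps → All Prime ps → (∀ q → Prime q → q ∣ product ps → q ≡ p) → ∃ λ f → product ps ≡ p ^ f
  power [] _ _ = 0 , refl
  power (q ∷ ps) (qr ∷ prs) h with power ps prs (λ r rr d → h r rr (∣n⇒∣m*n q d))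
  ... | f , eq = suc f , cong₂ _*_ (h q qr (m∣m*n (product ps))) eq
  from : PrimeFactorisation s → ∃ λ f → s ≡ p ^ f
  from record { factors = ps ; isFactorisation = eq ; factorsPrime = prs } =
    subst (λ s → ∃ λ f → s ≡ p ^ f) (sym eq) (power ps prs (λ q qr d → only q qr (subst (q ∣_) (sym eq) d)))

record PrimePower {n s t} {𝔾 : FinGroup n} (𝕂 : Kantor 𝔾 s t) : Set₁ where
  field
    p         : ℕ
    prime     : Prime p
    s-power   : ∃ λ f → s ≡ p ^ f
    nilpotent : NormalSubgroups.Nilpotent 𝔾 p

prime-power : ∀ {n s t} {𝔾 : FinGroup n} (𝕂 : Kantor 𝔾 s t) → PrimePower 𝕂
prime-power {n} {s} {t} {𝔾} 𝕂 = from (prime-divisor (Kantor.2≤s 𝕂))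
  where
  open KantorTheory 𝕂
  open FinGroupTheory 𝔾 using (pow-∣G∣; pow)
  from : (∃ λ p → Prime p × p ∣ s) → PrimePower 𝕂
  from (p , pr , p∣s) = record { p = p ; prime = pr ; s-power = power ; nilpotent = NormalSubgroups.nilpotent 𝔾 pr
      (KantorPrime.index-divisible 𝕂 pr (λ k → GroupActions.exponent⇒IndexDivisible 𝔾 pr (proj₁ power) (A k) (A-abelian k)
        (λ {a} a∈A → trans (cong (pow a) (sym (trans (∣A∣ k) (proj₂ power)))) (pow-∣G∣ (A k) a∈A)))) }
    where
    power : ∃ λ f → s ≡ p ^ f
    power = only-prime⇒power 2≤s (λ q qr q∣s → sym (same-prime 2≤t pr qr (PrimeComponent.t∣p-power 𝕂 pr p∣s) (PrimeComponent.t∣p-power 𝕂 qr q∣s)))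

-- Commutators fill the symmetry group: odd t

module CommutatorImage {n s t} {𝔾 : FinGroup n} (𝕂 : Kantor 𝔾 s t) where
  open FinGroupTheory 𝔾
  open GroupActions 𝔾
  open NormalSubgroups 𝔾
  open KantorTheory 𝕂

  -- The fields `[S]` and `[a]` say that both `S` and `a` become central modulo `N`.
  record Hyp (i : Fin (suc t)) (a : H) (N : Subgroup) : Set where
    field
      a∈A : a ∈ A i
      a≢ε : a ≢ ε
      N⊆S : N ⊆ S
      [S] : ∀ h {σ} → σ ∈ S → ⟨ h , σ ⟩ ∈ N
      [a] : ∀ h → ⟨ a , h ⟩ ∈ N

    N-normal : Normal N
    N-normal = ⟨⟩-normal N (λ h p → [S] h (N⊆S p))

    a∉S : ¬ a ∈ S
    a∉S p = a≢ε (A∩S a∈A p)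

  -- For c ∈ S ∖ N the relation  b b′ ∈ a c N  on the nontrivial elements of the components
  -- other than A i is symmetric and irreflexive, and it has t ∣N∣ pairs.
  module Odd {i a N} (hyp : Hyp i a N) {c} (c∈S : c ∈ S) (c∉N : ¬ c ∈ N) where
    open Hyp hyp
    open Modulo N N-normal using (centre; M⊆centre)

    -- The coset `a c N`. Its elements are central modulo `N`, and this makes the relation
    -- `Z (b ∙ d)` symmetric in `b` and `d`.
    Z : H → Set
    Z z = (a ∙ c) ⁻¹ ∙ z ∈ N

    Z? : Decidable Z
    Z? z = mem? N ((a ∙ c) ⁻¹ ∙ z)

    Z-central : ∀ {z} → Z z → z ∈ centre
    Z-central {z} q = ≡∈ centre (solve (a ∷ c ∷ z ∷ []) (x₀ ⊙ x₁ ⊙ (inv (x₀ ⊙ x₁) ⊙ x₂)) x₂ refl)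
      (∙∈ centre (∙∈ centre [a] (λ h → ⟨⟩-sym N ([S] h c∈S))) (M⊆centre q))

    Z⇒a⁻¹z∈S : ∀ {z} → Z z → a ⁻¹ ∙ z ∈ S
    Z⇒a⁻¹z∈S {z} q = ≡∈ S (solve (a ∷ c ∷ z ∷ []) (x₁ ⊙ (inv (x₀ ⊙ x₁) ⊙ x₂)) (inv x₀ ⊙ x₂) refl) (∙∈ S c∈S (N⊆S q))

    Z⇒A* : ∀ {z} → Z z → z ∈ A* i
    Z⇒A* {z} q = ≡∈ (A* i) (solve (a ∷ z ∷ []) (x₀ ⊙ (inv x₀ ⊙ x₁)) x₁ refl) (∙∈ (A* i) (A⊆A* i a∈A) (S⊆A* i (Z⇒a⁻¹z∈S q)))

    Z∌ε : ∀ {z} → Z z → z ≢ ε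
    Z∌ε q refl = a∉S (≡∈ S (solve (a ∷ []) (inv (inv x₀ ⊙ one)) x₀ refl) (⁻¹∈ S (Z⇒a⁻¹z∈S q)))

    Z∉A* : ∀ {k z} → k ≢ i → Z z → ¬ z ∈ A* k
    Z∉A* {k} {z} k≢i q p = a≢ε (A∩A* (λ e → k≢i (sym e)) a∈A (≡∈ (A* k) (solve (a ∷ z ∷ []) (x₁ ⊙ inv (inv x₀ ⊙ x₁)) x₀ refl)
      (∙∈ (A* k) p (⁻¹∈ (A* k) (S⊆A* k (Z⇒a⁻¹z∈S q))))))

    D : H → Set
    D b = b ≢ ε × ∃ λ k → k ≢ i × b ∈ A k

    D? : Decidable D
    D? b = ¬? (b ≟ ε) ×-dec any? (λ k → ¬? (k ≟ i) ×-dec mem? (A k) b)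

    ∣Z∣ : # Z? ≡ ∣ N ∣
    ∣Z∣ = #-translateˡ (mem? N) ((a ∙ c) ⁻¹)

    Z∙? : ∀ b d → Dec (Z (b ∙ d))
    Z∙? b d = Z? (b ∙ d)

    f : H → H → ℕ
    f b d = ind (D? b) * ind (row D? D? Z∙? b d)

    Z-swap : ∀ b d → Z (b ∙ d) → Z (d ∙ b)
    Z-swap b d q = ≡∈ N (solve (a ∙ c ∷ b ∷ d ∷ []) (inv x₀ ⊙ (x₁ ⊙ x₂) ⊙ (inv (x₁ ⊙ (x₁ ⊙ x₂)) ⊙ (x₁ ⊙ x₂ ⊙ x₁))) (inv x₀ ⊙ (x₂ ⊙ x₁)) refl)
      (∙∈ N q (⟨⟩-sym N (Z-central q b)))

    f-sym : ∀ b d → f b d ≡ f d b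
    f-sym b d = begin
      ind (D? b) * ind (row D? D? Z∙? b d)             ≡⟨ sym (ind-× (D? b) (row D? D? Z∙? b d)) ⟩
      ind (D? b ×-dec row D? D? Z∙? b d)               ≡⟨ ind-cong (D? b ×-dec row D? D? Z∙? b d) (D? d ×-dec row D? D? Z∙? d b)
                                                             (λ { (p , q , r) → q , p , Z-swap b d r }) (λ { (p , q , r) → q , p , Z-swap d b r }) ⟩
      ind (D? d ×-dec row D? D? Z∙? d b)               ≡⟨ ind-× (D? d) (row D? D? Z∙? d b) ⟩
      ind (D? d) * ind (row D? D? Z∙? d b)             ∎
      where open ≡-Reasoning

    f-irrefl : ∀ b → f b b ≡ 0
    f-irrefl b = trans (sym (ind-× (D? b) (row D? D? Z∙? b b))) (ind-no (D? b ×-dec row D? D? Z∙? b b)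
      (λ { ((_ , k , k≢i , b∈A) , _ , q) → Z∌ε q (A∩A* k≢i (∙∈ (A k) b∈A b∈A) (Z⇒A* q)) }))

    D⁻¹? : ∀ b z → Dec (D (b ⁻¹ ∙ z))
    D⁻¹? b z = D? (b ⁻¹ ∙ z)

    -- `cover` and `uniq` factor `z` through `A k` in exactly one way. The other factor is not in
    -- `A i`: that would force `b = ε` and `z = a`, against `c ∉ N`.
    one-b : ∀ k → k ≢ i → ∀ z → Z z → # (col (A∖ε? k) Z? D⁻¹? z) ≡ 1
    one-b k k≢i z q = from (cover k (Z∉A* k≢i q))
      where
      from : (∃ λ l → l ≢ k × ∃ λ b → b ∈ A k × b ⁻¹ ∙ z ∈ A l) → # (col (A∖ε? k) Z? D⁻¹? z) ≡ 1
      from (l , l≢k , b , b∈A , d∈A) = #-unique (col (A∖ε? k) Z? D⁻¹? z) ((b∈A , b≢ε) , d≢ε , l , l≢i , d∈A) unique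
        where
        z≡bd : ∀ b′ → b′ ∙ (b′ ⁻¹ ∙ z) ≡ z
        z≡bd b′ = solve (b′ ∷ z ∷ []) (x₀ ⊙ (inv x₀ ⊙ x₁)) x₁ refl
        d≢ε : b ⁻¹ ∙ z ≢ ε
        d≢ε e = Z∉A* k≢i q (A⊆A* k (≡∈ (A k) (trans (sym (identityʳ b)) (trans (cong (b ∙_) (sym e)) (z≡bd b))) b∈A))
        ε⇒z : b ≡ ε → b ⁻¹ ∙ z ≡ z
        ε⇒z refl = solve (z ∷ []) (inv one ⊙ x₀) x₀ refl
        l≢i : l ≢ i
        l≢i refl = c∉N (≡∈ N (solve (c ∷ []) (inv (inv x₀)) x₀ refl) (⁻¹∈ N (≡∈ N (trans (cong ((a ∙ c) ⁻¹ ∙_) z≡a)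
            (solve (a ∷ c ∷ []) (inv (x₀ ⊙ x₁) ⊙ x₀) (inv x₁) refl)) q)))
          where
          b≡ε : b ≡ ε
          b≡ε = A∩A* k≢i b∈A (≡∈ (A* i) (solve (b ∷ z ∷ []) (x₁ ⊙ inv (inv x₀ ⊙ x₁)) x₀ refl) (∙∈ (A* i) (Z⇒A* q) (⁻¹∈ (A* i) (A⊆A* i d∈A))))
          z≡a : z ≡ a
          z≡a = trans (solve (a ∷ z ∷ []) x₁ (x₀ ⊙ (inv x₀ ⊙ x₁)) refl)
            (trans (cong (a ∙_) (A∩S (∙∈ (A i) (⁻¹∈ (A i) a∈A) (≡∈ (A i) (ε⇒z b≡ε) d∈A)) (Z⇒a⁻¹z∈S q))) (identityʳ a))
        b≢ε : b ≢ ε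
        b≢ε e = Z∌ε q (A∩A* l≢i (≡∈ (A l) (ε⇒z e) d∈A) (Z⇒A* q))
        unique : ∀ b′ → (b′ ∈ A k × b′ ≢ ε) × D (b′ ⁻¹ ∙ z) → b′ ≡ b
        unique b′ ((b′∈A , _) , _ , l′ , _ , d′∈A) = trans (solve (b ∷ b′ ∷ []) x₁ (x₀ ⊙ inv (inv x₁ ⊙ x₀)) refl)
          (trans (cong (λ y → b ∙ y ⁻¹) (uniq l′≢k l≢k (∙∈ (A k) (⁻¹∈ (A k) b′∈A) b∈A) d′∈A d∈A
                    (solve (b ∷ b′ ∷ z ∷ []) (inv x₁ ⊙ x₂) (inv x₁ ⊙ x₀ ⊙ (inv x₀ ⊙ x₂)) refl)))
                 (solve (b ∷ []) (x₀ ⊙ inv one) x₀ refl))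
          where
          l′≢k : l′ ≢ k
          l′≢k refl = Z∉A* k≢i q (A⊆A* k (≡∈ (A k) (z≡bd b′) (∙∈ (A k) b′∈A d′∈A)))

    g : H → ℕ
    g b = # (row D? D? Z∙? b)

    -- Substituting `z = b ∙ d` counts the pairs by their product, and each `z` of the coset has one
    -- factorisation.
    pairs-from : ∀ k → k ≢ i → sum (λ b → ind (A∖ε? k b) * g b) ≡ ∣ N ∣
    pairs-from k k≢i = begin
      sum (λ b → ind (A∖ε? k b) * g b)                              ≡⟨ sum-cong-≗ (λ b → cong (ind (A∖ε? k b) *_) (shift b)) ⟩
      sum (λ b → ind (A∖ε? k b) * # (row (A∖ε? k) Z? D⁻¹? b))       ≡⟨ rows≡cols (A∖ε? k) Z? D⁻¹? ⟩
      sum (λ z → ind (Z? z) * # (col (A∖ε? k) Z? D⁻¹? z))           ≡⟨ sum-cong-≗ (λ z → only z (Z? z)) ⟩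
      # Z?                                                          ≡⟨ ∣Z∣ ⟩
      ∣ N ∣                                                         ∎
      where
      open ≡-Reasoning
      shift : ∀ b → g b ≡ # (row (A∖ε? k) Z? D⁻¹? b)
      shift b = trans (#-cong (row D? D? Z∙? b) (λ d → row (A∖ε? k) Z? D⁻¹? b (b ∙ d))
          (λ { d (p , q) → q , subst D (b⁻¹bd d) p }) (λ { d (q , p) → subst D (sym (b⁻¹bd d)) p , q }))
        (#-translateˡ (row (A∖ε? k) Z? D⁻¹? b) b)
        where
        b⁻¹bd : ∀ d → d ≡ b ⁻¹ ∙ (b ∙ d)
        b⁻¹bd d = solve (b ∷ d ∷ []) x₁ (inv x₀ ⊙ (x₀ ⊙ x₁)) refl
      only : ∀ z → (d : Dec (Z z)) → ind d * # (col (A∖ε? k) Z? D⁻¹? z) ≡ ind d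
      only z (no _)  = refl
      only z (yes q) = trans (+-identityʳ _) (one-b k k≢i z q)

    component-of : ∀ b → ind (D? b) ≡ sum (λ k → ind (¬? (k ≟ i)) * ind (A∖ε? k b))
    component-of b = sym (trans (sum-cong-≗ (λ k → sym (ind-× (¬? (k ≟ i)) (A∖ε? k b)))) (count (D? b)))
      where
      C? : Decidable (λ k → k ≢ i × (b ∈ A k × b ≢ ε))
      C? k = ¬? (k ≟ i) ×-dec A∖ε? k b
      count : (d : Dec (D b)) → # C? ≡ ind d
      count (yes (b≢ε , k , k≢i , b∈A)) = #-unique C? (k≢i , b∈A , b≢ε) (λ { l (_ , b∈Al , _) → A∩A b∈Al b∈A b≢ε })
      count (no ¬d) = #-none C? (λ { k (k≢i , b∈A , b≢ε) → ¬d (b≢ε , k , k≢i , b∈A) })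

    total : sum (λ b → sum (f b)) ≡ t * ∣ N ∣
    total = begin
      sum (λ b → sum (f b))
        ≡⟨ sum-cong-≗ (λ b → sum-*ˡ (ind (D? b)) (λ d → ind (row D? D? Z∙? b d))) ⟩
      sum (λ b → ind (D? b) * g b)
        ≡⟨ sum-cong-≗ (λ b → trans (cong (_* g b) (component-of b)) (trans (*-comm (sum (λ k → u k * v k b)) (g b)) (sym (sum-*ˡ (g b) (λ k → u k * v k b))))) ⟩
      sum (λ b → sum (λ k → g b * (u k * v k b)))
        ≡⟨ ∑-comm (λ b k → g b * (u k * v k b)) ⟩
      sum (λ k → sum (λ b → g b * (u k * v k b)))
        ≡⟨ sum-cong-≗ (λ k → trans (sum-cong-≗ (λ b → trans (*-comm (g b) (u k * v k b)) (*-assoc (u k) (v k b) (g b)))) (sum-*ˡ (u k) (λ b → v k b * g b))) ⟩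
      sum (λ k → u k * sum (λ b → v k b * g b))
        ≡⟨ sum-cong-≗ (λ k → each k (k ≟ i)) ⟩
      sum (λ k → ∣ N ∣ * ind (others? i k))
        ≡⟨ sum-*ˡ ∣ N ∣ (λ k → ind (others? i k)) ⟩
      ∣ N ∣ * # (others? i)
        ≡⟨ trans (cong (∣ N ∣ *_) (∣others∣ i)) (*-comm ∣ N ∣ t) ⟩
      t * ∣ N ∣ ∎
      where
      open ≡-Reasoning
      u : Fin (suc t) → ℕ
      u k = ind (¬? (k ≟ i))
      v : Fin (suc t) → H → ℕ
      v k b = ind (A∖ε? k b)
      each : ∀ k → (d : Dec (k ≡ i)) → ind (¬? d) * sum (λ b → v k b * g b) ≡ ∣ N ∣ * ind (whole k ×-dec ¬? d)
      each k (yes _) = sym (*-zeroʳ ∣ N ∣)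
      each k (no ne) = trans (+-identityʳ _) (trans (pairs-from k ne) (sym (*-identityʳ ∣ N ∣)))

    -- The ordered pairs of a graph are even in number. If this only makes `∣ N ∣` even, Lagrange in
    -- `S` still makes `t` even.
    t-even : 2 ∣ t
    t-even with euclidsLemma t ∣ N ∣ (from-yes (prime? 2)) (subst (2 ∣_) total (2∣-handshake f f-sym f-irrefl))
    ... | inj₁ h = h
    ... | inj₂ h = ∣-trans h (subst (∣ N ∣ ∣_) ∣S∣ (lagrange N S N⊆S))

  commutators-fill-odd : ¬ 2 ∣ t → ∀ {i a N} → Hyp i a N → S ⊆ N
  commutators-fill-odd t-odd {N = N} hyp {x} x∈S with mem? N x
  ... | yes p = p
  ... | no ¬p = contradiction (Odd.t-even hyp x∈S ¬p) t-odd

-- Commutators fill the symmetry group: a convolution idempotent for even t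

on : ∀ {P : Set} → Dec P → ℤ → ℤ
on d x = if does d then x else 0ℤ

on-yes : ∀ {P : Set} (d : Dec P) {x} → P → on d x ≡ x
on-yes (yes _) _ = refl
on-yes (no ¬p) p = contradiction p ¬p

on-no : ∀ {P : Set} (d : Dec P) {x} → ¬ P → on d x ≡ 0ℤ
on-no (yes p) ¬p = contradiction p ¬p
on-no (no _)  _  = refl

∑∈ : ∀ {n} {P : Fin n → Set} → Decidable P → (Fin n → ℤ) → ℤ
∑∈ P? f = ∑ (λ x → on (P? x) (f x))

∑∈-cong : ∀ {n} {P Q : Fin n → Set} (P? : Decidable P) (Q? : Decidable Q) {f g : Fin n → ℤ} →
          (∀ x → P x → Q x) → (∀ x → Q x → P x) → (∀ x → P x → f x ≡ g x) → ∑∈ P? f ≡ ∑∈ Q? g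
∑∈-cong P? Q? {f} {g} pq qp fg = ∑-cong (λ x → lem x (P? x))
  where
  lem : ∀ x → (d : Dec _) → on d (f x) ≡ on (Q? x) (g x)
  lem x (yes p) = trans (fg x p) (sym (on-yes (Q? x) (pq x p)))
  lem x (no ¬p) = sym (on-no (Q? x) (λ q → ¬p (qp x q)))

∑∈-const : ∀ {n} {P : Fin n → Set} (P? : Decidable P) {f : Fin n → ℤ} {c k} →
           (∀ x → P x → f x ≡ c) → # P? ≡ k → ∑∈ P? f ≡ ℤ.+ k ℤ.* c
∑∈-const P? {f} {c} h refl = trans (∑-cong (λ x → lem x (P? x))) (count P?)
  where
  lem : ∀ x → (d : Dec _) → on d (f x) ≡ ℤ.+ ind d ℤ.* c
  lem x (yes p) = trans (h x p) (sym (ℤ.*-identityˡ c))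
  lem x (no _)  = refl
  count : ∀ {n} {P : Fin n → Set} (P? : Decidable P) → ∑ (λ x → ℤ.+ ind (P? x) ℤ.* c) ≡ ℤ.+ (# P?) ℤ.* c
  count {zero}  P? = refl
  count {suc n} P? = trans (cong (λ z → ℤ.+ ind (P? zero) ℤ.* c ℤ.+ z) (count (P? ∘ suc))) (sym (ℤ.*-distribʳ-+ c (ℤ.+ ind (P? zero)) (ℤ.+ # (P? ∘ suc))))

∑∈-all : ∀ {n} {P : Fin n → Set} (P? : Decidable P) {f : Fin n → ℤ} → (∀ x → P x) → ∑∈ P? f ≡ ∑ f
∑∈-all P? h = ∑-cong (λ x → on-yes (P? x) (h x))

∑∈-remove : ∀ {n} {P : Fin n → Set} (P? : Decidable P) (f : Fin n → ℤ) {a} → P a →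
            ∑∈ P? f ≡ f a ℤ.+ ∑∈ (λ x → P? x ×-dec ¬? (x ≟ a)) f
∑∈-remove {n} {P} P? f {a} pa = begin
  ∑∈ P? f ≡⟨ ∑-cong (λ x → lem x (P? x) (x ≟ a)) ⟩
  ∑ (λ x → on (x ≟ a) (f x) ℤ.+ on (P? x ×-dec ¬? (x ≟ a)) (f x)) ≡⟨ ∑-+ {n} _ _ ⟩
  ∑∈ (_≟ a) f ℤ.+ ∑∈ (λ x → P? x ×-dec ¬? (x ≟ a)) f
    ≡⟨ cong (ℤ._+ ∑∈ (λ x → P? x ×-dec ¬? (x ≟ a)) f) (trans (∑∈-const (_≟ a) (λ { x refl → refl }) (#-unique (_≟ a) refl (λ _ h → h))) (ℤ.*-identityˡ _)) ⟩
  f a ℤ.+ ∑∈ (λ x → P? x ×-dec ¬? (x ≟ a)) f ∎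
  where
  open ≡-Reasoning
  lem : ∀ x (d : Dec (P x)) (e : Dec (x ≡ a)) → on d (f x) ≡ on e (f x) ℤ.+ on (d ×-dec ¬? e) (f x)
  lem x (yes _) (yes _) = sym (ℤ.+-identityʳ _)
  lem x (yes _) (no _)  = sym (ℤ.+-identityˡ _)
  lem x (no ¬p) (yes refl) = contradiction pa ¬p
  lem x (no _)  (no _)  = refl

module _ {m n} {P : Fin m → Set} {Q : Fin n → Set} {R : Fin m → Fin n → Set}
         (P? : Decidable P) (Q? : Decidable Q) (R? : ∀ x y → Dec (R x y)) where

  ∑∈-swap : (f : Fin m → Fin n → ℤ) → ∑∈ P? (λ x → ∑∈ (row P? Q? R? x) (f x)) ≡ ∑∈ Q? (λ y → ∑∈ (col P? Q? R? y) (λ x → f x y))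
  ∑∈-swap f = begin
    ∑ (λ x → on (P? x) (∑∈ (row P? Q? R? x) (f x)))
      ≡⟨ ∑-cong (λ x → inside (P? x) (λ y → on (row P? Q? R? x y) (f x y))) ⟩
    ∑ (λ x → ∑ (λ y → on (P? x) (on (row P? Q? R? x y) (f x y))))
      ≡⟨ ∑-swap (λ x y → on (P? x) (on (row P? Q? R? x y) (f x y))) ⟩
    ∑ (λ y → ∑ (λ x → on (P? x) (on (row P? Q? R? x y) (f x y))))
      ≡⟨ ∑-cong (λ y → ∑-cong (λ x → flip (P? x) (Q? y) (R? x y) (f x y))) ⟩
    ∑ (λ y → ∑ (λ x → on (Q? y) (on (col P? Q? R? y x) (f x y))))
      ≡⟨ ∑-cong (λ y → sym (inside (Q? y) (λ x → on (col P? Q? R? y x) (f x y)))) ⟩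
    ∑∈ Q? (λ y → ∑∈ (col P? Q? R? y) (λ x → f x y)) ∎
    where
    open ≡-Reasoning
    inside : ∀ {A : Set} {k} (d : Dec A) (g : Fin k → ℤ) → on d (∑ g) ≡ ∑ (λ y → on d (g y))
    inside (yes _) g = refl
    inside {k = k} (no _) g = sym (∑-zero {k} (λ _ → refl))
    flip : ∀ {A B C : Set} (a : Dec A) (b : Dec B) (c : Dec C) x → on a (on (b ×-dec c) x) ≡ on b (on (a ×-dec c) x)
    flip (yes _) (yes _) c x = refl
    flip (yes _) (no _)  c x = refl
    flip (no _)  (yes _) c x = refl
    flip (no _)  (no _)  c x = refl

∑-reindex : ∀ {m n} (f : Fin n → ℤ) (φ : Fin m → Fin n) (ψ : Fin n → Fin m) →
            (∀ x → ψ (φ x) ≡ x) → (∀ y → φ (ψ y) ≡ y) → ∑ (f ∘ φ) ≡ ∑ f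
∑-reindex {m} {n} f φ ψ ψφ φψ = begin
  ∑ (f ∘ φ)                        ≡⟨ ∑-cong (λ x → sym (trans (∑∈-const (φ x ≟_) {f} (λ y e → cong f (sym e)) (#-unique (φ x ≟_) refl (λ _ → sym))) (ℤ.*-identityˡ _))) ⟩
  ∑ (λ x → ∑∈ (φ x ≟_) f)          ≡⟨ ∑-swap (λ x y → on (φ x ≟ y) (f y)) ⟩
  ∑ (λ y → ∑∈ (λ x → φ x ≟ y) (λ _ → f y))
    ≡⟨ ∑-cong (λ y → trans (∑∈-const (λ x → φ x ≟ y) (λ _ _ → refl) (#-unique (λ x → φ x ≟ y) (φψ y) (λ { x refl → sym (ψφ x) }))) (ℤ.*-identityˡ _)) ⟩
  ∑ f ∎
  where open ≡-Reasoning

divisor-of-power : ∀ {p} → Prime p → ∀ N d → .{{NonZero d}} → d ∣ p ^ N → ∃ λ g → d ≡ p ^ g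
divisor-of-power pr N 1 h = 0 , refl
divisor-of-power pr N (suc (suc d)) h = only-prime⇒power (s≤s (s≤s z≤n)) (λ q qr q∣d → prime∣prime-power qr pr N (∣-trans q∣d h))

no-power-between : ∀ {f g t} → 1 ≤ t → t < 2 ^ f → 2 ^ f + t ≡ 2 ^ g → ⊥
no-power-between {f} {g} {t} 1≤t t< eq with f <? g
... | yes f<g = <⇒≱ (+-monoʳ-< (2 ^ f) t<) (≤-trans (≤-reflexive (cong ((2 ^ f) +_) (sym (+-identityʳ (2 ^ f))))) (≤-trans (^-monoʳ-≤ 2 f<g) (≤-reflexive (sym eq))))
... | no f≮g = <⇒≱ (≤-trans (≤-reflexive (sym (+-comm (2 ^ f) 1))) (+-monoʳ-≤ (2 ^ f) 1≤t)) (≤-trans (≤-reflexive eq) (^-monoʳ-≤ 2 (≮⇒≥ f≮g)))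

module CommutatorImageEven {n s t} {𝔾 : FinGroup n} (𝕂 : Kantor 𝔾 s t) where
  open FinGroupTheory 𝔾
  open GroupActions 𝔾
  open NormalSubgroups 𝔾
  open KantorTheory 𝕂
  open CommutatorImage 𝕂

  -- With χ the character of S with kernel N, the function ΣK on H which is Σⱼ χ on the A* j
  -- satisfies ΣK * ΣK = t (s + t) ΣK.  As the involution a is central modulo N, convolution with
  -- K′ = (1 − a) ΣK is 2 t (s + t) times an idempotent, and its trace n t is divisible by that number.
  module Index2 {i a N} (hyp : Hyp i a N) (a²≡ε : a ∙ a ≡ ε) (2N≡t : ∣ N ∣ + ∣ N ∣ ≡ t) where
    open Hyp hyp

    -- Only the values on `S` matter; there `N` has index 2, and `χ` is the sign character.
    χ : H → ℤ
    χ σ = if does (mem? N σ) then 1ℤ else -1ℤ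

    χ-N : ∀ {σ} → σ ∈ N → χ σ ≡ 1ℤ
    χ-N {σ} p = by (mem? N σ)
      where by : (d : Dec (σ ∈ N)) → (if does d then 1ℤ else -1ℤ) ≡ 1ℤ
            by (yes _) = refl
            by (no ¬p) = contradiction p ¬p

    χ-∉N : ∀ {σ} → ¬ σ ∈ N → χ σ ≡ -1ℤ
    χ-∉N {σ} ¬p = by (mem? N σ)
      where by : (d : Dec (σ ∈ N)) → (if does d then 1ℤ else -1ℤ) ≡ -1ℤ
            by (yes p) = contradiction p ¬p
            by (no _)  = refl

    -- `N` and `σ ⁻¹ N` are disjoint and have `t` elements together, so they exhaust `S`.
    ∉N-∙ : ∀ {σ τ} → σ ∈ S → τ ∈ S → ¬ σ ∈ N → ¬ τ ∈ N → σ ∙ τ ∈ N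
    ∉N-∙ {σ} {τ} σ∈S τ∈S σ∉N τ∉N = from (#-full P? (mem? S) (λ { x (inj₁ p) → N⊆S p ; x (inj₂ p) → ∈-cancelˡ S σ∈S (N⊆S p) }) full-size τ τ∈S)
      where
      P? : Decidable (λ x → x ∈ N ⊎ σ ∙ x ∈ N)
      P? x = mem? N x ⊎-dec mem? N (σ ∙ x)
      from : τ ∈ N ⊎ σ ∙ τ ∈ N → σ ∙ τ ∈ N
      from (inj₁ p) = contradiction p τ∉N
      from (inj₂ p) = p
      full-size : ∣ S ∣ ≤ # P?
      full-size = ≤-reflexive (trans ∣S∣ (trans (sym 2N≡t) (sym (trans (#-split P? (mem? N)) (cong₂ _+_
        (#-cong (λ x → P? x ×-dec mem? N x) (mem? N) (λ _ → proj₂) (λ _ p → inj₁ p , p))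
        (trans (#-cong (λ x → P? x ×-dec ¬? (mem? N x)) (λ x → mem? N (σ ∙ x))
                 (λ { x (inj₁ p , ¬p) → contradiction p ¬p ; x (inj₂ p , _) → p })
                 (λ x p → inj₂ p , λ q → σ∉N (∈-cancelʳ N q p)))
               (#-translateˡ (mem? N) σ)))))))

    χ-∙ : ∀ {σ τ} → σ ∈ S → τ ∈ S → χ (σ ∙ τ) ≡ χ σ ℤ.* χ τ
    χ-∙ {σ} {τ} p q = by (mem? N σ) (mem? N τ)
      where
      by : Dec (σ ∈ N) → Dec (τ ∈ N) → χ (σ ∙ τ) ≡ χ σ ℤ.* χ τ
      by (yes u) (yes v) = trans (χ-N (∙∈ N u v)) (sym (cong₂ ℤ._*_ (χ-N u) (χ-N v)))
      by (yes u) (no v)  = trans (χ-∉N (λ w → v (∈-cancelˡ N u w))) (sym (cong₂ ℤ._*_ (χ-N u) (χ-∉N v)))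
      by (no u)  (yes v) = trans (χ-∉N (λ w → u (∈-cancelʳ N v w))) (sym (cong₂ ℤ._*_ (χ-∉N u) (χ-N v)))
      by (no u)  (no v)  = trans (χ-N (∉N-∙ p q u v)) (sym (cong₂ ℤ._*_ (χ-∉N u) (χ-∉N v)))

    χ² : ∀ σ → χ σ ℤ.* χ σ ≡ 1ℤ
    χ² σ = by (mem? N σ)
      where by : Dec (σ ∈ N) → χ σ ℤ.* χ σ ≡ 1ℤ
            by (yes u) = cong₂ ℤ._*_ (χ-N u) (χ-N u)
            by (no u)  = cong₂ ℤ._*_ (χ-∉N u) (χ-∉N u)

    χ-⁻¹ : ∀ {σ} → σ ∈ S → χ (σ ⁻¹) ≡ χ σ
    χ-⁻¹ {σ} p = begin
      χ (σ ⁻¹)                     ≡⟨ sym (ℤ.*-identityʳ _) ⟩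
      χ (σ ⁻¹) ℤ.* 1ℤ              ≡⟨ cong (χ (σ ⁻¹) ℤ.*_) (sym (χ² σ)) ⟩
      χ (σ ⁻¹) ℤ.* (χ σ ℤ.* χ σ)   ≡⟨ sym (ℤ.*-assoc (χ (σ ⁻¹)) (χ σ) (χ σ)) ⟩
      χ (σ ⁻¹) ℤ.* χ σ ℤ.* χ σ     ≡⟨ cong (ℤ._* χ σ) (sym (χ-∙ (⁻¹∈ S p) p)) ⟩
      χ (σ ⁻¹ ∙ σ) ℤ.* χ σ         ≡⟨ cong (ℤ._* χ σ) (χ-N (≡∈ N (sym (inverseˡ σ)) (ε∈ N))) ⟩
      1ℤ ℤ.* χ σ                   ≡⟨ ℤ.*-identityˡ _ ⟩
      χ σ                          ∎
      where open ≡-Reasoning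

    χ-conj : ∀ h {σ} → σ ∈ S → χ (h ⁻¹ ∙ σ ∙ h) ≡ χ σ
    χ-conj h {σ} p = trans (cong χ (conj≡ σ h)) (trans (χ-∙ p (N⊆S ([S] h p))) (trans (cong (χ σ ℤ.*_) (χ-N ([S] h p))) (ℤ.*-identityʳ _)))

    value : ∀ j {v} → Dec (v ∈ A* j) → ℤ
    value j (no _)  = 0ℤ
    value j (yes p) = χ (proj₁ (split j p))

    -- `χ` is extended from `S` to `A* j`, a product of `A j` and `S`, by ignoring the factor in
    -- `A j`, and by zero elsewhere.
    K : Fin (suc t) → H → ℤ
    K j v = value j (mem? (A* j) v)

    K-outside : ∀ j {v} → ¬ v ∈ A* j → K j v ≡ 0ℤ
    K-outside j {v} ¬p = by (mem? (A* j) v)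
      where by : (d : Dec (v ∈ A* j)) → value j d ≡ 0ℤ
            by (yes p) = contradiction p ¬p
            by (no _)  = refl

    K-value : ∀ j {b σ} → b ∈ A j → σ ∈ S → K j (b ∙ σ) ≡ χ σ
    K-value j {b} {σ} b∈A σ∈S = by (mem? (A* j) (b ∙ σ))
      where
      same : (w : ∃ λ τ → τ ∈ S × b ∙ σ ∙ τ ⁻¹ ∈ A j) → proj₁ w ≡ σ
      same (τ , τ∈S , q) = trans (solve (σ ∷ τ ∷ []) x₁ (inv (x₀ ⊙ inv x₁) ⊙ x₀) refl)
        (trans (cong (λ z → z ⁻¹ ∙ σ) (A∩S (≡∈ (A j) (solve (b ∷ σ ∷ τ ∷ []) (inv x₀ ⊙ (x₀ ⊙ x₁ ⊙ inv x₂)) (x₁ ⊙ inv x₂) refl) (∙∈ (A j) (⁻¹∈ (A j) b∈A) q))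
                                           (∙∈ S σ∈S (⁻¹∈ S τ∈S))))
               (solve (σ ∷ []) (inv one ⊙ x₀) x₀ refl))
      by : (d : Dec (b ∙ σ ∈ A* j)) → value j d ≡ χ σ
      by (no ¬p) = contradiction (∙∈ (A* j) (A⊆A* j b∈A) (S⊆A* j σ∈S)) ¬p
      by (yes p) = cong χ (same (split j p))

    data View (j : Fin (suc t)) : H → Set where
      outside : ∀ {v} → ¬ v ∈ A* j → View j v
      inside  : ∀ {b σ} → b ∈ A j → σ ∈ S → View j (b ∙ σ)

    view : ∀ j v → View j v
    view j v = by (mem? (A* j) v)
      where
      from : (∃ λ σ → σ ∈ S × v ∙ σ ⁻¹ ∈ A j) → View j v
      from (σ , σ∈S , q) = subst (View j) (solve (v ∷ σ ∷ []) (x₀ ⊙ inv x₁ ⊙ x₁) x₀ refl) (inside q σ∈S)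
      by : Dec (v ∈ A* j) → View j v
      by (no ¬p) = outside ¬p
      by (yes p) = from (split j p)

    K-right : ∀ j v {τ} → τ ∈ S → K j (v ∙ τ) ≡ K j v ℤ.* χ τ
    K-right j v {τ} τ∈S = by (view j v)
      where
      by : ∀ {v} → View j v → K j (v ∙ τ) ≡ K j v ℤ.* χ τ
      by (outside ¬p) = trans (K-outside j (λ q → ¬p (∈-cancelʳ (A* j) (S⊆A* j τ∈S) q))) (sym (cong (ℤ._* χ τ) (K-outside j ¬p)))
      by (inside {b} {σ} p q) = trans (cong (K j) (assoc b σ τ)) (trans (K-value j p (∙∈ S q τ∈S)) (trans (χ-∙ q τ∈S) (cong (ℤ._* χ τ) (sym (K-value j p q)))))

    K-left : ∀ j v {τ} → τ ∈ S → K j (τ ∙ v) ≡ χ τ ℤ.* K j v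
    K-left j v {τ} τ∈S = begin
      K j (τ ∙ v)                     ≡⟨ cong (K j) (solve (v ∷ τ ∷ []) (x₁ ⊙ x₀) (x₀ ⊙ (inv x₀ ⊙ x₁ ⊙ x₀)) refl) ⟩
      K j (v ∙ (v ⁻¹ ∙ τ ∙ v))        ≡⟨ K-right j v (S-normal v τ∈S) ⟩
      K j v ℤ.* χ (v ⁻¹ ∙ τ ∙ v)      ≡⟨ cong (K j v ℤ.*_) (χ-conj v τ∈S) ⟩
      K j v ℤ.* χ τ                   ≡⟨ ℤ.*-comm (K j v) (χ τ) ⟩
      χ τ ℤ.* K j v                   ∎
      where open ≡-Reasoning

    K-component : ∀ j v {b} → b ∈ A j → K j (b ∙ v) ≡ K j v
    K-component j v {b} b∈A = by (view j v)
      where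
      by : ∀ {v} → View j v → K j (b ∙ v) ≡ K j v
      by (outside ¬p) = trans (K-outside j (λ q → ¬p (∈-cancelˡ (A* j) (A⊆A* j b∈A) q))) (sym (K-outside j ¬p))
      by (inside {c} {σ} p q) = trans (cong (K j) (sym (assoc b c σ))) (trans (K-value j (∙∈ (A j) b∈A p) q) (sym (K-value j p q)))

    ΣK : H → ℤ
    ΣK v = ∑ (λ j → K j v)

    ΣK-left : ∀ v {τ} → τ ∈ S → ΣK (τ ∙ v) ≡ χ τ ℤ.* ΣK v
    ΣK-left v {τ} τ∈S = trans (∑-cong (λ j → K-left j v τ∈S)) (∑-*ˡ (χ τ) (λ j → K j v))

    ΣK-right : ∀ v {ν} → ν ∈ N → ΣK (v ∙ ν) ≡ ΣK v
    ΣK-right v {ν} p = ∑-cong {f = λ j → K j (v ∙ ν)} {g = λ j → K j v} (λ j → trans (K-right j v (N⊆S p)) (trans (cong (K j v ℤ.*_) (χ-N p)) (ℤ.*-identityʳ _)))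

    -- For `v = b σ` in `A* k` the term is `χ σ` times `χ σ` times `G (b ⁻¹ ∙ z)`. The signs cancel,
    -- so the `t` choices of `σ` contribute equally.
    convolve : ∀ k (G : H → ℤ) → (∀ v {τ} → τ ∈ S → G (τ ∙ v) ≡ χ τ ℤ.* G v) → ∀ z →
               ∑ (λ v → K k v ℤ.* G (v ⁻¹ ∙ z)) ≡ ℤ.+ t ℤ.* ∑∈ (mem? (A k)) (λ b → G (b ∙ z))
    convolve k G G-left z = begin
      ∑ (λ v → K k v ℤ.* G (v ⁻¹ ∙ z))
        ≡⟨ ∑-cong (λ v → at v (mem? (A* k) v)) ⟩
      ∑∈ (mem? (A* k)) (λ v → ∑∈ (row (mem? (A* k)) (mem? (A k)) R? v) (λ b → G (b ⁻¹ ∙ z)))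
        ≡⟨ ∑∈-swap (mem? (A* k)) (mem? (A k)) R? (λ _ b → G (b ⁻¹ ∙ z)) ⟩
      ∑∈ (mem? (A k)) (λ b → ∑∈ (col (mem? (A* k)) (mem? (A k)) R? b) (λ _ → G (b ⁻¹ ∙ z)))
        ≡⟨ ∑∈-cong (mem? (A k)) (mem? (A k)) (λ _ p → p) (λ _ p → p) (λ b b∈A → ∑∈-const (col (mem? (A* k)) (mem? (A k)) R? b) (λ _ _ → refl)
             (trans (#-cong (col (mem? (A* k)) (mem? (A k)) R? b) (R? ⟨·⟩ b) (λ _ → proj₂)
                (λ v q → ≡∈ (A* k) (solve (b ∷ v ∷ []) (x₀ ⊙ (inv x₀ ⊙ x₁)) x₁ refl) (∙∈ (A* k) (A⊆A* k b∈A) (S⊆A* k q)) , q))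
               (trans (#-translateˡ (mem? S) (b ⁻¹)) ∣S∣))) ⟩
      ∑∈ (mem? (A k)) (λ b → ℤ.+ t ℤ.* G (b ⁻¹ ∙ z))
        ≡⟨ trans (∑-cong (λ b → on-* (mem? (A k) b))) (∑-*ˡ (ℤ.+ t) (λ b → on (mem? (A k) b) (G (b ⁻¹ ∙ z)))) ⟩
      ℤ.+ t ℤ.* ∑∈ (mem? (A k)) (λ b → G (b ⁻¹ ∙ z))
        ≡⟨ cong (ℤ.+ t ℤ.*_) (trans (∑-cong (λ b → inverse-on b (mem? (A k) b) (mem? (A k) (b ⁻¹))))
             (∑-reindex (λ b → on (mem? (A k) b) (G (b ∙ z))) _⁻¹ _⁻¹ inv-inv inv-inv)) ⟩
      ℤ.+ t ℤ.* ∑∈ (mem? (A k)) (λ b → G (b ∙ z)) ∎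
      where
      open ≡-Reasoning
      R? : ∀ v b → Dec (b ⁻¹ ∙ v ∈ S)
      R? v b = mem? S (b ⁻¹ ∙ v)
      _⟨·⟩_ : (∀ v b → Dec (b ⁻¹ ∙ v ∈ S)) → ∀ b v → Dec (b ⁻¹ ∙ v ∈ S)
      (r ⟨·⟩ b) v = r v b
      inv-inv : ∀ b → b ⁻¹ ⁻¹ ≡ b
      inv-inv b = solve (b ∷ []) (inv (inv x₀)) x₀ refl
      on-* : ∀ {P : Set} (d : Dec P) {x} → on d (ℤ.+ t ℤ.* x) ≡ ℤ.+ t ℤ.* on d x
      on-* (yes _) = refl
      on-* (no _)  = sym (ℤ.*-zeroʳ (ℤ.+ t))
      inverse-on : ∀ b (d : Dec (b ∈ A k)) (d′ : Dec (b ⁻¹ ∈ A k)) → on d (G (b ⁻¹ ∙ z)) ≡ on d′ (G (b ⁻¹ ∙ z))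
      inverse-on b (yes p) d′ = sym (on-yes d′ (⁻¹∈ (A k) p))
      inverse-on b (no ¬p) d′ = sym (on-no d′ (λ q → ¬p (≡∈ (A k) (inv-inv b) (⁻¹∈ (A k) q))))
      at : ∀ v (d : Dec (v ∈ A* k)) → K k v ℤ.* G (v ⁻¹ ∙ z) ≡ on d (∑∈ (row (mem? (A* k)) (mem? (A k)) R? v) (λ b → G (b ⁻¹ ∙ z)))
      at v (no ¬p) = cong (ℤ._* G (v ⁻¹ ∙ z)) (K-outside k ¬p)
      at v (yes p) = by p (view k v)
        where
        by : ∀ {v} → v ∈ A* k → View k v → K k v ℤ.* G (v ⁻¹ ∙ z) ≡ ∑∈ (row (mem? (A* k)) (mem? (A k)) R? v) (λ b → G (b ⁻¹ ∙ z))
        by p (outside ¬p) = contradiction p ¬p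
        by p (inside {b} {σ} b∈A σ∈S) = trans value≡ (sym (trans
            (∑∈-const (row (mem? (A* k)) (mem? (A k)) R? (b ∙ σ)) {c = G (b ⁻¹ ∙ z)} (λ { c (c∈A , q) → cong (λ y → G (y ⁻¹ ∙ z)) (unique c c∈A q) })
              (#-unique (row (mem? (A* k)) (mem? (A k)) R? (b ∙ σ)) (b∈A , ≡∈ S (solve (b ∷ σ ∷ []) x₁ (inv x₀ ⊙ (x₀ ⊙ x₁)) refl) σ∈S)
                 (λ { c (c∈A , q) → unique c c∈A q })))
            (ℤ.*-identityˡ _)))
          where
          unique : ∀ c → c ∈ A k → c ⁻¹ ∙ (b ∙ σ) ∈ S → c ≡ b
          unique c c∈A q = trans (solve (b ∷ c ∷ []) x₁ (x₀ ⊙ inv (inv x₁ ⊙ x₀)) refl) (trans (cong (λ y → b ∙ y ⁻¹)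
            (A∩S (∙∈ (A k) (⁻¹∈ (A k) c∈A) b∈A) (∈-cancelʳ S σ∈S (≡∈ S (solve (b ∷ c ∷ σ ∷ []) (inv x₁ ⊙ (x₀ ⊙ x₂)) (inv x₁ ⊙ x₀ ⊙ x₂) refl) q))))
            (solve (b ∷ []) (x₀ ⊙ inv one) x₀ refl))
          value≡ : K k (b ∙ σ) ℤ.* G ((b ∙ σ) ⁻¹ ∙ z) ≡ G (b ⁻¹ ∙ z)
          value≡ = begin
            K k (b ∙ σ) ℤ.* G ((b ∙ σ) ⁻¹ ∙ z)   ≡⟨ cong₂ ℤ._*_ (K-value k b∈A σ∈S) (cong G (solve (b ∷ σ ∷ z ∷ []) (inv (x₀ ⊙ x₁) ⊙ x₂) (inv x₁ ⊙ (inv x₀ ⊙ x₂)) refl)) ⟩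
            χ σ ℤ.* G (σ ⁻¹ ∙ (b ⁻¹ ∙ z))        ≡⟨ cong (χ σ ℤ.*_) (trans (G-left (b ⁻¹ ∙ z) (⁻¹∈ S σ∈S)) (cong (ℤ._* G (b ⁻¹ ∙ z)) (χ-⁻¹ σ∈S))) ⟩
            χ σ ℤ.* (χ σ ℤ.* G (b ⁻¹ ∙ z))       ≡⟨ sym (ℤ.*-assoc (χ σ) (χ σ) _) ⟩
            χ σ ℤ.* χ σ ℤ.* G (b ⁻¹ ∙ z)         ≡⟨ trans (cong (ℤ._* G (b ⁻¹ ∙ z)) (χ² σ)) (ℤ.*-identityˡ _) ⟩
            G (b ⁻¹ ∙ z)                         ∎

    module _ {c} (c∈S : c ∈ S) (c∉N : ¬ c ∈ N) where

      -- Translation by `c`, where `χ` is -1, permutes the complement of `A* j` and reverses the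
      -- sign of every term.
      outside-sum : ∀ j z → ∑∈ (λ h → ¬? (mem? (A* j) h)) (λ h → K j (h ∙ z)) ≡ 0ℤ
      outside-sum j z = self-negative _ (begin
        ∑∈ (λ h → ¬? (mem? (A* j) h)) (λ h → K j (h ∙ z))
          ≡⟨ sym (∑-reindex (λ h → on (¬? (mem? (A* j) h)) (K j (h ∙ z))) (c ∙_) (c ⁻¹ ∙_)
                (λ x → solve (c ∷ x ∷ []) (inv x₀ ⊙ (x₀ ⊙ x₁)) x₁ refl) (λ x → solve (c ∷ x ∷ []) (x₀ ⊙ (inv x₀ ⊙ x₁)) x₁ refl)) ⟩
        ∑ (λ h → on (¬? (mem? (A* j) (c ∙ h))) (K j (c ∙ h ∙ z)))
          ≡⟨ ∑-cong (λ h → at h (mem? (A* j) h) (mem? (A* j) (c ∙ h))) ⟩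
        ∑ (λ h → -1ℤ ℤ.* on (¬? (mem? (A* j) h)) (K j (h ∙ z)))
          ≡⟨ ∑-*ˡ -1ℤ (λ h → on (¬? (mem? (A* j) h)) (K j (h ∙ z))) ⟩
        -1ℤ ℤ.* ∑∈ (λ h → ¬? (mem? (A* j) h)) (λ h → K j (h ∙ z)) ∎)
        where
        open ≡-Reasoning
        self-negative : ∀ x → x ≡ -1ℤ ℤ.* x → x ≡ 0ℤ
        self-negative (ℤ.+ zero)    _ = refl
        self-negative (ℤ.+ suc n)   ()
        self-negative (ℤ.-[1+ n ])  ()
        at : ∀ h (d : Dec (h ∈ A* j)) (d′ : Dec (c ∙ h ∈ A* j)) → on (¬? d′) (K j (c ∙ h ∙ z)) ≡ -1ℤ ℤ.* on (¬? d) (K j (h ∙ z))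
        at h (yes p) d′ = on-no (¬? d′) (λ ¬q → ¬q (∙∈ (A* j) (S⊆A* j c∈S) p))
        at h (no ¬p) d′ = trans (on-yes (¬? d′) (λ q → ¬p (∈-cancelˡ (A* j) (S⊆A* j c∈S) q)))
          (trans (cong (K j) (assoc c h z)) (trans (K-left j (h ∙ z) c∈S) (cong (ℤ._* K j (h ∙ z)) (χ-∉N c∉N))))

      open Whole using () renaming (outside? to outside?; B? to B?; left-factor? to left-factor?; one-b to one-b; s-many to s-many)

      -- Each element outside `A* j` is uniquely `a b` with `a ∈ A j` and `b` in `B? j`. As `K j`
      -- ignores `a`, the vanishing sum over the complement is `s` times this one.
      B-sum : ∀ j z → ∑∈ (B? j) (λ b → K j (b ∙ z)) ≡ 0ℤ
      B-sum j z = cancel-s (begin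
        ℤ.+ s ℤ.* ∑∈ (B? j) (λ b → K j (b ∙ z))
          ≡⟨ trans (sym (∑-*ˡ (ℤ.+ s) (λ b → on (B? j b) (K j (b ∙ z))))) (∑-cong (λ b → on-s b (B? j b))) ⟩
        ∑∈ (B? j) (λ b → ∑∈ (col (outside? j) (B? j) (left-factor? j) b) (λ h → K j (h ∙ z)))
          ≡⟨ sym (∑∈-swap (outside? j) (B? j) (left-factor? j) (λ h _ → K j (h ∙ z))) ⟩
        ∑∈ (outside? j) (λ h → ∑∈ (row (outside? j) (B? j) (left-factor? j) h) (λ _ → K j (h ∙ z)))
          ≡⟨ ∑∈-cong (outside? j) (λ h → ¬? (mem? (A* j) h)) (λ _ → proj₂) (λ _ p → tt , p)
               (λ { h (_ , h∉A*) → trans (∑∈-const (row (outside? j) (B? j) (left-factor? j) h) (λ _ _ → refl) (one-b j h tt h∉A*)) (ℤ.*-identityˡ _) }) ⟩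
        ∑∈ (λ h → ¬? (mem? (A* j) h)) (λ h → K j (h ∙ z))
          ≡⟨ outside-sum j z ⟩
        0ℤ ∎)
        where
        open ≡-Reasoning
        cancel-s : ∀ {x} → ℤ.+ s ℤ.* x ≡ 0ℤ → x ≡ 0ℤ
        cancel-s {x} h with ℤ.i*j≡0⇒i≡0∨j≡0 (ℤ.+ s) h
        ... | inj₂ e = e
        ... | inj₁ e = contradiction (subst (2 ≤_) (ℤ.+-injective e) 2≤s) λ ()
        on-s : ∀ b (d : Dec (Whole.B j b)) → ℤ.+ s ℤ.* on d (K j (b ∙ z)) ≡ on d (∑∈ (col (outside? j) (B? j) (left-factor? j) b) (λ h → K j (h ∙ z)))
        on-s b (no _)  = ℤ.*-zeroʳ (ℤ.+ s)
        on-s b (yes p) = sym (∑∈-const (col (outside? j) (B? j) (left-factor? j) b)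
          (λ { h (_ , q) → trans (cong (K j) (solve (h ∷ b ∷ z ∷ []) (x₀ ⊙ x₂) (x₀ ⊙ inv x₁ ⊙ (x₁ ⊙ x₂)) refl)) (K-component j (b ∙ z) q) }) (s-many j b p))

      component-sum : ∀ j (F : H → ℤ) k → k ≢ j →
                      ∑∈ (mem? (A k)) F ≡ F ε ℤ.+ ∑∈ (row (others? j) (B? j) (λ l b → mem? (A l) b) k) F
      component-sum j F k k≢j = trans (∑∈-remove (mem? (A k)) F (ε∈ (A k))) (cong (ℤ._+_ (F ε))
        (∑∈-cong (λ x → mem? (A k) x ×-dec ¬? (x ≟ ε)) (row (others? j) (B? j) (λ l b → mem? (A l) b) k) {F} {F}
          (λ { b (b∈A , b≢ε) → ((tt , b≢ε) , k , k≢j , b∈A) , b∈A }) (λ { b (((_ , b≢ε) , _) , b∈A) → b∈A , b≢ε }) (λ _ _ → refl)))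

      -- `A j` itself contributes `s` copies of `K j z`, each of the other `t` components one copy
      -- through `ε`, and their remaining elements cancel by `B-sum`.
      T-eigen : ∀ j z → ∑ (λ k → ∑∈ (mem? (A k)) (λ b → K j (b ∙ z))) ≡ (ℤ.+ s ℤ.+ ℤ.+ t) ℤ.* K j z
      T-eigen j z = begin
        ∑ (λ k → ∑∈ (mem? (A k)) F)
          ≡⟨ sym (∑∈-all (whole {suc t}) {λ k → ∑∈ (mem? (A k)) F} (λ _ → tt)) ⟩
        ∑∈ whole (λ k → ∑∈ (mem? (A k)) F)
          ≡⟨ ∑∈-remove whole (λ k → ∑∈ (mem? (A k)) F) {j} tt ⟩
        ∑∈ (mem? (A j)) F ℤ.+ ∑∈ (others? j) (λ k → ∑∈ (mem? (A k)) F)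
          ≡⟨ cong₂ ℤ._+_ (∑∈-const (mem? (A j)) (λ b b∈A → K-component j z b∈A) (∣A∣ j)) rest ⟩
        ℤ.+ s ℤ.* K j z ℤ.+ ℤ.+ t ℤ.* K j z
          ≡⟨ sym (ℤ.*-distribʳ-+ (K j z) (ℤ.+ s) (ℤ.+ t)) ⟩
        (ℤ.+ s ℤ.+ ℤ.+ t) ℤ.* K j z ∎
        where
        open ≡-Reasoning
        F : H → ℤ
        F b = K j (b ∙ z)
        R? : ∀ l b → Dec (b ∈ A l)
        R? l b = mem? (A l) b
        on-+ : ∀ {P : Set} (d : Dec P) x y → on d (x ℤ.+ y) ≡ on d x ℤ.+ on d y
        on-+ (yes _) x y = refl
        on-+ (no _)  x y = refl
        rest : ∑∈ (others? j) (λ k → ∑∈ (mem? (A k)) F) ≡ ℤ.+ t ℤ.* K j z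
        rest = begin
          ∑∈ (others? j) (λ k → ∑∈ (mem? (A k)) F)
            ≡⟨ ∑∈-cong (others? j) (others? j) (λ _ p → p) (λ _ p → p) (λ { k (_ , k≢j) → component-sum j F k k≢j }) ⟩
          ∑∈ (others? j) (λ k → F ε ℤ.+ ∑∈ (row (others? j) (B? j) R? k) F)
            ≡⟨ trans (∑-cong (λ k → on-+ (others? j k) (F ε) (∑∈ (row (others? j) (B? j) R? k) F)))
                     (∑-+ (λ k → on (others? j k) (F ε)) (λ k → on (others? j k) (∑∈ (row (others? j) (B? j) R? k) F))) ⟩
          ∑∈ (others? j) (λ _ → F ε) ℤ.+ ∑∈ (others? j) (λ k → ∑∈ (row (others? j) (B? j) R? k) F)
            ≡⟨ cong₂ ℤ._+_ (∑∈-const (others? j) (λ _ _ → cong (K j) (identityˡ z)) (∣others∣ j)) (trans (∑∈-swap (others? j) (B? j) R? (λ _ → F))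
                 (trans (∑∈-cong (B? j) (B? j) (λ _ p → p) (λ _ p → p)
                   (λ { b ((_ , b≢ε) , k , k≢j , b∈A) → trans (∑∈-const (col (others? j) (B? j) R? b) (λ _ _ → refl)
                          (#-unique (col (others? j) (B? j) R? b) ((tt , k≢j) , b∈A) (λ { l (_ , q) → A∩A q b∈A b≢ε }))) (ℤ.*-identityˡ _) }))
                   (B-sum j z))) ⟩
          ℤ.+ t ℤ.* K j z ℤ.+ 0ℤ
            ≡⟨ ℤ.+-identityʳ _ ⟩
          ℤ.+ t ℤ.* K j z ∎

      m : ℤ
      m = ℤ.+ t ℤ.* (ℤ.+ s ℤ.+ ℤ.+ t)

      ΣK-convolve : ∀ z → ∑ (λ v → ΣK v ℤ.* ΣK (v ⁻¹ ∙ z)) ≡ m ℤ.* ΣK z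
      ΣK-convolve z = begin
        ∑ (λ v → ΣK v ℤ.* ΣK (v ⁻¹ ∙ z))
          ≡⟨ ∑-cong (λ v → trans (ℤ.*-comm (ΣK v) (ΣK (v ⁻¹ ∙ z))) (sym (∑-*ˡ (ΣK (v ⁻¹ ∙ z)) (λ k → K k v)))) ⟩
        ∑ (λ v → ∑ (λ k → ΣK (v ⁻¹ ∙ z) ℤ.* K k v))
          ≡⟨ ∑-swap (λ v k → ΣK (v ⁻¹ ∙ z) ℤ.* K k v) ⟩
        ∑ (λ k → ∑ (λ v → ΣK (v ⁻¹ ∙ z) ℤ.* K k v))
          ≡⟨ ∑-cong (λ k → trans (∑-cong (λ v → ℤ.*-comm (ΣK (v ⁻¹ ∙ z)) (K k v))) (convolve k ΣK ΣK-left z)) ⟩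
        ∑ (λ k → ℤ.+ t ℤ.* ∑∈ (mem? (A k)) (λ b → ΣK (b ∙ z)))
          ≡⟨ ∑-*ˡ (ℤ.+ t) (λ k → ∑∈ (mem? (A k)) (λ b → ΣK (b ∙ z))) ⟩
        ℤ.+ t ℤ.* ∑ (λ k → ∑∈ (mem? (A k)) (λ b → ΣK (b ∙ z)))
          ≡⟨ cong (ℤ.+ t ℤ.*_) (trans (∑-cong (λ k → exchange k)) (trans (∑-swap (λ k j → ∑∈ (mem? (A k)) (λ b → K j (b ∙ z))))
               (trans (∑-cong (λ j → T-eigen j z)) (∑-*ˡ (ℤ.+ s ℤ.+ ℤ.+ t) (λ j → K j z))))) ⟩
        ℤ.+ t ℤ.* ((ℤ.+ s ℤ.+ ℤ.+ t) ℤ.* ΣK z)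
          ≡⟨ sym (ℤ.*-assoc (ℤ.+ t) (ℤ.+ s ℤ.+ ℤ.+ t) (ΣK z)) ⟩
        m ℤ.* ΣK z ∎
        where
        open ≡-Reasoning
        exchange : ∀ k → ∑∈ (mem? (A k)) (λ b → ΣK (b ∙ z)) ≡ ∑ (λ j → ∑∈ (mem? (A k)) (λ b → K j (b ∙ z)))
        exchange k = trans (∑-cong (λ b → on-∑ (mem? (A k) b) b)) (∑-swap (λ b j → on (mem? (A k) b) (K j (b ∙ z))))
          where
          on-∑ : ∀ {P : Set} (d : Dec P) b → on d (∑ (λ j → K j (b ∙ z))) ≡ ∑ (λ j → on d (K j (b ∙ z)))
          on-∑ (yes _) b = refl
          on-∑ (no _)  b = sym (∑-zero {suc t} (λ _ → refl))

      K′ : H → ℤ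
      K′ v = ΣK v ℤ.- ΣK (a ∙ v)

      a-swap : ∀ v → ΣK (a ∙ v) ≡ ΣK (v ∙ a)
      a-swap v = trans (cong ΣK (solve (a ∷ v ∷ []) (x₀ ⊙ x₁) (x₁ ⊙ x₀ ⊙ (inv (x₁ ⊙ x₀) ⊙ (x₀ ⊙ x₁))) refl)) (ΣK-right (v ∙ a) (⟨⟩-sym N ([a] v)))

      aa : ∀ v → a ∙ (a ∙ v) ≡ v
      aa v = trans (sym (assoc a a v)) (trans (cong (_∙ v) a²≡ε) (identityˡ v))

      a⁻¹ : a ⁻¹ ≡ a
      a⁻¹ = trans (sym (identityʳ (a ⁻¹))) (trans (cong (a ⁻¹ ∙_) (sym a²≡ε)) (solve (a ∷ []) (inv x₀ ⊙ (x₀ ⊙ x₀)) x₀ refl))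

      shifted-convolve : ∀ z → ∑ (λ v → ΣK (a ∙ v) ℤ.* ΣK (v ⁻¹ ∙ z)) ≡ m ℤ.* ΣK (a ∙ z)
      shifted-convolve z = trans (sym (∑-reindex (λ v → ΣK (a ∙ v) ℤ.* ΣK (v ⁻¹ ∙ z)) (a ∙_) (a ∙_) aa aa))
        (trans (∑-cong (λ v → cong₂ ℤ._*_ (cong ΣK (aa v)) (cong ΣK (trans (cong (λ y → y ∙ z) (trans (solve (a ∷ v ∷ []) (inv (x₀ ⊙ x₁)) (inv x₁ ⊙ inv x₀) refl) (cong (v ⁻¹ ∙_) a⁻¹))) (assoc _ _ _)))))
               (ΣK-convolve (a ∙ z)))

      K′-convolve : ∀ z → ∑ (λ v → K′ v ℤ.* K′ (v ⁻¹ ∙ z)) ≡ (m ℤ.+ m) ℤ.* K′ z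
      K′-convolve z = begin
        ∑ (λ v → K′ v ℤ.* K′ (v ⁻¹ ∙ z))
          ≡⟨ ∑-cong (λ v → trans (cong (λ y → K′ v ℤ.* (ΣK (v ⁻¹ ∙ z) ℤ.- y)) (trans (a-swap (v ⁻¹ ∙ z)) (cong ΣK (assoc (v ⁻¹) z a))))
               (expand (ΣK v) (ΣK (a ∙ v)) (ΣK (v ⁻¹ ∙ z)) (ΣK (v ⁻¹ ∙ (z ∙ a))))) ⟩
        ∑ (λ v → (P v ℤ.+ -1ℤ ℤ.* Q v) ℤ.+ (-1ℤ ℤ.* P′ v ℤ.+ Q′ v))
          ≡⟨ trans (∑-+ {n} _ _) (cong₂ ℤ._+_ (∑-+ {n} _ _) (∑-+ {n} _ _)) ⟩
        (∑ P ℤ.+ ∑ (λ v → -1ℤ ℤ.* Q v)) ℤ.+ (∑ (λ v → -1ℤ ℤ.* P′ v) ℤ.+ ∑ Q′)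
          ≡⟨ cong₂ ℤ._+_ (cong₂ ℤ._+_ (ΣK-convolve z) (trans (∑-*ˡ -1ℤ Q) (cong (ℤ._*_ -1ℤ) (shifted-convolve z))))
                         (cong₂ ℤ._+_ (trans (∑-*ˡ -1ℤ P′) (cong (ℤ._*_ -1ℤ) (trans (ΣK-convolve (z ∙ a)) (cong (m ℤ.*_) (sym (a-swap z))))))
                                      (trans (shifted-convolve (z ∙ a)) (cong (m ℤ.*_) (trans (cong ΣK (sym (assoc a z a))) (trans (sym (a-swap (a ∙ z))) (cong ΣK (aa z))))))) ⟩
        (m ℤ.* ΣK z ℤ.+ -1ℤ ℤ.* (m ℤ.* ΣK (a ∙ z))) ℤ.+ (-1ℤ ℤ.* (m ℤ.* ΣK (a ∙ z)) ℤ.+ m ℤ.* ΣK z)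
          ≡⟨ collect m (ΣK z) (ΣK (a ∙ z)) ⟩
        (m ℤ.+ m) ℤ.* K′ z ∎
        where
        open ≡-Reasoning
        P Q P′ Q′ : H → ℤ
        P v = ΣK v ℤ.* ΣK (v ⁻¹ ∙ z)
        Q v = ΣK (a ∙ v) ℤ.* ΣK (v ⁻¹ ∙ z)
        P′ v = ΣK v ℤ.* ΣK (v ⁻¹ ∙ (z ∙ a))
        Q′ v = ΣK (a ∙ v) ℤ.* ΣK (v ⁻¹ ∙ (z ∙ a))
        expand : ∀ p q r s → (p ℤ.- q) ℤ.* (r ℤ.- s) ≡ (p ℤ.* r ℤ.+ -1ℤ ℤ.* (q ℤ.* r)) ℤ.+ (-1ℤ ℤ.* (p ℤ.* s) ℤ.+ q ℤ.* s)
        expand = solve-∀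
        collect : ∀ m p q → (m ℤ.* p ℤ.+ -1ℤ ℤ.* (m ℤ.* q)) ℤ.+ (-1ℤ ℤ.* (m ℤ.* q) ℤ.+ m ℤ.* p) ≡ (m ℤ.+ m) ℤ.* (p ℤ.- q)
        collect = solve-∀

      ΣK-ε : ΣK ε ≡ ℤ.+ suc t
      ΣK-ε = trans (sym (∑∈-all (whole {suc t}) {λ j → K j ε} (λ _ → tt))) (trans (∑∈-const (whole {suc t}) {λ j → K j ε} {c = 1ℤ} (λ j _ → trans (cong (K j) (sym (identityˡ ε))) (trans (K-value j (ε∈ (A j)) (ε∈ S)) (χ-N (ε∈ N))))
        (#-whole {suc t})) (ℤ.*-identityʳ _))

      ΣK-a : ΣK (a ∙ ε) ≡ 1ℤ
      ΣK-a = trans (sym (∑∈-all (whole {suc t}) {λ j → K j (a ∙ ε)} (λ _ → tt))) (trans (∑∈-remove whole (λ j → K j (a ∙ ε)) {i} tt)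
        (cong₂ ℤ._+_ (trans (K-value i a∈A (ε∈ S)) (χ-N (ε∈ N)))
          (trans (∑∈-const (others? i) {c = 0ℤ} (λ { j (_ , j≢i) → K-outside j (λ p → a≢ε (A∩A* (λ e → j≢i (sym e)) a∈A (≡∈ (A* j) (identityʳ a) p))) }) (∣others∣ i)) (ℤ.*-zeroʳ (ℤ.+ t)))))

      -- `ε` lies in all `t + 1` groups `A* j`, but `a` only in `A* i`.
      K′-ε : K′ ε ≡ ℤ.+ t
      K′-ε = cong₂ ℤ._-_ ΣK-ε ΣK-a

      -- The matrix of convolution with `K′` on functions on the group.
      M : H → H → ℤ
      M u h = K′ (u ⁻¹ ∙ h)

      M-scaled : Scaled-Idempotent M (m ℤ.+ m)
      M-scaled u w = trans (sym (∑-reindex (λ h → K′ (u ⁻¹ ∙ h) ℤ.* K′ (h ⁻¹ ∙ w)) (u ∙_) (u ⁻¹ ∙_)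
           (λ x → solve (u ∷ x ∷ []) (inv x₀ ⊙ (x₀ ⊙ x₁)) x₁ refl) (λ x → solve (u ∷ x ∷ []) (x₀ ⊙ (inv x₀ ⊙ x₁)) x₁ refl)))
        (trans (∑-cong (λ v → cong₂ ℤ._*_ (cong K′ (solve (u ∷ v ∷ []) (inv x₀ ⊙ (x₀ ⊙ x₁)) x₁ refl)) (cong K′ (solve (u ∷ v ∷ w ∷ []) (inv (x₀ ⊙ x₁) ⊙ x₂) (inv x₁ ⊙ (inv x₀ ⊙ x₂)) refl))))
               (K′-convolve (u ⁻¹ ∙ w)))

      trace-M : trace M ≡ ℤ.+ n ℤ.* ℤ.+ t
      trace-M = trans (sym (∑∈-all (whole {n}) {λ u → M u u} (λ _ → tt))) (∑∈-const (whole {n}) {λ u → M u u} (λ u _ → trans (cong K′ (inverseˡ u)) K′-ε) (#-whole {n}))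

      m≡ : m ≡ ℤ.+ (t * (s + t))
      m≡ = trans (cong (ℤ.+ t ℤ.*_) (sym (ℤ.pos-+ s t))) (sym (ℤ.pos-* t (s + t)))

      2m≡ : m ℤ.+ m ≡ ℤ.+ (t * (s + t) + t * (s + t))
      2m≡ = trans (cong₂ ℤ._+_ m≡ m≡) (sym (ℤ.pos-+ (t * (s + t)) (t * (s + t))))

      s+t∣nt : s + t ∣ n * t
      s+t∣nt = ∣-trans (∣m∣n⇒∣m+n (n∣m*n t) (n∣m*n t)) (ℤ.∣⇒∣ᵤ
        (subst₂ ℤ._∣_ 2m≡ (trans trace-M (sym (ℤ.pos-* n t))) (∣trace M (m ℤ.+ m) (λ e → m>0 (ℤ.+-injective (trans (sym 2m≡) e))) M-scaled)))
        where
        m>0 : t * (s + t) + t * (s + t) ≢ 0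
        m>0 e = contradiction (m*n≡0⇒m≡0∨n≡0 t (m+n≡0⇒m≡0 _ e)) (λ { (inj₁ refl) → contradiction 2≤t λ () ; (inj₂ e′) → contradiction (subst (2 ≤_) (m+n≡0⇒m≡0 s e′) 2≤s) λ () })

-- Commutators fill the symmetry group: all cases

prime-2 : Prime 2
prime-2 = from-yes (prime? 2)

module CommutatorsFill {n s t} {𝔾 : FinGroup n} (𝕂 : Kantor 𝔾 s t) (odd : s ≡ t → ¬ 2 ∣ t) where
  open FinGroupTheory 𝔾
  open GroupActions 𝔾
  open NormalSubgroups 𝔾
  open KantorTheory 𝕂
  open CommutatorImage 𝕂
  open CommutatorImageEven 𝕂

  module Even (2∣t : 2 ∣ t) (e f : ℕ) (n≡2^e : n ≡ 2 ^ e) (s≡2^f : s ≡ 2 ^ f) where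

    t∣2^e : t ∣ 2 ^ e
    t∣2^e = subst (t ∣_) (trans (sym n≡sst) n≡2^e) (∣n⇒∣m*n s (n∣m*n s))

    module _ {i a N} (hyp : Hyp i a N) {x} (x∈S : x ∈ S) (x∉N : ¬ x ∈ N) where
      open Hyp hyp

      N<t : ∣ N ∣ < t
      N<t = ≤∧≢⇒< (subst (∣ N ∣ ≤_) ∣S∣ (⊆⇒≤ N S N⊆S))
        (λ eq → x∉N (#-full (mem? N) (mem? S) (λ _ → N⊆S) (≤-reflexive (trans ∣S∣ (sym eq))) x x∈S))

      2N∣S : 2 * ∣ N ∣ ∣ ∣ S ∣
      2N∣S = from (lagrange N S N⊆S)
        where
        from : ∣ N ∣ ∣ ∣ S ∣ → 2 * ∣ N ∣ ∣ ∣ S ∣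
        from (divides q eq) = by (∣prime-power prime-2 e (∣-trans (divides ∣ N ∣ (trans (sym ∣S∣) (trans eq (*-comm q _)))) t∣2^e))
          where
          by : q ≡ 1 ⊎ 2 ∣ q → 2 * ∣ N ∣ ∣ ∣ S ∣
          by (inj₁ refl) = contradiction N<t (<⇒≱ (s≤s (≤-reflexive (trans (sym ∣S∣) (trans eq (*-identityˡ _))))))
          by (inj₂ d) = subst (2 * ∣ N ∣ ∣_) (sym eq) (*-monoˡ-∣ ∣ N ∣ d)

      half-step : ∃ λ z → z ∈ S × ¬ z ∈ N × pow z 2 ∈ N
      half-step = cauchy prime-2 ∣ S ∣ N S (m≤n+m _ _) N⊆S (λ {y} _ q → [S] y q) 2N∣S

    -- While the index of `N` in `S` exceeds 2, an element whose square lies in `N` is adjoined; the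
    -- conditions of `Hyp` survive enlarging `N` inside `S`.
    extend : ∀ k {i a N} → Hyp i a N → ∀ {x} → x ∈ S → ¬ x ∈ N → t ≤ ∣ N ∣ + k → ∃ λ N′ → Hyp i a N′ × ∣ N′ ∣ + ∣ N′ ∣ ≡ t
    extend k {i} {a} {N} hyp {x} x∈S x∉N le = from k le (half-step hyp x∈S x∉N)
      where
      open Hyp hyp
      from : ∀ k → t ≤ ∣ N ∣ + k → (∃ λ z → z ∈ S × ¬ z ∈ N × pow z 2 ∈ N) → ∃ λ N′ → Hyp i a N′ × ∣ N′ ∣ + ∣ N′ ∣ ≡ t
      from zero le _ = contradiction (N<t hyp x∈S x∉N) (≤⇒≯ (≤-trans le (≤-reflexive (+-identityʳ _))))
      from (suc k) le (z , z∈S , z∉N , z²∈N) = by (⊆-dec S adjoin)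
        where
        open Adjoin N z (λ d∈N → [S] z (N⊆S d∈N))
        order≡2 : order ≡ 2
        order≡2 with prime⇒irreducible prime-2 (order-∣ 2 z²∈N)
        ... | inj₁ o≡1 = contradiction (≡∈ N (trans (cong (pow z) o≡1) (pow-1 z)) pow-order) z∉N
        ... | inj₂ o≡2 = o≡2
        size : ∣ adjoin ∣ ≡ ∣ N ∣ + ∣ N ∣
        size = trans ∣adjoin∣ (trans (cong (_* ∣ N ∣) order≡2) (cong (∣ N ∣ +_) (+-identityʳ _)))
        adjoin⊆S : adjoin ⊆ S
        adjoin⊆S = adjoin⊆ {S} N⊆S z∈S
        hyp′ : Hyp i a adjoin
        hyp′ = record { a∈A = a∈A ; a≢ε = a≢ε ; N⊆S = adjoin⊆S ; [S] = λ h p → D⊆adjoin ([S] h p) ; [a] = λ h → D⊆adjoin ([a] h) }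
        by : (S ⊆ adjoin) ⊎ (∃ λ y → y ∈ S × ¬ y ∈ adjoin) → ∃ λ N′ → Hyp i a N′ × ∣ N′ ∣ + ∣ N′ ∣ ≡ t
        by (inj₁ S⊆) = N , hyp , trans (sym size) (trans (#-cong (mem? adjoin) (mem? S) (λ _ → adjoin⊆S) (λ _ → S⊆)) ∣S∣)
        by (inj₂ (y , y∈S , y∉)) = extend k hyp′ y∈S y∉ (≤-trans le (≤-trans (≤-reflexive (+-suc ∣ N ∣ k))
          (+-monoˡ-≤ k (≤-trans (≤-reflexive (sym (+-comm ∣ N ∣ 1))) (≤-trans (+-monoʳ-≤ ∣ N ∣ (∣G∣≥1 N)) (≤-reflexive (sym size)))))))

    -- The elements of `A i` that are central modulo `N` form a 2-group, nontrivial because of `a`,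
    -- and any involution in it can replace `a`.
    involution : ∀ {i a N} → Hyp i a N → ∃ λ a′ → Hyp i a′ N × a′ ∙ a′ ≡ ε
    involution {i} {a} {N} hyp = from (cauchy prime-2 ∣ Z ∣ trivial Z (m≤n+m _ _) (λ { refl → ε∈ Z })
        (λ { (_ , p) (_ , q) → A-abelian i p q }) (subst (_∣ ∣ Z ∣) (sym (cong (2 *_) ∣trivial∣)) 2∣Z))
      where
      open Hyp hyp
      open Modulo N N-normal using (centre)
      Z : Subgroup
      Z = centre ∩ A i
      2∣Z : 2 ∣ ∣ Z ∣
      2∣Z = by (∣prime-power prime-2 f (subst (∣ Z ∣ ∣_) (trans (∣A∣ i) s≡2^f) (lagrange Z (A i) proj₂)))
        where
        by : ∣ Z ∣ ≡ 1 ⊎ 2 ∣ ∣ Z ∣ → 2 ∣ ∣ Z ∣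
        by (inj₂ d) = d
        by (inj₁ e) = contradiction (#-full (mem? trivial) (mem? Z) (λ { _ refl → ε∈ Z }) (≤-reflexive (trans e (sym ∣trivial∣))) a ([a] , a∈A)) a≢ε
      from : (∃ λ z → z ∈ Z × z ≢ ε × pow z 2 ≡ ε) → ∃ λ a′ → Hyp i a′ N × a′ ∙ a′ ≡ ε
      from (z , (zC , zA) , z≢ε , z²) = z , record { a∈A = zA ; a≢ε = z≢ε ; N⊆S = N⊆S ; [S] = [S] ; [a] = zC } , trans (cong (z ∙_) (sym (identityʳ z))) z²

    -- As a divisor of a power of 2, `s + t` would be one itself, but `2 ^ f + t` with
    -- `0 < t < 2 ^ f` lies strictly between two successive powers.
    absurd : t < s → ∀ {i a N} → Hyp i a N → ∀ {x} → x ∈ S → ¬ x ∈ N → ⊥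
    absurd t<s hyp x∈S x∉N = from (extend t hyp x∈S x∉N (m≤n+m t _))
      where
      instance
        t≢0 : NonZero t
        t≢0 = >-nonZero (≤-trans (s≤s z≤n) 2≤t)
        s+t≢0 : NonZero (s + t)
        s+t≢0 = >-nonZero (≤-trans (≤-trans (s≤s z≤n) 2≤s) (m≤m+n s t))
      power : s + t ∣ n * t → ⊥
      power d with divisor-of-power prime-2 e t t∣2^e
      ... | j , t≡2^j with divisor-of-power prime-2 (e + j) (s + t) (subst (s + t ∣_) (trans (cong₂ _*_ n≡2^e t≡2^j) (sym (^-distribˡ-+-* 2 e j))) d)
      ...   | g , eq = no-power-between {f} {g} (≤-trans (s≤s z≤n) 2≤t) (subst (t <_) s≡2^f t<s) (trans (cong (_+ t) (sym s≡2^f)) eq)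
      from : ∀ {i a} → (∃ λ N′ → Hyp i a N′ × ∣ N′ ∣ + ∣ N′ ∣ ≡ t) → ⊥
      from (N′ , hyp′ , 2N) = finish (involution hyp′)
        where
        missing : ∃ λ c → c ∈ S × ¬ c ∈ N′
        missing = by (⊆-dec S N′)
          where
          by : (S ⊆ N′) ⊎ (∃ λ c → c ∈ S × ¬ c ∈ N′) → ∃ λ c → c ∈ S × ¬ c ∈ N′
          by (inj₂ w) = w
          by (inj₁ h) = contradiction (≤-trans (+-monoˡ-≤ ∣ N′ ∣ (∣G∣≥1 N′)) (≤-trans (≤-reflexive (trans 2N (sym ∣S∣))) (⊆⇒≤ S N′ h))) (<⇒≱ (n<1+n _))
        finish : (∃ λ a′ → Hyp _ a′ N′ × a′ ∙ a′ ≡ ε) → ⊥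
        finish (a′ , hyp″ , a²) = power (Index2.s+t∣nt hyp″ a² 2N (proj₁ (proj₂ missing)) (proj₂ (proj₂ missing)))

  commutators-fill : ∀ {i a N} → Hyp i a N → S ⊆ N
  commutators-fill {N = N} hyp {x} x∈S = by (2 ∣? t) (mem? N x) (prime-power 𝕂)
    where
    even : PrimePower 𝕂 → 2 ∣ t → ¬ x ∈ N → ⊥
    even pp 2∣t x∉N = go (prime∣prime-power prime-2 prime exponent (∣-trans 2∣t
        (subst (t ∣_) (trans (sym n≡sst) n≡p^) (∣n⇒∣m*n s (n∣m*n s)))))
      where
      open PrimePower pp
      open Nilpotent (PrimePower.nilpotent pp)
      go : 2 ≡ p → ⊥
      -- For even `t` the hypothesis `odd` rules out `s = t`, which makes `t ≤ s` strict.
      go refl = Even.absurd 2∣t exponent (proj₁ s-power) n≡p^ (proj₂ s-power) (≤∧≢⇒< t≤s (λ t≡s → odd (sym t≡s) 2∣t)) hyp x∈S x∉N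
    by : Dec (2 ∣ t) → Dec (x ∈ N) → PrimePower 𝕂 → x ∈ N
    by _ (yes p) _ = p
    by (no t-odd) (no _) _ = commutators-fill-odd t-odd hyp x∈S
    by (yes 2∣t) (no ¬p) pp = ⊥-elim (even pp 2∣t ¬p)

-- Centrality of S and the order of centralisers

module CentralSymmetries {n s t} {𝔾 : FinGroup n} (𝕂 : Kantor 𝔾 s t) (odd : s ≡ t → ¬ 2 ∣ t) where
  open FinGroupTheory 𝔾
  open GroupActions 𝔾
  open NormalSubgroups 𝔾
  open KantorTheory 𝕂
  open CommutatorImage 𝕂 using (Hyp)
  open CommutatorsFill 𝕂 odd

  decompose : ∀ {i j} h → i ≢ j → ∃ λ a → ∃ λ b → ∃ λ σ → a ∈ A i × b ∈ A j × σ ∈ S × h ≡ a ∙ b ∙ σ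
  decompose {i} {j} h i≢j = by (prod h i≢j)
    where
    by : (∃ λ a → a ∈ A i × a ⁻¹ ∙ h ∈ A* j) → ∃ λ a → ∃ λ b → ∃ λ σ → a ∈ A i × b ∈ A j × σ ∈ S × h ≡ a ∙ b ∙ σ
    by (a , a∈A , q) = with-split (split j q)
      where
      with-split : (∃ λ σ → σ ∈ S × a ⁻¹ ∙ h ∙ σ ⁻¹ ∈ A j) → ∃ λ a → ∃ λ b → ∃ λ σ → a ∈ A i × b ∈ A j × σ ∈ S × h ≡ a ∙ b ∙ σ
      with-split (σ , σ∈S , p) = a , a ⁻¹ ∙ h ∙ σ ⁻¹ , σ , a∈A , p , σ∈S , solve (a ∷ h ∷ σ ∷ []) x₁ (x₀ ⊙ (inv x₀ ⊙ x₁ ⊙ inv x₂) ⊙ x₂) refl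

  -- One factor of the central chain: the commutators of `S` are pushed from `M′` down to `M`.
  -- Modulo `W = S ∩ M`, the group `U = S ∩ M′` is central and contains all of them.
  module Descend (M M′ : Subgroup) (M-normal : Normal M) (M′-normal : Normal M′)
                 (central : ∀ h {x} → x ∈ M′ → ⟨ h , x ⟩ ∈ M) (hyp : ∀ h {σ} → σ ∈ S → ⟨ h , σ ⟩ ∈ M′) where
    U W : Subgroup
    U = S ∩ M′
    W = S ∩ M

    open Modulo W (∩-normal S M S-normal M-normal)

    U-normal : Normal U
    U-normal = ∩-normal S M′ S-normal M′-normal

    U-central : ∀ h {u} → u ∈ U → ⟨ h , u ⟩ ∈ W
    U-central h (p , q) = normal-⟨⟩ S S-normal h p , central h q

    [S]⊆U : ∀ h {σ} → σ ∈ S → ⟨ h , σ ⟩ ∈ U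
    [S]⊆U h p = normal-⟨⟩ S S-normal h p , hyp h p

    -- The elements of `S` commuting with `x` modulo `W` form a subgroup that contains the
    -- commutators of `S` and those of `a`, hence all of `S`.
    fill : ∀ {i a} → a ∈ A i → a ≢ ε → ∀ x → (∀ {u} → u ∈ U → ⟨ x , u ⟩ ∈ W) → (∀ h → ⟨ x , ⟨ a , h ⟩ ⟩ ∈ W) →
           ∀ {σ} → σ ∈ S → ⟨ x , σ ⟩ ∈ W
    fill {i} {a} a∈A a≢ε x U⊆ [a]⊆ p = proj₂ (commutators-fill {N = S ∩ centraliser x} record
      { a∈A = a∈A ; a≢ε = a≢ε ; N⊆S = proj₁
      ; [S] = λ h q → proj₁ ([S]⊆U h q) , U⊆ ([S]⊆U h q)
      ; [a] = λ h → commutator∈S a h , [a]⊆ h } p)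

    module _ (2≤U : 2 ≤ ∣ U ∣) (i : Fin (suc t)) where

      j : Fin (suc t)
      j = proj₁ (others i)
      j≢i : j ≢ i
      j≢i = proj₁ (proj₂ (proj₂ (others i)))

      d : H
      d = proj₁ (nontrivial j)
      d∈A : d ∈ A j
      d∈A = proj₁ (proj₂ (nontrivial j))
      d≢ε : d ≢ ε
      d≢ε = proj₂ (proj₂ (nontrivial j))

      Good : H → Set
      Good a = (a ∈ A i × a ≢ ε) × ⟨ d , a ⟩ ∈ U

      -- ∣A i∣ ∣U∣ > ∣S∣, so two cosets ⟨ d , a ⟩ U meet
      good : ∃ Good
      good = by (any? (λ a → A∖ε? i a ×-dec mem? U ⟨ d , a ⟩))
        where
        R? : ∀ a σ → Dec (⟨ d , a ⟩ ⁻¹ ∙ σ ∈ U)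
        R? a σ = mem? U (⟨ d , a ⟩ ⁻¹ ∙ σ)
        by : Dec (∃ Good) → ∃ Good
        by (yes w) = w
        by (no ¬w) = contradiction (≤-trans (*-monoˡ-≤ s 2≤U) (≤-trans count t≤s)) (<⇒≱ (m<m+n s {s + 0} (≤-trans (≤-trans (s≤s z≤n) 2≤s) (≤-reflexive (sym (+-identityʳ s))))))
          where
          same : ∀ σ a b → a ∈ A i → b ∈ A i → ⟨ d , a ⟩ ⁻¹ ∙ σ ∈ U → ⟨ d , b ⟩ ⁻¹ ∙ σ ∈ U → Dec (a ≡ b) → a ≡ b
          same σ a b p q u v (yes e) = e
          same σ a b p q u v (no ne) = contradiction (a ∙ b ⁻¹ , (∙∈ (A i) p (⁻¹∈ (A i) q) , λ e → ne (trans (solve (a ∷ b ∷ []) x₀ (x₀ ⊙ inv x₁ ⊙ x₁) refl) (trans (cong (_∙ b) e) (identityˡ b)))) ,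
              ≡∈ U (solve (d ∷ a ∷ b ∷ []) (x₂ ⊙ (inv (x₀ ⊙ x₁) ⊙ (x₁ ⊙ x₀) ⊙ inv (inv (x₀ ⊙ x₂) ⊙ (x₂ ⊙ x₀))) ⊙ inv x₂) (inv (x₀ ⊙ (x₁ ⊙ inv x₂)) ⊙ (x₁ ⊙ inv x₂ ⊙ x₀)) refl)
                (conj⁻¹ U U-normal b quotient∈U)) ¬w
            where
            κ = ⟨ d , a ⟩
            λ′ = ⟨ d , b ⟩
            quotient∈U : κ ∙ λ′ ⁻¹ ∈ U
            quotient∈U = ≡∈ U (solve (κ ∷ λ′ ∷ []) (x₀ ⊙ (inv x₁ ⊙ x₀) ⊙ inv x₀) (x₀ ⊙ inv x₁) refl)
              (conj⁻¹ U U-normal κ (coset-trans U v (coset-sym U u)))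
          count : ∣ U ∣ * s ≤ t
          count = subst₂ _≤_ (cong (∣ U ∣ *_) (∣A∣ i)) (trans (*-identityˡ _) ∣S∣) (double-≤ (mem? (A i)) (mem? S) R? ∣ U ∣ 1
            (λ a _ → ≤-trans (≤-reflexive (sym (#-translateˡ (mem? U) (⟨ d , a ⟩ ⁻¹))))
               (#-mono (λ σ → mem? U (⟨ d , a ⟩ ⁻¹ ∙ σ)) (row (mem? (A i)) (mem? S) R? a)
                 (λ σ q → ∈-cancelˡ S (⁻¹∈ S (commutator∈S d a)) (proj₁ q) , q)))
            (λ σ _ → #-! (col (mem? (A i)) (mem? S) R? σ) (λ { a b (p , u) (q , v) → same σ a b p q u v (a ≟ b) })))

      a : H
      a = proj₁ good
      a∈A : a ∈ A i
      a∈A = proj₁ (proj₁ (proj₂ good))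
      a≢ε : a ≢ ε
      a≢ε = proj₂ (proj₁ (proj₂ good))

      A-comm : ∀ {k x y} → x ∈ A k → y ∈ A k → ⟨ x , y ⟩ ∈ W
      A-comm p q = ≡∈ W (sym (A-abelian _ p q)) (ε∈ W)

      -- In `h = e c τ` the factor `e` commutes with `d`, and `τ` contributes only elements of the
      -- central `U`. The factor `c` commutes with `a`, and since `⟨ d , a ⟩` is central modulo `W`,
      -- `comm-⟨⟩-of-central` applies.
      a-⟨d,⟩ : ∀ h → ⟨ a , ⟨ d , h ⟩ ⟩ ∈ W
      a-⟨d,⟩ h = by (decompose h j≢i)
        where
        by : (∃ λ e → ∃ λ c → ∃ λ τ → e ∈ A j × c ∈ A i × τ ∈ S × h ≡ e ∙ c ∙ τ) → ⟨ a , ⟨ d , h ⟩ ⟩ ∈ W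
        by (e , c , τ , e∈A , c∈A , τ∈S , refl) = subst (λ z → ⟨ a , z ⟩ ∈ W) (sym expand)
          (Comm-∙ {a} {⟨ d , c ⟩ ∙ ⟨ τ , ⟨ d , c ⟩ ⟩} {⟨ d , τ ⟩}
            (Comm-∙ {a} {⟨ d , c ⟩} {⟨ τ , ⟨ d , c ⟩ ⟩}
              (comm-⟨⟩-of-central {a} {c} {d} (A-comm a∈A c∈A) (λ y → U-central y (proj₂ (proj₂ good))))
              (U-central a ([S]⊆U τ (commutator∈S d c))))
            (U-central a ([S]⊆U d τ∈S)))
          where
          expand : ⟨ d , e ∙ c ∙ τ ⟩ ≡ ⟨ d , c ⟩ ∙ ⟨ τ , ⟨ d , c ⟩ ⟩ ∙ ⟨ d , τ ⟩
          expand = begin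
            ⟨ d , e ∙ c ∙ τ ⟩
              ≡⟨ solve (d ∷ e ∷ c ∷ τ ∷ []) (inv (x₀ ⊙ (x₁ ⊙ x₂ ⊙ x₃)) ⊙ (x₁ ⊙ x₂ ⊙ x₃ ⊙ x₀))
                   (inv (x₂ ⊙ x₃) ⊙ (inv (x₀ ⊙ x₁) ⊙ (x₁ ⊙ x₀)) ⊙ inv x₀ ⊙ (x₂ ⊙ x₃ ⊙ x₀)) refl ⟩
              (c ∙ τ) ⁻¹ ∙ ⟨ d , e ⟩ ∙ d ⁻¹ ∙ (c ∙ τ ∙ d)
              ≡⟨ cong (λ z → (c ∙ τ) ⁻¹ ∙ z ∙ d ⁻¹ ∙ (c ∙ τ ∙ d)) (A-abelian j d∈A e∈A) ⟩
              (c ∙ τ) ⁻¹ ∙ ε ∙ d ⁻¹ ∙ (c ∙ τ ∙ d)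
              ≡⟨ solve (d ∷ c ∷ τ ∷ []) (inv (x₁ ⊙ x₂) ⊙ one ⊙ inv x₀ ⊙ (x₁ ⊙ x₂ ⊙ x₀))
                   (κ ⊙ (inv (x₂ ⊙ κ) ⊙ (κ ⊙ x₂)) ⊙ (inv (x₀ ⊙ x₂) ⊙ (x₂ ⊙ x₀))) refl ⟩
            ⟨ d , c ⟩ ∙ ⟨ τ , ⟨ d , c ⟩ ⟩ ∙ ⟨ d , τ ⟩ ∎
            where
            open ≡-Reasoning
            κ : Expr 3
            κ = inv (x₀ ⊙ x₁) ⊙ (x₁ ⊙ x₀)

      a-centralises-S : ∀ {σ} → σ ∈ S → ⟨ a , σ ⟩ ∈ W
      a-centralises-S = fill d∈A d≢ε a (U-central a) a-⟨d,⟩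

      ⟨a,⟩-centralised : ∀ x → (∀ h → ⟨ x , ⟨ h , a ⟩ ⟩ ∈ W) → ∀ h → ⟨ x , ⟨ a , h ⟩ ⟩ ∈ W
      ⟨a,⟩-centralised x c h = subst (λ z → ⟨ x , z ⟩ ∈ W) (solve (a ∷ h ∷ []) (inv (inv (x₁ ⊙ x₀) ⊙ (x₀ ⊙ x₁))) (inv (x₀ ⊙ x₁) ⊙ (x₁ ⊙ x₀)) refl)
        (Comm-⁻¹ {x} {⟨ h , a ⟩} (c h))

      -- `⟨ h , a ⟩` is `a ⁻¹` times a conjugate of `a`, and both centralise `S` modulo `W`; so
      -- every `τ ∈ S` commutes with the commutators of `a`, which fill `S`.
      S-abelian : ∀ {τ σ} → τ ∈ S → σ ∈ S → ⟨ τ , σ ⟩ ∈ W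
      S-abelian {τ} τ∈S = fill a∈A a≢ε τ (U-central τ) (⟨a,⟩-centralised τ (λ h →
        subst (λ z → ⟨ τ , z ⟩ ∈ W) (solve (a ∷ h ∷ []) (inv x₀ ⊙ (inv x₁ ⊙ x₀ ⊙ x₁)) (inv (x₁ ⊙ x₀) ⊙ (x₀ ⊙ x₁)) refl)
        (Comm-∙ {τ} {a ⁻¹} {h ⁻¹ ∙ a ∙ h} (Comm-⁻¹ {τ} {a} (⟨⟩-sym W (a-centralises-S τ∈S)))
          (⟨⟩-sym W (subst (λ z → ⟨ h ⁻¹ ∙ a ∙ h , z ⟩ ∈ W) (solve (τ ∷ h ∷ []) (inv x₁ ⊙ (x₁ ⊙ x₀ ⊙ inv x₁) ⊙ x₁) x₀ refl)
            (Comm-conj {a} {h ∙ τ ∙ h ⁻¹} h (a-centralises-S (conj⁻¹ S S-normal h τ∈S))))))))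

      -- Now that `a` centralises `S` and `S` is abelian modulo `W`, `comm-of-commuting-⟨⟩` makes
      -- `c` commute with all `⟨ h , a ⟩`.
      A-centralises-S : ∀ {c σ} → c ∈ A i → σ ∈ S → ⟨ c , σ ⟩ ∈ W
      A-centralises-S {c} c∈A = fill a∈A a≢ε c (U-central c) (⟨a,⟩-centralised c (λ h →
        comm-of-commuting-⟨⟩ {a} {c} {h} (A-comm a∈A c∈A) (a-centralises-S (commutator∈S h a)) (a-centralises-S (commutator∈S h c))
          (S-abelian (commutator∈S h a) (commutator∈S h c))))

    descend : ∀ h {σ} → σ ∈ S → ⟨ h , σ ⟩ ∈ M
    descend h {σ} σ∈S = by (2 ≤? ∣ U ∣)
      where
      by : Dec (2 ≤ ∣ U ∣) → ⟨ h , σ ⟩ ∈ M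
      -- If `U` is trivial, so are the commutators of `S`, which lie in it.
      by (no ¬2≤U) = ≡∈ M (sym (#-full (mem? trivial) (mem? U) (λ { _ refl → ε∈ U })
        (≤-trans (≤-pred (≰⇒> ¬2≤U)) (≤-reflexive (sym ∣trivial∣))) _ ([S]⊆U h σ∈S))) (ε∈ M)
      by (yes 2≤U) = proj₂ (⟨⟩-sym W (go (decompose h (proj₂ (proj₂ (proj₂ (proj₂ (others zero))))))))
        where
        go : ∀ {i j} → (∃ λ x → ∃ λ y → ∃ λ τ → x ∈ A i × y ∈ A j × τ ∈ S × h ≡ x ∙ y ∙ τ) → ⟨ σ , h ⟩ ∈ W
        go {i} {j} (x , y , τ , x∈A , y∈A , τ∈S , refl) = Comm-∙ {σ} {x ∙ y} {τ}
          (Comm-∙ {σ} {x} {y} (⟨⟩-sym W (A-centralises-S 2≤U i x∈A σ∈S)) (⟨⟩-sym W (A-centralises-S 2≤U j y∈A σ∈S)))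
          (S-abelian 2≤U i σ∈S τ∈S)

  descend-chain : ∀ {M} → CentralChain M → (∀ h {σ} → σ ∈ S → ⟨ h , σ ⟩ ∈ M) → ∀ h {σ} → σ ∈ S → ⟨ h , σ ⟩ ≡ ε
  descend-chain (base _ M⊆1) hyp h p = M⊆1 (hyp h p)
  descend-chain (step {M} {M′} ch N′ _ central) hyp = descend-chain ch (Descend.descend M M′ (chain-normal ch) N′ central hyp)

  S-central : ∀ h {σ} → σ ∈ S → ⟨ h , σ ⟩ ≡ ε
  S-central = descend-chain chain (λ h _ → full⊆top tt)
    where open Nilpotent (PrimePower.nilpotent (prime-power 𝕂))

  ⟨⟩≡ε⇒comm : ∀ {x y} → ⟨ x , y ⟩ ≡ ε → x ∙ y ≡ y ∙ x
  ⟨⟩≡ε⇒comm {x} {y} h = trans (sym (identityʳ _)) (trans (cong (x ∙ y ∙_) (sym h)) (solve (x ∷ y ∷ []) (x₀ ⊙ x₁ ⊙ (inv (x₀ ⊙ x₁) ⊙ (x₁ ⊙ x₀))) (x₁ ⊙ x₀) refl))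

  comm⇒⟨⟩≡ε : ∀ {x y} → x ∙ y ≡ y ∙ x → ⟨ x , y ⟩ ≡ ε
  comm⇒⟨⟩≡ε {x} {y} h = trans (cong ((x ∙ y) ⁻¹ ∙_) (sym h)) (inverseˡ _)

  -- The correction term is a commutator with an element of `S`, which is now central.
  ⟨⟩-∙ : ∀ a g h → ⟨ a , g ∙ h ⟩ ≡ ⟨ a , g ⟩ ∙ ⟨ a , h ⟩
  ⟨⟩-∙ a g h = trans (solve (a ∷ g ∷ h ∷ []) (inv (x₀ ⊙ (x₁ ⊙ x₂)) ⊙ (x₁ ⊙ x₂ ⊙ x₀)) (κ ⊙ (inv (x₂ ⊙ κ) ⊙ (κ ⊙ x₂)) ⊙ (inv (x₀ ⊙ x₂) ⊙ (x₂ ⊙ x₀))) refl)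
    (cong (_∙ ⟨ a , h ⟩) (trans (cong (⟨ a , g ⟩ ∙_) (S-central h (commutator∈S a g))) (identityʳ _)))
    where
    κ : Expr 3
    κ = inv (x₀ ⊙ x₁) ⊙ (x₁ ⊙ x₀)

  ⟨⟩-ε : ∀ a → ⟨ a , ε ⟩ ≡ ε
  ⟨⟩-ε a = solve (a ∷ []) (inv (x₀ ⊙ one) ⊙ (one ⊙ x₀)) one refl

  ⟨⟩-⁻¹ : ∀ a h → ⟨ a , h ⁻¹ ⟩ ≡ ⟨ a , h ⟩ ⁻¹
  ⟨⟩-⁻¹ a h = trans (solve (⟨ a , h ⟩ ∷ ⟨ a , h ⁻¹ ⟩ ∷ []) x₁ (inv x₀ ⊙ (x₀ ⊙ x₁)) refl)
    (trans (cong (⟨ a , h ⟩ ⁻¹ ∙_) (trans (sym (⟨⟩-∙ a h (h ⁻¹))) (trans (cong ⟨ a ,_⟩ (inverseʳ h)) (⟨⟩-ε a)))) (identityʳ _))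

  -- Only since `⟨ a ,_⟩` is a homomorphism do its values form a subgroup, which can itself be taken
  -- for `N`.
  commutators-onto : ∀ {i a} → a ∈ A i → a ≢ ε → ∀ {σ} → σ ∈ S → ∃ λ h → ⟨ a , h ⟩ ≡ σ
  commutators-onto {i} {a} a∈A a≢ε σ∈S = proj₂ (commutators-fill {N = image} record
      { a∈A = a∈A ; a≢ε = a≢ε ; N⊆S = proj₁ ; [S] = λ h p → ≡∈ image (sym (S-central h p)) (ε∈ image)
      ; [a] = λ h → commutator∈S a h , h , refl } σ∈S)
    where
    image : Subgroup
    image = record
      { mem = λ σ → σ ∈ S × ∃ λ h → ⟨ a , h ⟩ ≡ σ ; mem? = λ σ → mem? S σ ×-dec any? (λ h → ⟨ a , h ⟩ ≟ σ)
      ; ε∈ = ε∈ S , ε , ⟨⟩-ε a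
      ; ∙∈ = λ { (p , g , refl) (q , h , refl) → ∙∈ S p q , g ∙ h , ⟨⟩-∙ a g h }
      ; ⁻¹∈ = λ { (p , h , refl) → ⁻¹∈ S p , h ⁻¹ , ⟨⟩-⁻¹ a h } }

  commuting? : ∀ a → Decidable (λ h → ⟨ a , h ⟩ ≡ ε)
  commuting? a h = ⟨ a , h ⟩ ≟ ε

  -- The fibres of the homomorphism `⟨ a ,_⟩` onto `S` are cosets of its kernel, the centraliser of
  -- `a`.
  ∣centraliser∣ : ∀ {i a} → a ∈ A i → a ≢ ε → # (commuting? a) * t ≡ n
  ∣centraliser∣ {i} {a} a∈A a≢ε = sym (trans (sym (trans (*-identityˡ _) (#-whole {n}))) (trans
      (double-≡ whole (mem? S) R? 1 (# (commuting? a))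
        (λ h _ → #-unique (row whole (mem? S) R? h) (commutator∈S a h , refl) (λ σ → sym ∘ proj₂))
        (λ σ σ∈S → coset σ (commutators-onto a∈A a≢ε σ∈S)))
      (cong (# (commuting? a) *_) ∣S∣)))
    where
    R? : ∀ h σ → Dec (⟨ a , h ⟩ ≡ σ)
    R? h σ = ⟨ a , h ⟩ ≟ σ
    coset : ∀ σ → (∃ λ h → ⟨ a , h ⟩ ≡ σ) → # (col whole (mem? S) R? σ) ≡ # (commuting? a)
    coset σ (g , refl) = trans (#-cong (col whole (mem? S) R? σ) (λ h → commuting? a (g ⁻¹ ∙ h))
        (λ { h (_ , e) → trans (⟨⟩-∙ a (g ⁻¹) h) (trans (cong₂ _∙_ (⟨⟩-⁻¹ a g) e) (inverseˡ _)) })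
        (λ h e → tt , trans (cong ⟨ a ,_⟩ (solve (g ∷ h ∷ []) x₁ (x₀ ⊙ (inv x₀ ⊙ x₁)) refl)) (trans (⟨⟩-∙ a g (g ⁻¹ ∙ h)) (trans (cong (⟨ a , g ⟩ ∙_) e) (identityʳ _)))))
      (#-translateˡ (commuting? a) (g ⁻¹))

  component-not-central : ∀ {i a} → a ∈ A i → (∀ h → ⟨ a , h ⟩ ≡ ε) → a ≡ ε
  component-not-central {i} {a} a∈A c = by (a ≟ ε)
    where
    by : Dec (a ≡ ε) → a ≡ ε
    by (yes e) = e
    by (no ne) = contradiction (≤-trans 2≤t (subst (_≤ 1) ∣S∣ (≤-trans (#-mono (mem? S) (mem? trivial)
      (λ σ p → trans (sym (proj₂ (commutators-onto a∈A ne p))) (c _))) (≤-reflexive ∣trivial∣)))) λ { (s≤s ()) }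

  centre⊆S : ∀ z → (∀ h → ⟨ z , h ⟩ ≡ ε) → z ∈ S
  centre⊆S z c = by (decompose z i≢j)
    where
    i = proj₁ (others zero)
    j = proj₁ (proj₂ (others zero))
    i≢j : i ≢ j
    i≢j = proj₂ (proj₂ (proj₂ (proj₂ (others zero))))
    by : (∃ λ a → ∃ λ b → ∃ λ σ → a ∈ A i × b ∈ A j × σ ∈ S × z ≡ a ∙ b ∙ σ) → z ∈ S
    by (a , b , σ , a∈A , b∈A , σ∈S , refl) = ≡∈ S (sym (trans (cong₂ (λ x y → x ∙ y ∙ σ) a≡ε b≡ε) (solve (σ ∷ []) (one ⊙ one ⊙ x₀) x₀ refl))) σ∈S
      where
      flip : ∀ {x y} → ⟨ x , y ⟩ ≡ ε → ⟨ y , x ⟩ ≡ ε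
      flip h = comm⇒⟨⟩≡ε (sym (⟨⟩≡ε⇒comm h))
      -- a commutes with A j since z and b do; hence with A i A j S = H
      a-A : ∀ {y} → y ∈ A j → ⟨ y , a ⟩ ≡ ε
      a-A {y} y∈A = begin
        ⟨ y , a ⟩                               ≡⟨ cong ⟨ y ,_⟩ (solve (a ∷ b ∷ σ ∷ []) x₀ (x₀ ⊙ x₁ ⊙ x₂ ⊙ (inv x₂ ⊙ inv x₁)) refl) ⟩
        ⟨ y , a ∙ b ∙ σ ∙ (σ ⁻¹ ∙ b ⁻¹) ⟩      ≡⟨ trans (⟨⟩-∙ y (a ∙ b ∙ σ) _) (cong₂ _∙_ (flip (c y)) (⟨⟩-∙ y (σ ⁻¹) (b ⁻¹))) ⟩
        ε ∙ (⟨ y , σ ⁻¹ ⟩ ∙ ⟨ y , b ⁻¹ ⟩)       ≡⟨ cong₂ (λ u v → ε ∙ (u ∙ v)) (S-central y (⁻¹∈ S σ∈S)) (A-abelian j y∈A (⁻¹∈ (A j) b∈A)) ⟩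
        ε ∙ (ε ∙ ε)                             ≡⟨ solve [] (one ⊙ (one ⊙ one)) one refl ⟩
        ε ∎
        where open ≡-Reasoning
      central : ∀ {x} → (∀ {y} → y ∈ A i → ⟨ x , y ⟩ ≡ ε) → (∀ {y} → y ∈ A j → ⟨ x , y ⟩ ≡ ε) → ∀ h → ⟨ x , h ⟩ ≡ ε
      central {x} p q h = go (decompose h i≢j)
        where
        go : (∃ λ u → ∃ λ v → ∃ λ τ → u ∈ A i × v ∈ A j × τ ∈ S × h ≡ u ∙ v ∙ τ) → ⟨ x , h ⟩ ≡ ε
        go (u , v , τ , u∈A , v∈A , τ∈S , refl) = trans (⟨⟩-∙ x (u ∙ v) τ) (trans (cong₂ _∙_ (trans (⟨⟩-∙ x u v) (cong₂ _∙_ (p u∈A) (q v∈A))) (S-central x τ∈S))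
          (solve [] (one ⊙ one ⊙ one) one refl))
      a≡ε : a ≡ ε
      a≡ε = component-not-central a∈A (central (λ y∈A → A-abelian i a∈A y∈A) (λ y∈A → flip (a-A y∈A)))
      b≡ε : b ≡ ε
      b≡ε = component-not-central b∈A (λ h → flip (begin
        ⟨ h , b ⟩                           ≡⟨ cong ⟨ h ,_⟩ (solve (b ∷ σ ∷ []) x₀ (one ⊙ x₀ ⊙ x₁ ⊙ inv x₁) refl) ⟩
        ⟨ h , ε ∙ b ∙ σ ∙ σ ⁻¹ ⟩            ≡⟨ cong (λ y → ⟨ h , y ∙ b ∙ σ ∙ σ ⁻¹ ⟩) (sym a≡ε) ⟩
        ⟨ h , a ∙ b ∙ σ ∙ σ ⁻¹ ⟩            ≡⟨ trans (⟨⟩-∙ h (a ∙ b ∙ σ) (σ ⁻¹)) (cong₂ _∙_ (flip (c h)) (S-central h (⁻¹∈ S σ∈S))) ⟩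
        ε ∙ ε                               ≡⟨ identityˡ ε ⟩
        ε ∎))
        where open ≡-Reasoning

-- From the quadrangle to a Kantor family

CardIs⇒# : ∀ {n k} {P : Fin n → Set} (P? : Decidable P) → CardIs P k → # P? ≡ k
CardIs⇒# {k = k} P? (f , inj , P-f , onto) = trans (sym (*-identityˡ _)) (trans
  (double-≡ P? whole (λ p i → f i ≟ p) 1 1
    (λ p q → unique-index p (onto p q))
    (λ i _ → #-unique (col P? whole (λ p i → f i ≟ p) i) (P-f i , refl) (λ _ → sym ∘ proj₂)))
  (trans (*-identityˡ _) #-whole))
  where
  unique-index : ∀ p → (∃ λ i → f i ≡ p) → # (row P? whole (λ p i → f i ≟ p) p) ≡ 1
  unique-index p (i , refl) = #-unique (row P? whole (λ p i → f i ≟ p) p) (tt , refl) (λ j q → inj (proj₂ q))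

#⇒CardIs : ∀ {n} {P : Fin n → Set} (P? : Decidable P) → CardIs P (# P?)
#⇒CardIs P? = elem , injective , elem∈ , λ p q → index q , elem-index q
  where open Enumeration (enumerate P?)

module Automorphisms {𝒢 : IncStr} where
  open IncStr 𝒢
  open Aut

  ap-inj : ∀ (α : Aut 𝒢) {p q} → ap α p ≡ ap α q → p ≡ q
  ap-inj α {p} {q} e = trans (sym (Inverse.strictlyInverseʳ (πP α) p)) (trans (cong (Inverse.from (πP α)) e) (Inverse.strictlyInverseʳ (πP α) q))

  al-inj : ∀ (α : Aut 𝒢) {L M} → al α L ≡ al α M → L ≡ M
  al-inj α {p} {q} e = trans (sym (Inverse.strictlyInverseʳ (πL α) p)) (trans (cong (Inverse.from (πL α)) e) (Inverse.strictlyInverseʳ (πL α) q))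

  map-I : ∀ (α : Aut 𝒢) {p L} → p I L → ap α p I al α L
  map-I α {p} {L} h = subst T (pres α p L) h

  unmap-I : ∀ (α : Aut 𝒢) {p L} → ap α p I al α L → p I L
  unmap-I α {p} {L} h = subst T (sym (pres α p L)) h

-- A skew translation quadrangle with base point y₀; the elation group is identified with
-- the orbit of y₀, i.e. with the points not collinear with x.
module Geometry (𝒢 : IncStr) (s t : ℕ) (gq : IsGQ 𝒢 s t) (thick : Thick s t) (x : IncStr.Pt 𝒢)
                (E 𝕊 : Aut 𝒢 → Set) (stgq : IsSTGQ x E 𝕊 t) (star : Star x E) where
  open IncStr 𝒢
  open IsGQ gq
  open Aut
  open Automorphisms {𝒢}
  open IsSTGQ stgq
  open IsEGQ egq
  module E = IsSubgroup subgroup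
  module 𝕊ᵍ = IsSubgroup 𝕊-sub

  I? : ∀ p L → Dec (p I L)
  I? p L = T? (inc p L)

  Col? : ∀ p q → Dec (Col p q)
  Col? p q = any? (λ L → I? p L ×-dec I? q L)

  Col-sym : ∀ {p q} → Col p q → Col q p
  Col-sym (L , a , b) = L , b , a

  same-point : ∀ {p q L M} → p I L → q I L → p I M → q I M → L ≢ M → p ≡ q
  same-point {p} {q} {L} {M} a b c d L≢M with partial p q L M a b c d
  ... | inj₁ e = e
  ... | inj₂ e = contradiction e L≢M

  same-line : ∀ {p q L M} → p I L → q I L → p I M → q I M → p ≢ q → L ≡ M
  same-line {p} {q} {L} {M} a b c d p≢q with partial p q L M a b c d
  ... | inj₁ e = contradiction e p≢q
  ... | inj₂ e = e

  proj-unique : ∀ {p L q r} → ¬ p I L → q I L → Col p q → r I L → Col p r → q ≡ r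
  proj-unique {p} {L} p∉L q∈L pq r∈L pr = trans (sym (proj₂ (gqAxiom p L p∉L) _ q∈L pq)) (proj₂ (gqAxiom p L p∉L) _ r∈L pr)

  Λ : Fin (suc t) → Ln
  Λ = proj₁ (ptLines x)

  Λ-inj : ∀ {i j} → Λ i ≡ Λ j → i ≡ j
  Λ-inj = proj₁ (proj₂ (ptLines x))

  x∈Λ : ∀ k → x I Λ k
  x∈Λ = proj₁ (proj₂ (proj₂ (ptLines x)))

  Λ-onto : ∀ {L} → x I L → ∃ λ k → Λ k ≡ L
  Λ-onto {L} = proj₂ (proj₂ (proj₂ (ptLines x))) L

  Affine : Pt → Set
  Affine y = ¬ Col x y

  affine∉Λ : ∀ {y} → Affine y → ∀ k → ¬ y I Λ k
  affine∉Λ y-aff k h = y-aff (Λ k , x∈Λ k , h)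

  x∉affine-line : ∀ {y M} → Affine y → y I M → ¬ x I M
  x∉affine-line y-aff y∈M x∈M = y-aff (_ , x∈M , y∈M)

  -- `u` is the projection of the affine point `y` to the `k`-th line on `x`, and `ℓ` joins the two.
  module At (y : Pt) (y-aff : Affine y) (k : Fin (suc t)) where
    private
      w = proj₁ (gqAxiom y (Λ k) (affine∉Λ y-aff k))
    u : Pt
    u = proj₁ w
    u∈Λ : u I Λ k
    u∈Λ = proj₁ (proj₂ w)
    ℓ : Ln
    ℓ = proj₁ (proj₂ (proj₂ w))
    y∈ℓ : y I ℓ
    y∈ℓ = proj₁ (proj₂ (proj₂ (proj₂ w)))
    u∈ℓ : u I ℓ
    u∈ℓ = proj₂ (proj₂ (proj₂ (proj₂ w)))
    u-unique : ∀ {q} → q I Λ k → Col y q → u ≡ q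
    u-unique q∈Λ yq = proj₂ (gqAxiom y (Λ k) (affine∉Λ y-aff k)) _ q∈Λ yq
    x-u : Col x u
    x-u = Λ k , x∈Λ k , u∈Λ
    u≢x : u ≢ x
    u≢x e = y-aff (ℓ , subst (_I ℓ) e u∈ℓ , y∈ℓ)
    ℓ-unique : ∀ {M q} → y I M → q I M → q I Λ k → M ≡ ℓ
    ℓ-unique {M} {q} y∈M q∈M q∈Λ = same-line y∈M (subst (_I M) (sym (u-unique q∈Λ (M , y∈M , q∈M))) q∈M) y∈ℓ u∈ℓ
      (λ y≡u → affine∉Λ y-aff k (subst (_I Λ k) (sym y≡u) u∈Λ))
    x∉ℓ : ¬ x I ℓ
    x∉ℓ = x∉affine-line y-aff y∈ℓ
    ℓ≢Λ : ℓ ≢ Λ k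
    ℓ≢Λ e = x∉ℓ (subst (x I_) (sym e) (x∈Λ k))
    ℓ-affine : ∀ {q} → q I ℓ → q ≢ u → Affine q
    ℓ-affine q∈ℓ q≢u xq = q≢u (proj-unique x∉ℓ q∈ℓ xq u∈ℓ x-u)

  open At

  line-through : ∀ {y M} (y-aff : Affine y) → y I M → ∃ λ k → M ≡ ℓ y y-aff k
  line-through {y} {M} y-aff y∈M with proj₁ (gqAxiom x M (x∉affine-line y-aff y∈M))
  ... | q , q∈M , N , x∈N , q∈N with Λ-onto x∈N
  ...   | k , refl = k , ℓ-unique y y-aff k y∈M q∈M q∈N

  affine-point-on : ∀ {L} → ¬ x I L → ∃ λ y → Affine y × y I L
  affine-point-on {L} x∉L with gqAxiom x L x∉L
  ... | (q , q∈L , xq) , unique = from (#-witness Q? (s≤s⁻¹ (≤-trans (≤-trans (proj₁ thick) (n≤1+n s))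
      (≤-reflexive (trans (sym (CardIs⇒# (λ p → I? p L) (linePts L))) (#-remove (λ p → I? p L) q∈L))))))
    where
    Q? : Decidable (λ p → p I L × p ≢ q)
    Q? p = I? p L ×-dec ¬? (p ≟ q)
    from : (∃ λ p → p I L × p ≢ q) → ∃ λ y → Affine y × y I L
    from (p , p∈L , p≢q) = p , (λ xp → p≢q (sym (unique p p∈L xp))) , p∈L

  fix-Λ : ∀ {α} → E α → ∀ k → al α (Λ k) ≡ Λ k
  fix-Λ {α} h k = fixLines α h (Λ k) (x∈Λ k)

  Λ-preserved : ∀ {α} → E α → ∀ k {p} → p I Λ k → ap α p I Λ k
  Λ-preserved {α} h k p∈Λ = subst (ap α _ I_) (fix-Λ {α} h k) (map-I α p∈Λ)

  fix-x : ∀ {α} → E α → ap α x ≡ x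
  fix-x {α} h with two-others (proj₂ thick) zero
  ... | i , j , _ , _ , i≢j = same-point (Λ-preserved {α} h i (x∈Λ i)) (x∈Λ i) (Λ-preserved {α} h j (x∈Λ j)) (x∈Λ j) (i≢j ∘ Λ-inj)

  map-affine : ∀ {α y} → E α → Affine y → Affine (ap α y)
  map-affine {α} {y} h y-aff (N , x∈N , αy∈N) = y-aff (N , x∈N , unmap-I α (subst (ap α y I_) (sym (fixLines α h N x∈N)) αy∈N))

  map-Col : ∀ α {p q} → Col p q → Col (ap α p) (ap α q)
  map-Col α (L , a , b) = al α L , map-I α a , map-I α b

  map-u : ∀ {α y z} (h : E α) (y-aff : Affine y) (z-aff : Affine z) k → ap α y ≡ z → ap α (u y y-aff k) ≡ u z z-aff k
  map-u {α} h y-aff z-aff k refl = sym (u-unique _ z-aff k (Λ-preserved {α} h k (u∈Λ _ y-aff k)) (map-Col α (ℓ _ y-aff k , y∈ℓ _ y-aff k , u∈ℓ _ y-aff k)))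

  map-ℓ : ∀ {α y z} (h : E α) (y-aff : Affine y) (z-aff : Affine z) k → ap α y ≡ z → al α (ℓ y y-aff k) ≡ ℓ z z-aff k
  map-ℓ {α} h y-aff z-aff k refl = ℓ-unique _ z-aff k (map-I α (y∈ℓ _ y-aff k)) (map-I α (u∈ℓ _ y-aff k)) (Λ-preserved {α} h k (u∈Λ _ y-aff k))

  Λ-meet : ∀ {i j p} → i ≢ j → p I Λ i → p I Λ j → p ≡ x
  Λ-meet i≢j a b = same-point a (x∈Λ _) b (x∈Λ _) (i≢j ∘ Λ-inj)

  Λ∌ℓ : ∀ {y} (y-aff : Affine y) {j k v} → j ≢ k → v I Λ j → v ≢ x → ¬ v I ℓ y y-aff k
  Λ∌ℓ {y} y-aff {j} {k} {v} j≢k v∈Λ v≢x v∈ℓ = v≢x (Λ-meet j≢k v∈Λ (subst (_I Λ k)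
    (proj-unique (x∉ℓ y y-aff k) (u∈ℓ y y-aff k) (x-u y y-aff k) v∈ℓ (Λ j , x∈Λ j , v∈Λ)) (u∈Λ y y-aff k)))

  -- `y` is the only point of its `k`-th line collinear with its projection to `Λ j`, so it is
  -- determined by fixed data.
  fix-ℓ-and-point : ∀ {α y} (h : E α) (y-aff : Affine y) {j k} → j ≢ k → al α (ℓ y y-aff k) ≡ ℓ y y-aff k →
                    ap α (u y y-aff j) ≡ u y y-aff j → ap α y ≡ y
  fix-ℓ-and-point {α} {y} h y-aff {j} {k} j≢k fℓ fu = proj-unique (Λ∌ℓ y-aff j≢k (u∈Λ y y-aff j) (u≢x y y-aff j))
    (subst (ap α y I_) fℓ (map-I α (y∈ℓ y y-aff k))) (subst (λ z → Col z (ap α y)) fu (map-Col α (ℓ y y-aff j , u∈ℓ y y-aff j , y∈ℓ y y-aff j)))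
    (y∈ℓ y y-aff k) (ℓ y y-aff j , u∈ℓ y y-aff j , y∈ℓ y y-aff j)

  identity : Aut 𝒢
  identity = proj₁ E.hasId
  E-identity : E identity
  E-identity = proj₁ (proj₂ E.hasId)
  identity-id : IsIdA identity
  identity-id = proj₂ (proj₂ E.hasId)

  fix⇒id : ∀ {α y} → E α → Affine y → ap α y ≡ y → IsIdA α
  fix⇒id {α} {y} h y-aff e with sharp α identity y h E-identity y-aff (trans e (sym (proj₁ identity-id y)))
  ... | P , L = (λ p → trans (P p) (proj₁ identity-id p)) , (λ M → trans (L M) (proj₂ identity-id M))

  module Based (y₀ : Pt) (y₀-aff : Affine y₀) where

    uₖ : Fin (suc t) → Pt
    uₖ = u y₀ y₀-aff
    ℓₖ : Fin (suc t) → Ln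
    ℓₖ = ℓ y₀ y₀-aff

    Affine? : Decidable Affine
    Affine? y = ¬? (Col? x y)

    open Enumeration (enumerate Affine?) public

    n : ℕ
    n = # Affine?

    abstract
      elation : ∀ i → ∃ λ α → E α × ap α y₀ ≡ elem i
      elation i = transitive y₀ (elem i) y₀-aff (elem∈ i)

    ⟪_⟫ : Fin n → Aut 𝒢
    ⟪ i ⟫ = proj₁ (elation i)
    E-⟪⟫ : ∀ i → E ⟪ i ⟫
    E-⟪⟫ i = proj₁ (proj₂ (elation i))
    ⟪⟫-y₀ : ∀ i → ap ⟪ i ⟫ y₀ ≡ elem i
    ⟪⟫-y₀ i = proj₂ (proj₂ (elation i))

    name : ∀ {α} → E α → Fin n
    name h = index (map-affine h y₀-aff)

    ⟪name⟫ : ∀ {α} (h : E α) → α ≈A ⟪ name h ⟫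
    ⟪name⟫ {α} h = sharp α ⟪ name h ⟫ y₀ h (E-⟪⟫ (name h)) y₀-aff (sym (trans (⟪⟫-y₀ (name h)) (elem-index (map-affine h y₀-aff))))

    -- By sharp transitivity an elation is known from the image of `y₀`; the product records the
    -- image under the composite, and the group laws are checked on `y₀`.
    _·ᵉ_ : Fin n → Fin n → Fin n
    i ·ᵉ j = index (map-affine (E-⟪⟫ i) (elem∈ j))

    elem-· : ∀ i j → elem (i ·ᵉ j) ≡ ap ⟪ i ⟫ (elem j)
    elem-· i j = elem-index _

    ⟪·⟫ : ∀ i j → IsComp ⟪ i ·ᵉ j ⟫ ⟪ i ⟫ ⟪ j ⟫
    ⟪·⟫ i j with E.comp (E-⟪⟫ i) (E-⟪⟫ j)
    ... | γ , γ∈E , cP , cL with sharp ⟪ i ·ᵉ j ⟫ γ y₀ (E-⟪⟫ (i ·ᵉ j)) γ∈E y₀-aff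
                                (trans (⟪⟫-y₀ (i ·ᵉ j)) (trans (elem-· i j) (trans (cong (ap ⟪ i ⟫) (sym (⟪⟫-y₀ j))) (sym (cP y₀)))))
    ...   | eP , eL = (λ p → trans (eP p) (cP p)) , (λ L → trans (eL L) (cL L))

    1ᵉ : Fin n
    1ᵉ = index y₀-aff

    elem-1 : elem 1ᵉ ≡ y₀
    elem-1 = elem-index y₀-aff

    ⟪1⟫ : IsIdA ⟪ 1ᵉ ⟫
    ⟪1⟫ = fix⇒id (E-⟪⟫ 1ᵉ) y₀-aff (trans (⟪⟫-y₀ 1ᵉ) elem-1)

    invᵉ : Fin n → Fin n
    invᵉ i = name (proj₁ (proj₂ (E.inv (E-⟪⟫ i))))

    ⟪inv⟫ : ∀ i p → ap ⟪ invᵉ i ⟫ (ap ⟪ i ⟫ p) ≡ p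
    ⟪inv⟫ i p = trans (sym (proj₁ (⟪name⟫ (proj₁ (proj₂ (E.inv (E-⟪⟫ i))))) _)) (proj₁ (proj₂ (proj₂ (E.inv (E-⟪⟫ i)))) p)

    𝔾 : FinGroup n
    𝔾 = record
      { _·_ = _·ᵉ_ ; 1# = 1ᵉ ; _⁻ = invᵉ
      ; isGroup = record
        { isMonoid = record
          { isSemigroup = record
            { isMagma = record { isEquivalence = isEquivalence ; ∙-cong = cong₂ _·ᵉ_ }
            ; assoc = λ i j k → injective (trans (elem-· _ k) (trans (proj₁ (⟪·⟫ i j) (elem k))
                (sym (trans (elem-· i _) (cong (ap ⟪ i ⟫) (elem-· j k)))))) }
          ; identity = (λ i → injective (trans (elem-· 1ᵉ i) (proj₁ ⟪1⟫ (elem i))))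
                     , (λ i → injective (trans (elem-· i 1ᵉ) (trans (cong (ap ⟪ i ⟫) elem-1) (⟪⟫-y₀ i)))) }
        ; inverse = (λ i → injective (trans (elem-· _ i) (trans (cong (ap ⟪ invᵉ i ⟫) (sym (⟪⟫-y₀ i))) (trans (⟪inv⟫ i y₀) (sym elem-1)))))
                  , (λ i → injective (trans (elem-· i _) (trans (cong (ap ⟪ i ⟫) (sym (⟪⟫-y₀ (invᵉ i))))
                       (trans (ap-inj ⟪ invᵉ i ⟫ (⟪inv⟫ i _)) (sym elem-1)))))
        ; ⁻¹-cong = cong invᵉ } }

    open FinGroupTheory 𝔾
    open NormalSubgroups 𝔾

    infixr 5 _•_ _◦_
    _•_ : H → Pt → Pt
    h • p = ap ⟪ h ⟫ p
    _◦_ : H → Ln → Ln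
    h ◦ L = al ⟪ h ⟫ L

    •-∙ : ∀ g h p → (g ∙ h) • p ≡ g • (h • p)
    •-∙ g h = proj₁ (⟪·⟫ g h)
    ◦-∙ : ∀ g h L → (g ∙ h) ◦ L ≡ g ◦ (h ◦ L)
    ◦-∙ g h = proj₂ (⟪·⟫ g h)
    •-ε : ∀ p → ε • p ≡ p
    •-ε = proj₁ ⟪1⟫
    ◦-ε : ∀ L → ε ◦ L ≡ L
    ◦-ε = proj₂ ⟪1⟫

    •-⁻¹ : ∀ h {p q} → h • p ≡ q → h ⁻¹ • q ≡ p
    •-⁻¹ h {p} refl = trans (sym (•-∙ (h ⁻¹) h p)) (trans (cong (_• p) (inverseˡ h)) (•-ε p))
    ◦-⁻¹ : ∀ h {p q} → h ◦ p ≡ q → h ⁻¹ ◦ q ≡ p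
    ◦-⁻¹ h {p} refl = trans (sym (◦-∙ (h ⁻¹) h p)) (trans (cong (_◦ p) (inverseˡ h)) (◦-ε p))

    •-y₀ : ∀ h → h • y₀ ≡ elem h
    •-y₀ = ⟪⟫-y₀

    elem≡y₀⇒ε : ∀ {h} → elem h ≡ y₀ → h ≡ ε
    elem≡y₀⇒ε e = injective (trans e (sym elem-1))

    h-u : ∀ h k → h • uₖ k ≡ u (elem h) (elem∈ h) k
    h-u h k = map-u {⟪ h ⟫} (E-⟪⟫ h) y₀-aff (elem∈ h) k (•-y₀ h)

    h-ℓ : ∀ h k → h ◦ ℓₖ k ≡ ℓ (elem h) (elem∈ h) k
    h-ℓ h k = map-ℓ {⟪ h ⟫} (E-⟪⟫ h) y₀-aff (elem∈ h) k (•-y₀ h)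

    A A* : Fin (suc t) → Subgroup
    A k = record
      { mem = λ h → h ◦ ℓₖ k ≡ ℓₖ k ; mem? = λ h → h ◦ ℓₖ k ≟ ℓₖ k ; ε∈ = ◦-ε _
      ; ∙∈ = λ {g} {h} p q → trans (◦-∙ g h _) (trans (cong (g ◦_) q) p) ; ⁻¹∈ = λ {h} p → ◦-⁻¹ h p }
    A* k = record
      { mem = λ h → h • uₖ k ≡ uₖ k ; mem? = λ h → h • uₖ k ≟ uₖ k ; ε∈ = •-ε _
      ; ∙∈ = λ {g} {h} p q → trans (•-∙ g h _) (trans (cong (g •_) q) p) ; ⁻¹∈ = λ {h} p → •-⁻¹ h p }

    on-ℓ⇒A : ∀ k {h} → elem h I ℓₖ k → h ∈ A k
    on-ℓ⇒A k {h} q = trans (h-ℓ h k) (sym (ℓ-unique (elem h) (elem∈ h) k q (u∈ℓ y₀ y₀-aff k) (u∈Λ y₀ y₀-aff k)))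

    A⇒on-ℓ : ∀ k {h} → h ∈ A k → elem h I ℓₖ k
    A⇒on-ℓ k {h} p = subst₂ _I_ (•-y₀ h) p (map-I ⟪ h ⟫ (y∈ℓ y₀ y₀-aff k))

    A⊆A* : ∀ k → A k ⊆ A* k
    A⊆A* k {h} p = sym (u-unique y₀ y₀-aff k (Λ-preserved {⟪ h ⟫} (E-⟪⟫ h) k (u∈Λ y₀ y₀-aff k))
      (ℓₖ k , y∈ℓ y₀ y₀-aff k , subst ((h • uₖ k) I_) p (map-I ⟪ h ⟫ (u∈ℓ y₀ y₀-aff k))))

    u-fixed⇒A* : ∀ k {h} → u (elem h) (elem∈ h) k ≡ uₖ k → h ∈ A* k
    u-fixed⇒A* k {h} e = trans (h-u h k) e

    A*-normal : ∀ k → Normal (A* k)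
    A*-normal k g {h} p = trans (•-∙ (g ⁻¹ ∙ h) g _) (trans (•-∙ (g ⁻¹) h _) (•-⁻¹ g (sym
      (star ⟪ h ⟫ (E-⟪⟫ h) (uₖ k) (x-u y₀ y₀-aff k) (u≢x y₀ y₀-aff k) p (Λ k) (x∈Λ k) (u∈Λ y₀ y₀-aff k) (g • uₖ k)
        (Λ-preserved {⟪ g ⟫} (E-⟪⟫ g) k (u∈Λ y₀ y₀-aff k))))))

    A∩A* : ∀ {i j h} → i ≢ j → h ∈ A i → h ∈ A* j → h ≡ ε
    A∩A* {i} {j} {h} i≢j p q = elem≡y₀⇒ε (trans (sym (•-y₀ h)) (fix-ℓ-and-point (E-⟪⟫ h) y₀-aff (λ e → i≢j (sym e)) p q))

    symmetry-fixing-ℓ : ∀ {α} → E α → IsSymmetry x α → ∀ k → al α (ℓₖ k) ≡ ℓₖ k → IsIdA α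
    symmetry-fixing-ℓ {α} h sym-α k e with two-others (proj₂ thick) k
    ... | j , _ , j≢k , _ = fix⇒id h y₀-aff (fix-ℓ-and-point h y₀-aff j≢k e (sym-α _ (x-u y₀ y₀-aff j)))

    𝕤 : Fin t → Aut 𝒢
    𝕤 = proj₁ 𝕊-card
    𝕤-inj : ∀ i j → 𝕤 i ≈A 𝕤 j → i ≡ j
    𝕤-inj = proj₁ (proj₂ 𝕊-card)
    𝕊-𝕤 : ∀ i → 𝕊 (𝕤 i)
    𝕊-𝕤 = proj₁ (proj₂ (proj₂ 𝕊-card))
    𝕤-onto : ∀ α → 𝕊 α → ∃ λ i → α ≈A 𝕤 i
    𝕤-onto = proj₂ (proj₂ (proj₂ 𝕊-card))

    E-𝕤 : ∀ i → E (𝕤 i)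
    E-𝕤 i = 𝕊⊆H (𝕤 i) (𝕊-𝕤 i)

    ≈A-sym : ∀ {α β : Aut 𝒢} → α ≈A β → β ≈A α
    ≈A-sym (P , L) = (λ p → sym (P p)) , (λ M → sym (L M))

    agree-on-ℓ : ∀ {α β} → E α → E β → IsSymmetry x α → IsSymmetry x β → ∀ k → al α (ℓₖ k) ≡ al β (ℓₖ k) → α ≈A β
    agree-on-ℓ {α} {β} α∈E β∈E sα sβ k e with E.inv β∈E
    ... | β′ , β′∈E , iP , iL with E.comp β′∈E α∈E
    ...   | γ , γ∈E , cP , cL = (λ p → ap-inj β′ (trans (sym (cP p)) (trans (proj₁ γ-id p) (sym (iP p)))))
                              , (λ M → al-inj β′ (trans (sym (cL M)) (trans (proj₂ γ-id M) (sym (iL M)))))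
      where
      γ-sym : IsSymmetry x γ
      γ-sym y xy = trans (cP y) (trans (cong (ap β′) (trans (sα y xy) (sym (sβ y xy)))) (iP y))
      γ-id : IsIdA γ
      γ-id = symmetry-fixing-ℓ γ∈E γ-sym k (trans (cL _) (trans (cong (al β′) e) (iL _)))

    tangent? : ∀ k → Decidable (λ M → uₖ k I M × M ≢ Λ k)
    tangent? k M = I? (uₖ k) M ×-dec ¬? (M ≟ Λ k)

    -- The `t` symmetries send `ℓₖ k` to distinct lines by `agree-on-ℓ`, and only `t` lines on
    -- `uₖ k` differ from `Λ k`.
    𝕊-transitive : ∀ k M → uₖ k I M → M ≢ Λ k → ∃ λ i → al (𝕤 i) (ℓₖ k) ≡ M
    𝕊-transitive k M u∈M M≢Λ = #-full image? (tangent? k)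
        (λ { N (i , refl) → subst (_I al (𝕤 i) (ℓₖ k)) (𝕊-sym (𝕤 i) (𝕊-𝕤 i) _ (x-u y₀ y₀-aff k)) (map-I (𝕤 i) (u∈ℓ y₀ y₀-aff k))
           , (λ e → ℓ≢Λ y₀ y₀-aff k (al-inj (𝕤 i) (trans e (sym (fix-Λ {𝕤 i} (E-𝕤 i) k))))) })
        (≤-trans (≤-reflexive ∣tangent∣) t≤image) M (u∈M , M≢Λ)
      where
      image? : Decidable (λ M → ∃ λ i → al (𝕤 i) (ℓₖ k) ≡ M)
      image? M = any? (λ i → al (𝕤 i) (ℓₖ k) ≟ M)
      ∣tangent∣ : # (tangent? k) ≡ t
      ∣tangent∣ = suc-injective (trans (sym (#-remove (I? (uₖ k)) (u∈Λ y₀ y₀-aff k))) (CardIs⇒# (I? (uₖ k)) (ptLines (uₖ k))))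
      t≤image : t ≤ # image?
      t≤image = ≤-trans (≤-reflexive (sym #-whole)) (#-inj whole image? (λ i → al (𝕤 i) (ℓₖ k)) (λ i _ → i , refl)
        (λ i j _ _ e → 𝕤-inj i j (agree-on-ℓ (E-𝕤 i) (E-𝕤 j) (𝕊-sym (𝕤 i) (𝕊-𝕤 i)) (𝕊-sym (𝕤 j) (𝕊-𝕤 j)) k e)))

    -- Some element of `𝕊` agrees with `α` on one line `ℓₖ zero`, hence everywhere. So `𝕊` consists
    -- of all symmetries in `E`, which is what makes it normal.
    symmetry⇒𝕊 : ∀ {α} → E α → IsSymmetry x α → 𝕊 α
    symmetry⇒𝕊 {α} h sα with 𝕊-transitive zero (al α (ℓₖ zero))
        (subst (_I al α (ℓₖ zero)) (sα _ (x-u y₀ y₀-aff zero)) (map-I α (u∈ℓ y₀ y₀-aff zero)))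
        (λ e → ℓ≢Λ y₀ y₀-aff zero (al-inj α (trans e (sym (fix-Λ {α} h zero)))))
    ... | i , e = 𝕊ᵍ.resp (agree-on-ℓ (E-𝕤 i) h (𝕊-sym (𝕤 i) (𝕊-𝕤 i)) sα zero e) (𝕊-𝕤 i)

    S : Subgroup
    S = record
      { mem = λ h → 𝕊 ⟪ h ⟫ ; mem? = mem𝕊?
      ; ε∈ = symmetry⇒𝕊 (E-⟪⟫ ε) (λ y _ → •-ε y)
      ; ∙∈ = λ {g} {h} p q → symmetry⇒𝕊 (E-⟪⟫ (g ∙ h)) (λ y xy → trans (•-∙ g h y) (trans (cong (g •_) (𝕊-sym _ q y xy)) (𝕊-sym _ p y xy)))
      ; ⁻¹∈ = λ {h} p → symmetry⇒𝕊 (E-⟪⟫ (h ⁻¹)) (λ y xy → •-⁻¹ h (𝕊-sym _ p y xy)) }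
      where
      -- `𝕊` is an arbitrary predicate; its enumeration and the image of `y₀` make it decidable.
      mem𝕊? : Decidable (λ h → 𝕊 ⟪ h ⟫)
      mem𝕊? h with any? (λ i → ap (𝕤 i) y₀ ≟ elem h)
      ... | yes (i , e) = yes (𝕊ᵍ.resp (sharp (𝕤 i) ⟪ h ⟫ y₀ (E-𝕤 i) (E-⟪⟫ h) y₀-aff (trans e (sym (•-y₀ h)))) (𝕊-𝕤 i))
      ... | no ¬e = no (λ p → ¬e (proj₁ (𝕤-onto ⟪ h ⟫ p) , trans (sym (proj₁ (proj₂ (𝕤-onto ⟪ h ⟫ p)) y₀)) (•-y₀ h)))

    S-normal : Normal S
    S-normal g {h} p = symmetry⇒𝕊 (E-⟪⟫ _) (λ y xy → trans (•-∙ (g ⁻¹ ∙ h) g y) (trans (•-∙ (g ⁻¹) h _)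
      (•-⁻¹ g (sym (𝕊-sym _ p (g • y) (subst (λ z → Col z (g • y)) (fix-x {⟪ g ⟫} (E-⟪⟫ g)) (map-Col ⟪ g ⟫ xy)))))))

    S⊆A* : ∀ k → S ⊆ A* k
    S⊆A* k p = 𝕊-sym _ p _ (x-u y₀ y₀-aff k)

    -- A symmetry `τ` with the same effect as `h` on `ℓₖ k` leaves `a = τ ⁻¹ ∙ h` in `A k`;
    -- conjugating `τ` by `a` puts the symmetry on the right.
    split : ∀ k {h} → h ∈ A* k → ∃ λ σ → σ ∈ S × h ∙ σ ⁻¹ ∈ A k
    split k {h} p = from (𝕊-transitive k (h ◦ ℓₖ k) (subst (_I (h ◦ ℓₖ k)) p (map-I ⟪ h ⟫ (u∈ℓ y₀ y₀-aff k)))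
        (λ e → ℓ≢Λ y₀ y₀-aff k (al-inj ⟪ h ⟫ (trans e (sym (fix-Λ {⟪ h ⟫} (E-⟪⟫ h) k))))))
      where
      from : (∃ λ i → al (𝕤 i) (ℓₖ k) ≡ h ◦ ℓₖ k) → ∃ λ σ → σ ∈ S × h ∙ σ ⁻¹ ∈ A k
      from (i , e) = a ⁻¹ ∙ τ ∙ a , S-normal a τ∈S , ≡∈ (A k) (solve (τ ∷ h ∷ []) (inv x₀ ⊙ x₁) (x₁ ⊙ inv (inv (inv x₀ ⊙ x₁) ⊙ x₀ ⊙ (inv x₀ ⊙ x₁))) refl) a∈A
        where
        τ = name (E-𝕤 i)
        τ∈S : τ ∈ S
        τ∈S = 𝕊ᵍ.resp (⟪name⟫ (E-𝕤 i)) (𝕊-𝕤 i)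
        a = τ ⁻¹ ∙ h
        a∈A : a ∈ A k
        a∈A = trans (◦-∙ (τ ⁻¹) h _) (◦-⁻¹ τ (trans (sym (proj₂ (⟪name⟫ (E-𝕤 i)) _)) e))

    cover : ∀ k {h} → ¬ h ∈ A* k → ∃ λ j → j ≢ k × ∃ λ a → a ∈ A k × a ⁻¹ ∙ h ∈ A j
    cover k {h} h∉A* = from (proj₁ (gqAxiom (elem h) (ℓₖ k) h∉ℓ))
      where
      h∉ℓ : ¬ elem h I ℓₖ k
      h∉ℓ q = h∉A* (A⊆A* k (on-ℓ⇒A k q))
      from : (∃ λ q → q I ℓₖ k × Col (elem h) q) → ∃ λ j → j ≢ k × ∃ λ a → a ∈ A k × a ⁻¹ ∙ h ∈ A j
      from (q , q∈ℓ , M , h∈M , q∈M) = along (line-through (elem∈ a) (subst (_I M) (sym elem-a) q∈M))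
        where
        q≢u : q ≢ uₖ k
        q≢u refl = h∉A* (u-fixed⇒A* k (u-unique (elem h) (elem∈ h) k (u∈Λ y₀ y₀-aff k) (M , h∈M , q∈M)))
        q-aff : Affine q
        q-aff = ℓ-affine y₀ y₀-aff k q∈ℓ q≢u
        a : H
        a = index q-aff
        elem-a : elem a ≡ q
        elem-a = elem-index q-aff
        a∈A : a ∈ A k
        a∈A = on-ℓ⇒A k (subst (_I ℓₖ k) (sym elem-a) q∈ℓ)
        along : (∃ λ j → M ≡ ℓ (elem a) (elem∈ a) j) → ∃ λ j → j ≢ k × ∃ λ a → a ∈ A k × a ⁻¹ ∙ h ∈ A j
        along (j , M≡) = j , (λ { refl → h∉ℓ (subst (elem h I_) (trans M≡aℓ a∈A) h∈M) }) , a , a∈A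
          , on-ℓ⇒A j (unmap-I ⟪ a ⟫ (subst₂ _I_ (trans (sym (•-y₀ h)) (trans (cong (_• y₀) (solve (a ∷ h ∷ []) x₁ (x₀ ⊙ (inv x₀ ⊙ x₁)) refl))
                (trans (•-∙ a (a ⁻¹ ∙ h) y₀) (cong (a •_) (•-y₀ (a ⁻¹ ∙ h)))))) M≡aℓ h∈M))
          where
          M≡aℓ : M ≡ a ◦ ℓₖ j
          M≡aℓ = trans M≡ (sym (h-ℓ a j))

    uniq : ∀ {k j l a b c} → j ≢ k → l ≢ k → a ∈ A k → b ∈ A j → c ∈ A l → b ≡ a ∙ c → a ≡ ε
    uniq {k} {j} {l} {a} {b} {c} j≢k l≢k a∈A b∈A c∈A b≡ac = by (I? (elem b) (ℓₖ k))
      where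
      by : Dec (elem b I ℓₖ k) → a ≡ ε
      by (yes q) = A∩A* (λ e → l≢k (sym e)) a∈A (A⊆A* l (≡∈ (A l) c⁻¹≡a (⁻¹∈ (A l) c∈A)))
        where
        b≡ε : b ≡ ε
        b≡ε = A∩A* j≢k b∈A (A⊆A* k (on-ℓ⇒A k q))
        c⁻¹≡a : c ⁻¹ ≡ a
        c⁻¹≡a = trans (sym (identityˡ _)) (trans (cong (_∙ c ⁻¹) (trans (sym b≡ε) b≡ac)) (solve (a ∷ c ∷ []) (x₀ ⊙ x₁ ⊙ inv x₁) x₀ refl))
      by (no b∉ℓ) = elem≡y₀⇒ε (proj-unique b∉ℓ (A⇒on-ℓ k a∈A)
        (a ◦ ℓₖ l , subst (_I (a ◦ ℓₖ l)) (trans (cong (a •_) (sym (•-y₀ c))) (trans (sym (•-∙ a c y₀)) (trans (cong (_• y₀) (sym b≡ac)) (•-y₀ b))))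
                      (map-I ⟪ a ⟫ (A⇒on-ℓ l c∈A))
                  , subst (_I (a ◦ ℓₖ l)) (•-y₀ a) (map-I ⟪ a ⟫ (y∈ℓ y₀ y₀-aff l)))
        (y∈ℓ y₀ y₀-aff k) (ℓₖ j , A⇒on-ℓ j b∈A , y∈ℓ y₀ y₀-aff j))

    prod : ∀ {i j} h → i ≢ j → ∃ λ a → a ∈ A i × a ⁻¹ ∙ h ∈ A* j
    prod {i} {j} h i≢j = from (proj₁ (gqAxiom v (ℓₖ i) v∉ℓ))
      where
      v = h • uₖ j
      v∈Λ : v I Λ j
      v∈Λ = Λ-preserved {⟪ h ⟫} (E-⟪⟫ h) j (u∈Λ y₀ y₀-aff j)
      v≢x : v ≢ x
      v≢x e = u≢x y₀ y₀-aff j (ap-inj ⟪ h ⟫ (trans e (sym (fix-x {⟪ h ⟫} (E-⟪⟫ h)))))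
      v∉ℓ : ¬ v I ℓₖ i
      v∉ℓ = Λ∌ℓ y₀-aff (λ e → i≢j (sym e)) v∈Λ v≢x
      from : (∃ λ q → q I ℓₖ i × Col v q) → ∃ λ a → a ∈ A i × a ⁻¹ ∙ h ∈ A* j
      from (q , q∈ℓ , vq) = a , on-ℓ⇒A i (subst (_I ℓₖ i) (sym elem-a) q∈ℓ)
          , trans (•-∙ (a ⁻¹) h _) (•-⁻¹ a (trans (h-u a j) (u-unique (elem a) (elem∈ a) j v∈Λ (subst (λ z → Col z v) (sym elem-a) (Col-sym vq)))))
        where
        q≢u : q ≢ uₖ i
        q≢u refl = v≢x (proj-unique {uₖ i} {Λ j} (λ u∈Λj → u≢x y₀ y₀-aff i (Λ-meet i≢j (u∈Λ y₀ y₀-aff i) u∈Λj))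
          v∈Λ (Col-sym vq) (x∈Λ j) (Col-sym (x-u y₀ y₀-aff i)))
        q-aff : Affine q
        q-aff = ℓ-affine y₀ y₀-aff i q∈ℓ q≢u
        a : H
        a = index q-aff
        elem-a : elem a ≡ q
        elem-a = elem-index q-aff

    ∣A∣ : ∀ k → ∣ A k ∣ ≡ s
    ∣A∣ k = trans (sym (*-identityˡ _)) (trans (double-≡ (mem? (A k)) Q? (λ h p → elem h ≟ p) 1 1
        (λ h h∈A → #-unique (row (mem? (A k)) Q? (λ h p → elem h ≟ p) h)
          ((A⇒on-ℓ k h∈A , (λ e → elem∈ h (subst (Col x) (sym e) (x-u y₀ y₀-aff k)))) , refl) (λ _ → sym ∘ proj₂))
        (λ { p (p∈ℓ , p≢u) → #-unique (col (mem? (A k)) Q? (λ h p → elem h ≟ p) p) {index (ℓ-affine y₀ y₀-aff k p∈ℓ p≢u)}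
          (on-ℓ⇒A k (subst (_I ℓₖ k) (sym (elem-index _)) p∈ℓ) , elem-index _) (λ { h (_ , e) → injective (trans e (sym (elem-index _))) }) }))
      (trans (*-identityˡ _) (suc-injective (trans (sym (#-remove (λ p → I? p (ℓₖ k)) (u∈ℓ y₀ y₀-aff k))) (CardIs⇒# (λ p → I? p (ℓₖ k)) (linePts (ℓₖ k)))))))
      where
      Q? : Decidable (λ p → p I ℓₖ k × p ≢ uₖ k)
      Q? p = I? p (ℓₖ k) ×-dec ¬? (p ≟ uₖ k)

    ∣S∣ : ∣ S ∣ ≡ t
    ∣S∣ = trans (sym (*-identityˡ _)) (trans (double-≡ (mem? S) whole R? 1 1
        (λ h p → unique-𝕤 h p (𝕤-onto ⟪ h ⟫ p))
        (λ i _ → #-unique (col (mem? S) whole R? i) {name (E-𝕤 i)}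
           (𝕊ᵍ.resp (⟪name⟫ (E-𝕤 i)) (𝕊-𝕤 i) , sym (elem-index _)) (λ { h (_ , e) → injective (trans (sym e) (sym (elem-index _))) })))
      (trans (*-identityˡ _) #-whole))
      where
      R? : ∀ h i → Dec (ap (𝕤 i) y₀ ≡ elem h)
      R? h i = ap (𝕤 i) y₀ ≟ elem h
      unique-𝕤 : ∀ h → h ∈ S → (∃ λ i → ⟪ h ⟫ ≈A 𝕤 i) → # (row (mem? S) whole R? h) ≡ 1
      unique-𝕤 h p (i , e) = #-unique (row (mem? S) whole R? h) (tt , trans (sym (proj₁ e y₀)) (•-y₀ h))
        (λ { j (_ , q) → 𝕤-inj j i (sharp (𝕤 j) (𝕤 i) y₀ (E-𝕤 j) (E-𝕤 i) y₀-aff (trans q (trans (sym (•-y₀ h)) (proj₁ e y₀)))) })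

    kantor : Kantor 𝔾 s t
    kantor = record
      { A = A ; A* = A* ; S = S ; S-normal = S-normal ; A*-normal = A*-normal ; A⊆A* = A⊆A* ; S⊆A* = S⊆A*
      ; split = split ; A∩A* = A∩A* ; cover = cover ; uniq = uniq ; prod = prod ; ∣A∣ = ∣A∣ ; ∣S∣ = ∣S∣
      ; 2≤s = proj₁ thick ; 2≤t = proj₂ thick }

-- The three statements

#≡1⇒unique : ∀ {n} {P : Fin n → Set} (P? : Decidable P) → # P? ≡ 1 → ∀ {a b} → P a → P b → a ≡ b
#≡1⇒unique P? #≡1 {a} {b} pa pb with b ≟ a
... | yes e = sym e
... | no ne = contradiction (#-∃ (λ x → P? x ×-dec ¬? (x ≟ a)) (pb , ne)) (<⇒≱ (s≤s (≤-reflexive (suc-injective (trans (sym (#-remove P? pa)) #≡1)))))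

CardIs-⇔ : ∀ {n k} {P Q : Fin n → Set} → (∀ x → P x → Q x) → (∀ x → Q x → P x) → CardIs P k → CardIs Q k
CardIs-⇔ pq qp (f , inj , P-f , onto) = f , inj , (λ i → pq (f i) (P-f i)) , λ x q → onto x (qp x q)

module Conclusions (𝒢 : IncStr) (s t : ℕ) (gq : IsGQ 𝒢 s t) (thick : Thick s t) (odd : s ≡ t → ¬ 2 ∣ t) (x : IncStr.Pt 𝒢)
                   (E 𝕊 : Aut 𝒢 → Set) (stgq : IsSTGQ x E 𝕊 t) (star : Star x E) where
  open IncStr 𝒢
  open IsGQ gq
  open Aut
  open Automorphisms {𝒢}
  open IsSTGQ stgq
  open IsEGQ egq
  open Geometry 𝒢 s t gq thick x E 𝕊 stgq star

  module WithBase (y₀ : Pt) (y₀-aff : Affine y₀) where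
    open Based y₀ y₀-aff
    open FinGroupTheory 𝔾
    open NormalSubgroups 𝔾
    open KantorTheory kantor using (commutator∈S; A∩S; n≡sst; module Whole; others)
    open CentralSymmetries kantor odd

    ∣A*∣ : ∀ k → ∣ A* k ∣ ≡ s * t
    ∣A*∣ k = trans (#-cong (mem? (A* k)) inside? (λ _ p → tt , p) (λ _ → proj₂)) (trans ∣inside∣ (cong (s *_)
      (trans (#-cong (mem? (S ∩ full)) (mem? S) (λ _ → proj₁) (λ _ p → p , tt)) ∣S∣)))
      where open Whole k using (inside?; ∣inside∣)

    commutes-with-S : ∀ h {σ} → σ ∈ S → h ∙ σ ≡ σ ∙ h
    commutes-with-S h p = ⟨⟩≡ε⇒comm (S-central h p)

    name∈S : ∀ {α} (h : E α) → 𝕊 α → name {α} h ∈ S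
    name∈S {α} h p = 𝕊ᵍ.resp {α} {⟪ name {α} h ⟫} (⟪name⟫ {α} h) p

    -- `S` carries `ℓₖ k` to every line on `uₖ k` other than `Λ k`, and `h` commutes with `S`.
    fixes-pencil : ∀ k h → h ∈ A k → ∀ M → uₖ k I M → h ◦ M ≡ M
    fixes-pencil k h h∈A M u∈M = by (M ≟ Λ k)
      where
      from : (∃ λ i → al (𝕤 i) (ℓₖ k) ≡ M) → h ◦ M ≡ M
      from (i , e) = begin
        h ◦ M               ≡⟨ cong (h ◦_) (sym e′) ⟩
        h ◦ σ ◦ ℓₖ k        ≡⟨ sym (◦-∙ h σ _) ⟩
        (h ∙ σ) ◦ ℓₖ k      ≡⟨ cong (_◦ ℓₖ k) (commutes-with-S h (name∈S {𝕤 i} (E-𝕤 i) (𝕊-𝕤 i))) ⟩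
        (σ ∙ h) ◦ ℓₖ k      ≡⟨ ◦-∙ σ h _ ⟩
        σ ◦ h ◦ ℓₖ k        ≡⟨ cong (σ ◦_) h∈A ⟩
        σ ◦ ℓₖ k            ≡⟨ e′ ⟩
        M                   ∎
        where
        open ≡-Reasoning
        σ = name {𝕤 i} (E-𝕤 i)
        e′ : σ ◦ ℓₖ k ≡ M
        e′ = trans (sym (proj₂ (⟪name⟫ {𝕤 i} (E-𝕤 i)) _)) e
      by : Dec (M ≡ Λ k) → h ◦ M ≡ M
      by (yes refl) = fix-Λ {⟪ h ⟫} (E-⟪⟫ h) k
      by (no ne)    = from (𝕊-transitive k M u∈M ne)

    Fixed-on : Fin (suc t) → H → Pt → Set
    Fixed-on k h p = p I Λ k × ∃ λ M → ¬ x I M × p I M × h ◦ M ≡ M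

    Fixed-on? : ∀ k h → Decidable (Fixed-on k h)
    Fixed-on? k h p = I? p (Λ k) ×-dec any? (λ M → ¬? (I? x M) ×-dec (I? p M ×-dec (h ◦ M ≟ M)))

    -- the points of [h] are the images of uₖ k under the centraliser of h
    commuting⇒fixed : ∀ k h → h ∈ A k → ∀ g → ⟨ h , g ⟩ ≡ ε → Fixed-on k h (g • uₖ k)
    commuting⇒fixed k h h∈A g c = Λ-preserved {⟪ g ⟫} (E-⟪⟫ g) k (At.u∈Λ y₀ y₀-aff k) , g ◦ ℓₖ k
      , (λ x∈ → At.x∉ℓ y₀ y₀-aff k (unmap-I ⟪ g ⟫ (subst (_I (g ◦ ℓₖ k)) (sym (fix-x {⟪ g ⟫} (E-⟪⟫ g))) x∈)))
      , map-I ⟪ g ⟫ (At.u∈ℓ y₀ y₀-aff k)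
      , trans (sym (◦-∙ h g _)) (trans (cong (_◦ ℓₖ k) (⟨⟩≡ε⇒comm c)) (trans (◦-∙ g h _) (cong (g ◦_) h∈A)))

    -- With `M = g ◦ ℓₖ k`, the conjugate `g ⁻¹ ∙ h ∙ g` lies in `A k`, so `⟨ g , h ⟩` lies in both
    -- `A k` and `S` and is trivial.
    fixed⇒commuting : ∀ k h → h ∈ A k → ∀ {p} → Fixed-on k h p → ∃ λ g → ⟨ h , g ⟩ ≡ ε × g • uₖ k ≡ p
    fixed⇒commuting k h h∈A {p} (p∈Λ , M , x∉M , p∈M , hM) = from (affine-point-on x∉M)
      where
      from : (∃ λ y → Affine y × y I M) → ∃ λ g → ⟨ h , g ⟩ ≡ ε × g • uₖ k ≡ p
      from (y , y-aff , y∈M) = g , comm⇒⟨⟩≡ε (sym (⟨⟩≡ε⇒comm (A∩S g⁻¹hg∈A (commutator∈S g h))))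
          , trans (h-u g k) (At.u-unique (elem g) (elem∈ g) k p∈Λ (M , g∈M , p∈M))
        where
        g : H
        g = index y-aff
        g∈M : elem g I M
        g∈M = subst (_I M) (sym (elem-index y-aff)) y∈M
        M≡gℓ : M ≡ g ◦ ℓₖ k
        M≡gℓ = trans (At.ℓ-unique (elem g) (elem∈ g) k g∈M p∈M p∈Λ) (sym (h-ℓ g k))
        conj∈A : g ⁻¹ ∙ h ∙ g ∈ A k
        conj∈A = trans (◦-∙ (g ⁻¹ ∙ h) g _) (trans (◦-∙ (g ⁻¹) h _) (◦-⁻¹ g (sym (trans (cong (h ◦_) (sym M≡gℓ)) (trans hM M≡gℓ)))))
        g⁻¹hg∈A : ⟨ g , h ⟩ ∈ A k
        g⁻¹hg∈A = ∈-cancelˡ (A k) h∈A (≡∈ (A k) (conj≡ h g) conj∈A)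

    -- The centraliser of `h`, of order s², acts transitively on these points. The stabiliser of
    -- `uₖ k` in it is `A* k`, of order s t, which commutes with `h` since `A k` is abelian and `S`
    -- central.
    ∣Fixed-on∣ : ∀ k h → h ∈ A k → h ≢ ε → # (Fixed-on? k h) * t ≡ s
    ∣Fixed-on∣ k h h∈A h≢ε = *-cancelˡ-≡ _ _ (s * t) {{m*n≢0 s t {{s≢0}} {{t≢0}}}} (begin
      s * t * (b * t)        ≡⟨ sym (*-assoc (s * t) b t) ⟩
      s * t * b * t          ≡⟨ cong (_* t) (trans count (*-identityˡ _)) ⟩
      # (commuting? h) * t   ≡⟨ ∣centraliser∣ h∈A h≢ε ⟩
      n                      ≡⟨ n≡sst ⟩
      s * (s * t)            ≡⟨ *-comm s (s * t) ⟩
      s * t * s              ∎)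
      where
      open ≡-Reasoning
      s≢0 : NonZero s
      s≢0 = >-nonZero (≤-trans (s≤s z≤n) (proj₁ thick))
      t≢0 : NonZero t
      t≢0 = >-nonZero (≤-trans (s≤s z≤n) (proj₂ thick))
      b = # (Fixed-on? k h)
      R? : ∀ p g → Dec (g • uₖ k ≡ p)
      R? p g = g • uₖ k ≟ p
      A*-commutes : ∀ {g} → g ∈ A* k → ⟨ h , g ⟩ ≡ ε
      A*-commutes {g} g∈A* = from (split k g∈A*)
        where
        from : (∃ λ σ → σ ∈ S × g ∙ σ ⁻¹ ∈ A k) → ⟨ h , g ⟩ ≡ ε
        from (σ , σ∈S , q) = trans (cong ⟨ h ,_⟩ (solve (g ∷ σ ∷ []) x₀ (x₀ ⊙ inv x₁ ⊙ x₁) refl))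
          (trans (⟨⟩-∙ h (g ∙ σ ⁻¹) σ) (trans (cong₂ _∙_ (KantorTheory.A-abelian kantor k h∈A q) (S-central h σ∈S)) (identityˡ ε)))
      coset : ∀ p → (∃ λ g → ⟨ h , g ⟩ ≡ ε × g • uₖ k ≡ p) → # (row (Fixed-on? k h) (commuting? h) R? p) ≡ s * t
      coset p (g₀ , c₀ , refl) = trans (#-cong (row (Fixed-on? k h) (commuting? h) R? p) (λ g → mem? (A* k) (g₀ ⁻¹ ∙ g))
          (λ { g (_ , e) → trans (•-∙ (g₀ ⁻¹) g _) (•-⁻¹ g₀ (sym e)) })
          (λ g q → trans (cong ⟨ h ,_⟩ (g≡ g)) (trans (⟨⟩-∙ h g₀ (g₀ ⁻¹ ∙ g)) (trans (cong₂ _∙_ c₀ (A*-commutes q)) (identityˡ ε)))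
                 , trans (cong (_• uₖ k) (g≡ g)) (trans (•-∙ g₀ (g₀ ⁻¹ ∙ g) _) (cong (g₀ •_) q))))
        (trans (#-translateˡ (mem? (A* k)) (g₀ ⁻¹)) (∣A*∣ k))
        where
        g≡ : ∀ g → g ≡ g₀ ∙ (g₀ ⁻¹ ∙ g)
        g≡ g = solve (g₀ ∷ g ∷ []) x₁ (x₀ ⊙ (inv x₀ ⊙ x₁)) refl
      count : s * t * b ≡ 1 * # (commuting? h)
      count = double-≡ (Fixed-on? k h) (commuting? h) R? (s * t) 1
        (λ p f → coset p (fixed⇒commuting k h h∈A f))
        (λ g c → #-unique (col (Fixed-on? k h) (commuting? h) R? g) (commuting⇒fixed k h h∈A g c , refl) (λ p → sym ∘ proj₂))

    -- If `M` met another line `Λ j`, then `h` would fix the meeting point, by (*) every point of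
    -- `Λ j`, and so lie in `A k` and `A* j`.
    fixed-lines-meet-Λ : ∀ k h → h ∈ A k → h ≢ ε → ∀ M → ¬ x I M → h ◦ M ≡ M → ∃ λ p → p I M × Fixed-on k h p
    fixed-lines-meet-Λ k h h∈A h≢ε M x∉M hM = from (affine-point-on x∉M)
      where
      from : (∃ λ y → Affine y × y I M) → ∃ λ p → p I M × Fixed-on k h p
      from (y , y-aff , y∈M) = along (line-through y-aff y∈M)
        where
        along : (∃ λ j → M ≡ At.ℓ y y-aff j) → ∃ λ p → p I M × Fixed-on k h p
        along (j , refl) = by (j ≟ k)
          where
          v = At.u y y-aff j
          v∈Λ = At.u∈Λ y y-aff j
          v∈M = At.u∈ℓ y y-aff j
          v-fixed : h • v ≡ v
          v-fixed = sym (At.u-unique y y-aff j (Λ-preserved {⟪ h ⟫} (E-⟪⟫ h) j v∈Λ) (M , y∈M , subst ((h • v) I_) hM (map-I ⟪ h ⟫ v∈M)))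
          by : Dec (j ≡ k) → ∃ λ p → p I M × Fixed-on k h p
          by (yes refl) = v , v∈M , v∈Λ , M , x∉M , v∈M , hM
          by (no j≢k) = contradiction (A∩A* (λ e → j≢k (sym e)) h∈A
            (star ⟪ h ⟫ (E-⟪⟫ h) v (At.x-u y y-aff j) (At.u≢x y y-aff j) v-fixed (Λ j) (x∈Λ j) v∈Λ (uₖ j) (At.u∈Λ y₀ y₀-aff j))) h≢ε

    central⇔𝕊 : ∀ α → (E α × (∀ β → E β → Commute α β)) ⇔ 𝕊 α
    central⇔𝕊 α = mk⇔
      (λ { (α∈E , c) → 𝕊ᵍ.resp {⟪ name {α} α∈E ⟫} {α} (≈A-sym {α} {⟪ name {α} α∈E ⟫} (⟪name⟫ {α} α∈E)) (centre⊆S (name {α} α∈E) (λ g → comm⇒⟨⟩≡ε (injective (begin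
        elem (name {α} α∈E ∙ g)        ≡⟨ trans (elem-· _ g) (cong (name {α} α∈E •_) (sym (•-y₀ g))) ⟩
        name {α} α∈E • g • y₀          ≡⟨ sym (proj₁ (⟪name⟫ {α} α∈E) _) ⟩
        ap α (g • y₀)                  ≡⟨ proj₁ (c ⟪ g ⟫ (E-⟪⟫ g)) y₀ ⟩
        g • ap α y₀                    ≡⟨ cong (g •_) (proj₁ (⟪name⟫ {α} α∈E) y₀) ⟩
        g • name {α} α∈E • y₀          ≡⟨ sym (trans (elem-· g _) (cong (g •_) (sym (•-y₀ (name {α} α∈E))))) ⟩
        elem (g ∙ name {α} α∈E)        ∎)))) })
      (λ p → 𝕊⊆H α p , λ β β∈E → commute β β∈E p)
      where
      open ≡-Reasoning
      commute : ∀ β → E β → 𝕊 α → Commute α β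
      commute β β∈E p = (λ q → trans (cong (ap α) (proj₁ gβ q)) (trans (proj₁ hα (g • q)) (trans (sym (•-∙ h g q)) (trans (cong (_• q) hg) (trans (•-∙ g h q) (sym (trans (cong (ap β) (proj₁ hα q)) (proj₁ gβ (h • q)))))))))
                     , (λ M → trans (cong (al α) (proj₂ gβ M)) (trans (proj₂ hα (g ◦ M)) (trans (sym (◦-∙ h g M)) (trans (cong (_◦ M) hg) (trans (◦-∙ g h M) (sym (trans (cong (al β) (proj₂ hα M)) (proj₂ gβ (h ◦ M)))))))))
        where
        α∈E = 𝕊⊆H α p
        h = name {α} α∈E
        g = name {β} β∈E
        hα : α ≈A ⟪ h ⟫
        hα = ⟪name⟫ {α} α∈E
        gβ : β ≈A ⟪ g ⟫
        gβ = ⟪name⟫ {β} β∈E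
        hg : h ∙ g ≡ g ∙ h
        hg = sym (commutes-with-S g (name∈S {α} α∈E p))

  -- A base point for the statement on the centre, where no affine line is given.
  affine-point : ∃ Affine
  affine-point = from (#-witness Q? (s≤s⁻¹ (≤-trans (≤-trans (proj₁ thick) (n≤1+n s))
      (≤-reflexive (trans (sym (CardIs⇒# (λ p → I? p (Λ zero)) (linePts (Λ zero)))) (#-remove (λ p → I? p (Λ zero)) (x∈Λ zero)))))))
    where
    Q? : Decidable (λ p → p I Λ zero × p ≢ x)
    Q? p = I? p (Λ zero) ×-dec ¬? (p ≟ x)
    from : (∃ λ p → p I Λ zero × p ≢ x) → ∃ Affine
    from (p , p∈Λ , p≢x) = line (#-witness M? (s≤s⁻¹ (≤-trans (≤-trans (proj₂ thick) (n≤1+n t))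
        (≤-reflexive (trans (sym (CardIs⇒# (I? p) (ptLines p))) (#-remove (I? p) p∈Λ))))))
      where
      M? : Decidable (λ M → p I M × M ≢ Λ zero)
      M? M = I? p M ×-dec ¬? (M ≟ Λ zero)
      line : (∃ λ M → p I M × M ≢ Λ zero) → ∃ Affine
      line (M , p∈M , M≢Λ) = proj₁ y , proj₁ (proj₂ y)
        where y = affine-point-on {M} (λ x∈M → p≢x (same-point p∈M x∈M p∈Λ (x∈Λ zero) M≢Λ))

  -- With the base point on `L`, the line is one of the `ℓₖ k` and its stabiliser is a component.
  module OnLine (L : Ln) (nx : ¬ x I L) where
    y₀ : Pt
    y₀ = proj₁ (affine-point-on nx)
    y₀-aff : Affine y₀
    y₀-aff = proj₁ (proj₂ (affine-point-on nx))
    y₀∈L : y₀ I L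
    y₀∈L = proj₂ (proj₂ (affine-point-on nx))

    open Based y₀ y₀-aff
    open WithBase y₀ y₀-aff
    open FinGroupTheory 𝔾 using (ε)

    k : Fin (suc t)
    k = proj₁ (line-through y₀-aff y₀∈L)
    L≡ℓ : L ≡ ℓₖ k
    L≡ℓ = proj₂ (line-through y₀-aff y₀∈L)

    projPt≡u : projPt x L nx ≡ uₖ k
    projPt≡u = proj₂ (gqAxiom x L nx) (uₖ k) (subst (uₖ k I_) (sym L≡ℓ) (At.u∈ℓ y₀ y₀-aff k)) (At.x-u y₀ y₀-aff k)

    projLn≡Λ : projLn x L nx ≡ Λ k
    projLn≡Λ = same-line (proj₁ (proj₂ (proj₂ (proj₂ (proj₁ (gqAxiom x L nx))))))
      (subst (_I projLn x L nx) projPt≡u (proj₂ (proj₂ (proj₂ (proj₂ (proj₁ (gqAxiom x L nx))))))) (x∈Λ k) (At.u∈Λ y₀ y₀-aff k)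
      (λ e → At.u≢x y₀ y₀-aff k (sym e))

    module _ (α : Aut 𝒢) (α∈E : E α) (αL : al α L ≡ L) where
      h = name {α} α∈E

      α≡h : ∀ M → al α M ≡ h ◦ M
      α≡h = proj₂ (⟪name⟫ {α} α∈E)

      h∈A : FinGroupTheory._∈_ 𝔾 h (A k)
      h∈A = subst (λ M → h ◦ M ≡ M) L≡ℓ (trans (sym (α≡h L)) αL)

      statement-i : ∀ M → projPt x L nx I M → al α M ≡ M
      statement-i M p∈M = trans (α≡h M) (fixes-pencil k h h∈A M (subst (_I M) projPt≡u p∈M))

      module _ (α≢id : ¬ IsIdA α) where

        h≢ε : h ≢ ε
        h≢ε e = α≢id ((λ p → trans (proj₁ (⟪name⟫ {α} α∈E) p) (trans (cong (_• p) e) (•-ε p)))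
                     , (λ M → trans (α≡h M) (trans (cong (_◦ M) e) (◦-ε M))))

        fixed⇒bracket : ∀ {p} → Fixed-on k h p → Bracket gq x L nx α p
        fixed⇒bracket {p} (p∈Λ , M , x∉M , p∈M , hM) = subst (p I_) (sym projLn≡Λ) p∈Λ , M , x∉M , p∈M , trans (α≡h M) hM

        bracket⇒fixed : ∀ {p} → Bracket gq x L nx α p → Fixed-on k h p
        bracket⇒fixed {p} (p∈Λ , M , x∉M , p∈M , αM) = subst (p I_) projLn≡Λ p∈Λ , M , x∉M , p∈M , trans (sym (α≡h M)) αM

        bracket : CardIs (Bracket gq x L nx α) (# (Fixed-on? k h))
        bracket = CardIs-⇔ (λ _ → fixed⇒bracket) (λ _ → bracket⇒fixed) (#⇒CardIs (Fixed-on? k h))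

        statement-ii : (Σ ℕ λ k → CardIs (Bracket gq x L nx α) k × k * t ≡ s)
                     × (s ≡ t → ∀ M → (¬ x I M × al α M ≡ M) ⇔ (projPt x L nx I M × M ≢ projLn x L nx))
        statement-ii = (_ , bracket , ∣Fixed-on∣ k h h∈A h≢ε) , λ s≡t M → mk⇔
          (λ { (x∉M , αM) → through-u s≡t M x∉M αM , λ e → x∉M (subst (x I_) (sym (trans e projLn≡Λ)) (x∈Λ k)) })
          (λ { (p∈M , M≢) → (λ x∈M → M≢ (trans (same-line x∈M (subst (_I M) projPt≡u p∈M) (x∈Λ k) (At.u∈Λ y₀ y₀-aff k)
                                              (λ e → At.u≢x y₀ y₀-aff k (sym e))) (sym projLn≡Λ)))
                           , statement-i M p∈M })
          where
          one-point : s ≡ t → # (Fixed-on? k h) ≡ 1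
          one-point s≡t = *-cancelʳ-≡ _ 1 t {{>-nonZero (≤-trans (s≤s z≤n) (proj₂ thick))}}
            (trans (∣Fixed-on∣ k h h∈A h≢ε) (trans s≡t (sym (*-identityˡ t))))
          -- For `s = t` the bracket has a single point, and `uₖ k` belongs to it by way of `ℓₖ k`,
          -- that is `L` itself.
          through-u : s ≡ t → ∀ M → ¬ x I M → al α M ≡ M → projPt x L nx I M
          through-u s≡t M x∉M αM = from (fixed-lines-meet-Λ k h h∈A h≢ε M x∉M (trans (sym (α≡h M)) αM))
            where
            from : (∃ λ p → p I M × Fixed-on k h p) → projPt x L nx I M
            from (p , p∈M , f) = subst (_I M) (trans (#≡1⇒unique (Fixed-on? k h) (one-point s≡t) f
              (At.u∈Λ y₀ y₀-aff k , ℓₖ k , At.x∉ℓ y₀ y₀-aff k , At.u∈ℓ y₀ y₀-aff k , h∈A)) (sym projPt≡u)) p∈M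

mainTheorem3 : (S : IncStr) (s t : ℕ) (G : IsGQ S s t) → Thick s t → (s ≡ t → s % 2 ≡ 1) →
    (x : IncStr.Pt S) (H 𝕊 : Aut S → Set) → IsSTGQ x H 𝕊 t → Star x H →
    ((L : IncStr.Ln S) (nx : ¬ IncStr._I_ S x L) (α : Aut S) → H α → Aut.al α L ≡ L →
    ∀ M → IncStr._I_ S (IsGQ.projPt G x L nx) M → Aut.al α M ≡ M)
    ×
    ((L : IncStr.Ln S) (nx : ¬ IncStr._I_ S x L) (α : Aut S) → H α → Aut.al α L ≡ L → ¬ IsIdA α →
    (Σ ℕ λ k → CardIs (Bracket G x L nx α) k × k * t ≡ s)
    × (s ≡ t → ∀ M →
    (¬ IncStr._I_ S x M × Aut.al α M ≡ M)
    ⇔ (IncStr._I_ S (IsGQ.projPt G x L nx) M × M ≢ IsGQ.projLn G x L nx)))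
    ×
    (∀ α → (H α × (∀ β → H β → Commute α β)) ⇔ 𝕊 α)
mainTheorem3 S s t G thick s-odd x H 𝕊 stgq star =
    (λ L nx α α∈H αL → OnLine.statement-i L nx α α∈H αL)
  , (λ L nx α α∈H αL α≢id → OnLine.statement-ii L nx α α∈H αL α≢id)
  , WithBase.central⇔𝕊 (proj₁ affine-point) (proj₂ affine-point)
  where
  t-odd : s ≡ t → ¬ 2 ∣ t
  t-odd s≡t 2∣t = contradiction (trans (sym (s-odd s≡t)) (n∣m⇒m%n≡0 s 2 (subst (2 ∣_) (sym s≡t) 2∣t))) λ ()
  open Conclusions S s t G thick t-odd x H 𝕊 stgq star
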